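{- Let $k\geq 1$ and let $n=p_0p_1p_2\cdots p_k$, where $p_0=2<p_1<p_2<\dots<p_k$ are distinct primes. Suppose that the $n$-th cyclotomic polynomial $\Phi_n(x)$ is flat. Let $\zeta_n\in\mathbb{C}$ be a primitive $n$-th root of unity. Then $\Phi_n^T(\zeta_n)=0$ is a minimal vanishing sum of $n$-th roots of unity.
   Context: $\Phi_n(x)$ denotes the $n$-th cyclotomic polynomial. It is called flat if the maximum absolute value of its coefficients is $1$ (i.e. all its coefficients lie in $\{ -1,0,1\}$). For even $n$ with $\Phi_n(x)$ flat, write uniquely $\Phi_n(x)=f_1(x)-f_2(x)$, where $f_1,f_2$ are polynomials all of whose nonzero coefficients are positive (hence equal to $1$) and no power of $x$ occurs in both $f_1$ and $f_2$. Define $\Phi_n^T(x)=f_1(x)+x^{n/2}f_2(x)$, a polynomial with coefficients in $\{0,1\}$. A vanishing sum of (distinct) $n$-th roots of unity is an equation $\zeta_n^{k_1}+\dots+\zeta_n^{k_l}=0$ with $l\ge 1$ and distinct $k_1,\dots,k_l\in\{0,1,\dots,n-1\}$. It is minimal if no proper nonempty sub-sum is zero. For a polynomial $f$ with coefficients in $\{0,1\}$ and degree at most $n-1$, saying that $f(\zeta_n)=0$ is a (minimal) vanishing sum refers to the sum of the roots of unity $\zeta_n^e$ over all exponents $e$ occurring in $f$. -}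

module Defs where

open import Algebra.Bundles.Raw using (RawRing)
import Algebra.Definitions.RawSemiring as RawSemiringDefs
open import Data.Bool.Base using (if_then_else_)
open import Data.Fin.Base using (Fin; toℕ)
open import Data.Fin.Properties using (toℕ<n)
open import Data.Fin.Subset using (Subset; Nonempty; _⊂_)
open import Data.Integer.Base as ℤ using (ℤ; 0ℤ; 1ℤ; -1ℤ)
import Data.Integer.Properties as ℤ
open import Data.List.Base using (List; []; _∷_; _++_; map; foldr; filter; allFin; length; replicate)
open import Data.Nat.Base as ℕ using (ℕ; zero; suc; pred)
open import Data.Nat.Divisibility using (_∣?_)
open import Data.Nat.DivMod using (_/_)
open import Data.Nat.Induction using (<-rec)
import Data.Nat.Properties as ℕ
open import Data.Product.Base using (∃; _×_; _,_; proj₁; proj₂)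
open import Data.Rational.Base as ℚ using (ℚ; 0ℚ; 1ℚ; ½; ∣_∣)
import Data.Rational.Properties as ℚ
open import Data.Rational.Solver using (module +-*-Solver)
open import Data.Sum.Base using (_⊎_)
import Data.Vec.Base as Vec
open import Level using (0ℓ)
open import Relation.Binary.PropositionalEquality
  using (_≡_; refl; sym; trans; cong; subst)
open import Relation.Nullary using (¬_; does; yes; no)

------------------------------------------------------------------------
-- Polynomials over ℤ

-- Coefficient lists, constant term first.  Trailing zeros are allowed, so
-- everything below depends on a list only through its coefficients.

Poly : Set
Poly = List ℤ

coeff : Poly → ℕ → ℤ
coeff []      _       = 0ℤ
coeff (a ∷ f) zero    = a
coeff (a ∷ f) (suc i) = coeff f i

infixl 6 _+ₚ_ _-ₚ_
infixl 7 _*ₚ_ _·ₚ_ _quot_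

_+ₚ_ : Poly → Poly → Poly
[]      +ₚ g       = g
f       +ₚ []      = f
(a ∷ f) +ₚ (b ∷ g) = a ℤ.+ b ∷ f +ₚ g

_·ₚ_ : ℤ → Poly → Poly
c ·ₚ f = map (c ℤ.*_) f

_-ₚ_ : Poly → Poly → Poly
f -ₚ g = f +ₚ (-1ℤ ·ₚ g)

_*ₚ_ : Poly → Poly → Poly
[]      *ₚ g = []
(a ∷ f) *ₚ g = (a ·ₚ g) +ₚ (0ℤ ∷ f *ₚ g)

1ₚ : Poly
1ₚ = 1ℤ ∷ []

X^_*ₚ_ : ℕ → Poly → Poly
X^ n *ₚ f = replicate n 0ℤ ++ f

trim : Poly → Poly
trim [] = []
trim (a ∷ f) with trim f
... | b ∷ g = a ∷ b ∷ g
... | []    with a ℤ.≟ 0ℤ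
...   | yes _ = []
...   | no  _ = a ∷ []

-- The zero polynomial gets degree 0.
degree : Poly → ℕ
degree f = pred (length (trim f))

-- Quotient and remainder of division by a monic polynomial g.
-- If f = q g + r with deg r < deg g, then a + X f = (X q) g + (a + X r), and
-- a + X r has degree at most deg g, so one multiple of g remains to be removed.
-- The result is meaningless when g is not monic.
quotRem : Poly → Poly → Poly × Poly
quotRem []      g = [] , []
quotRem (a ∷ f) g = step (quotRem f g)
  where
  step : Poly × Poly → Poly × Poly
  step (q , r) = c ∷ q , (a ∷ r) -ₚ (c ·ₚ g)
    where
    c : ℤ
    c = coeff (a ∷ r) (degree g)

_quot_ : Poly → Poly → Poly
f quot g = proj₁ (quotRem f g)

------------------------------------------------------------------------
-- Cyclotomic polynomials

-- Φ n is determined by Xⁿ - 1 = ∏_{d ∣ n} Φ d for n ≥ 1: it is the (exact)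
-- quotient of Xⁿ - 1 by the product of the Φ d over the divisors d < n of n.
-- The value at n = 0 is irrelevant.
Φ : ℕ → Poly
Φ = <-rec (λ _ → Poly) λ n Φ<n →
  ((X^ n *ₚ 1ₚ) -ₚ 1ₚ)
    quot foldr _*ₚ_ 1ₚ (map (λ d → Φ<n (toℕ<n d)) (filter (λ d → toℕ d ∣? n) (allFin n)))

height : Poly → ℕ
height f = foldr ℕ._⊔_ 0 (map ℤ.∣_∣ f)

Flat : Poly → Set
Flat f = height f ≡ 1

-- f = posPart f - negPart f is the unique way to write f as a difference of
-- polynomials with nonnegative coefficients and disjoint supports.
posPart negPart : Poly → Poly
posPart = map (λ a → a ℤ.⊔ 0ℤ)
negPart = map (λ a → (ℤ.- a) ℤ.⊔ 0ℤ)

Φᵀ : ℕ → Poly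
Φᵀ n = posPart (Φ n) +ₚ (X^ (n / 2) *ₚ negPart (Φ n))

------------------------------------------------------------------------
-- Real and complex numbers

Cauchy : (ℕ → ℚ) → Set
Cauchy x = ∀ ε → 0ℚ ℚ.< ε →
  ∃ λ N → ∀ m n → N ℕ.≤ m → N ℕ.≤ n → ∣ x m ℚ.- x n ∣ ℚ.< ε

record ℝ : Set where
  constructor mkℝ
  field
    seq    : ℕ → ℚ
    cauchy : Cauchy seq

open ℝ public

infix 4 _≈ℝ_

_≈ℝ_ : ℝ → ℝ → Set
x ≈ℝ y = ∀ ε → 0ℚ ℚ.< ε → ∃ λ N → ∀ n → N ℕ.≤ n → ∣ seq x n ℚ.- seq y n ∣ ℚ.< ε

private
  open +-*-Solver

  pos*pos : ∀ {p q} → 0ℚ ℚ.< p → 0ℚ ℚ.< q → 0ℚ ℚ.< p ℚ.* q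
  pos*pos {p} {q} 0<p 0<q = subst (ℚ._< p ℚ.* q) (ℚ.*-zeroʳ p)
    (ℚ.*-monoʳ-<-pos p {{ℚ.positive 0<p}} 0<q)

  0<½ : 0ℚ ℚ.< ½
  0<½ = ℚ.positive⁻¹ ½

  halves : ∀ ε → ε ℚ.* ½ ℚ.+ ε ℚ.* ½ ≡ ε
  halves ε = trans (sym (ℚ.*-distribˡ-+ ε ½ ½)) (ℚ.*-identityʳ ε)

  cauchy-const : ∀ q → Cauchy (λ _ → q)
  cauchy-const q ε 0<ε =
    0 , λ _ _ _ _ → subst (λ z → ∣ z ∣ ℚ.< ε) (sym (ℚ.+-inverseʳ q)) 0<ε

  cauchy-+ : ∀ {x y} → Cauchy x → Cauchy y → Cauchy (λ n → x n ℚ.+ y n)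
  cauchy-+ {x} {y} cx cy ε 0<ε
    with cx (ε ℚ.* ½) (pos*pos 0<ε 0<½) | cy (ε ℚ.* ½) (pos*pos 0<ε 0<½)
  ... | M , hx | N , hy = M ℕ.⊔ N , λ m n m≥ n≥ → begin-strict
    ∣ (x m ℚ.+ y m) ℚ.- (x n ℚ.+ y n) ∣
      ≡⟨ cong ∣_∣ (solve 4 (λ a b c d → (a :+ b) :- (c :+ d) := (a :- c) :+ (b :- d))
           refl (x m) (y m) (x n) (y n)) ⟩
    ∣ (x m ℚ.- x n) ℚ.+ (y m ℚ.- y n) ∣
      ≤⟨ ℚ.∣p+q∣≤∣p∣+∣q∣ (x m ℚ.- x n) (y m ℚ.- y n) ⟩
    ∣ x m ℚ.- x n ∣ ℚ.+ ∣ y m ℚ.- y n ∣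
      <⟨ ℚ.+-mono-< (hx m n (ℕ.m⊔n≤o⇒m≤o M N m≥) (ℕ.m⊔n≤o⇒m≤o M N n≥))
                    (hy m n (ℕ.m⊔n≤o⇒n≤o M N m≥) (ℕ.m⊔n≤o⇒n≤o M N n≥)) ⟩
    ε ℚ.* ½ ℚ.+ ε ℚ.* ½
      ≡⟨ halves ε ⟩
    ε ∎
    where open ℚ.≤-Reasoning

  cauchy-neg : ∀ {x} → Cauchy x → Cauchy (λ n → ℚ.- x n)
  cauchy-neg {x} cx ε 0<ε with cx ε 0<ε
  ... | N , hx = N , λ m n m≥ n≥ → subst (ℚ._< ε)
    (trans (sym (ℚ.∣-p∣≡∣p∣ (x m ℚ.- x n)))
           (cong ∣_∣ (ℚ.neg-distrib-+ (x m) (ℚ.- x n))))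
    (hx m n m≥ n≥)

  EventuallyBounded : (ℕ → ℚ) → Set
  EventuallyBounded x = ∃ λ B → 0ℚ ℚ.< B × ∃ λ N → ∀ n → N ℕ.≤ n → ∣ x n ∣ ℚ.≤ B

  cauchy⇒bounded : ∀ {x} → Cauchy x → EventuallyBounded x
  cauchy⇒bounded {x} cx with cx 1ℚ (ℚ.positive⁻¹ 1ℚ)
  ... | N , hx = 1ℚ ℚ.+ ∣ x N ∣ , ℚ.+-mono-<-≤ (ℚ.positive⁻¹ 1ℚ) (ℚ.0≤∣p∣ (x N)) ,
                 N , λ n n≥ → begin
    ∣ x n ∣
      ≡⟨ cong ∣_∣ (solve 2 (λ a b → a := (a :- b) :+ b) refl (x n) (x N)) ⟩
    ∣ (x n ℚ.- x N) ℚ.+ x N ∣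
      ≤⟨ ℚ.∣p+q∣≤∣p∣+∣q∣ (x n ℚ.- x N) (x N) ⟩
    ∣ x n ℚ.- x N ∣ ℚ.+ ∣ x N ∣
      ≤⟨ ℚ.+-monoˡ-≤ ∣ x N ∣ (ℚ.<⇒≤ (hx n N n≥ ℕ.≤-refl)) ⟩
    1ℚ ℚ.+ ∣ x N ∣ ∎
    where open ℚ.≤-Reasoning

  ∣*∣<* : ∀ {p q A δ} → 0ℚ ℚ.< A → ∣ p ∣ ℚ.≤ A → ∣ q ∣ ℚ.< δ → ∣ p ℚ.* q ∣ ℚ.< A ℚ.* δ
  ∣*∣<* {p} {q} {A} {δ} 0<A p≤A q<δ = begin-strict
    ∣ p ℚ.* q ∣       ≡⟨ ℚ.∣p*q∣≡∣p∣*∣q∣ p q ⟩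
    ∣ p ∣ ℚ.* ∣ q ∣   ≤⟨ ℚ.*-monoʳ-≤-nonNeg ∣ q ∣ {{ℚ.∣-∣-nonNeg q}} p≤A ⟩
    A ℚ.* ∣ q ∣       <⟨ ℚ.*-monoʳ-<-pos A {{ℚ.positive 0<A}} q<δ ⟩
    A ℚ.* δ           ∎
    where open ℚ.≤-Reasoning

  product-difference : ∀ a b c d →
    a ℚ.* b ℚ.- c ℚ.* d ≡ a ℚ.* (b ℚ.- d) ℚ.+ d ℚ.* (a ℚ.- c)
  product-difference =
    solve 4 (λ a b c d → a :* b :- c :* d := a :* (b :- d) :+ d :* (a :- c)) refl

  ∣*-*∣< : ∀ {a b c d A B δ} → 0ℚ ℚ.< A → 0ℚ ℚ.< B → ∣ a ∣ ℚ.≤ A → ∣ d ∣ ℚ.≤ B →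
    ∣ a ℚ.- c ∣ ℚ.< δ → ∣ b ℚ.- d ∣ ℚ.< δ →
    ∣ a ℚ.* b ℚ.- c ℚ.* d ∣ ℚ.< (A ℚ.+ B) ℚ.* δ
  ∣*-*∣< {a} {b} {c} {d} {A} {B} {δ} 0<A 0<B a≤A d≤B ac bd = begin-strict
    ∣ a ℚ.* b ℚ.- c ℚ.* d ∣
      ≡⟨ cong ∣_∣ (product-difference a b c d) ⟩
    ∣ a ℚ.* (b ℚ.- d) ℚ.+ d ℚ.* (a ℚ.- c) ∣
      ≤⟨ ℚ.∣p+q∣≤∣p∣+∣q∣ (a ℚ.* (b ℚ.- d)) (d ℚ.* (a ℚ.- c)) ⟩
    ∣ a ℚ.* (b ℚ.- d) ∣ ℚ.+ ∣ d ℚ.* (a ℚ.- c) ∣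
      <⟨ ℚ.+-mono-< (∣*∣<* {a} {b ℚ.- d} 0<A a≤A bd) (∣*∣<* {d} {a ℚ.- c} 0<B d≤B ac) ⟩
    A ℚ.* δ ℚ.+ B ℚ.* δ
      ≡⟨ sym (ℚ.*-distribʳ-+ δ A B) ⟩
    (A ℚ.+ B) ℚ.* δ ∎
    where open ℚ.≤-Reasoning

  quotient : ∀ {C ε} → 0ℚ ℚ.< C → 0ℚ ℚ.< ε → ∃ λ δ → 0ℚ ℚ.< δ × C ℚ.* δ ≡ ε
  quotient {C} {ε} 0<C 0<ε =
    (ℚ.1/ C) ℚ.* ε ,
    pos*pos (ℚ.positive⁻¹ (ℚ.1/ C) {{ℚ.1/pos⇒pos C}}) 0<ε ,
    trans (sym (ℚ.*-assoc C (ℚ.1/ C) ε))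
          (trans (cong (ℚ._* ε) (ℚ.*-inverseʳ C)) (ℚ.*-identityˡ ε))
    where
    instance
      C-pos : ℚ.Positive C
      C-pos = ℚ.positive 0<C
      C-nonZero : ℚ.NonZero C
      C-nonZero = ℚ.pos⇒nonZero C

  module _ {x y : ℕ → ℚ} where

    cauchy-*-bounded : ∀ {A B δ ε K L M N} →
      0ℚ ℚ.< A → (∀ n → K ℕ.≤ n → ∣ x n ∣ ℚ.≤ A) →
      0ℚ ℚ.< B → (∀ n → L ℕ.≤ n → ∣ y n ∣ ℚ.≤ B) →
      (A ℚ.+ B) ℚ.* δ ≡ ε →
      (∀ m n → M ℕ.≤ m → M ℕ.≤ n → ∣ x m ℚ.- x n ∣ ℚ.< δ) →
      (∀ m n → N ℕ.≤ m → N ℕ.≤ n → ∣ y m ℚ.- y n ∣ ℚ.< δ) →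
      ∀ m n → (K ℕ.⊔ L) ℕ.⊔ (M ℕ.⊔ N) ℕ.≤ m → (K ℕ.⊔ L) ℕ.⊔ (M ℕ.⊔ N) ℕ.≤ n →
      ∣ x m ℚ.* y m ℚ.- x n ℚ.* y n ∣ ℚ.< ε
    cauchy-*-bounded {A} {B} {δ} {ε} {K} {L} {M} {N} 0<A bx 0<B by eq hx hy m n m≥ n≥ =
      subst (∣ x m ℚ.* y m ℚ.- x n ℚ.* y n ∣ ℚ.<_) eq
        (∣*-*∣< {x m} {y m} {x n} {y n} 0<A 0<B
          (bx m (ℕ.m⊔n≤o⇒m≤o K L (≥KL m≥)))
          (by n (ℕ.m⊔n≤o⇒n≤o K L (≥KL n≥)))
          (hx m n (ℕ.m⊔n≤o⇒m≤o M N (≥MN m≥)) (ℕ.m⊔n≤o⇒m≤o M N (≥MN n≥)))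
          (hy m n (ℕ.m⊔n≤o⇒n≤o M N (≥MN m≥)) (ℕ.m⊔n≤o⇒n≤o M N (≥MN n≥))))
      where
      ≥KL : ∀ {o} → (K ℕ.⊔ L) ℕ.⊔ (M ℕ.⊔ N) ℕ.≤ o → K ℕ.⊔ L ℕ.≤ o
      ≥KL = ℕ.m⊔n≤o⇒m≤o (K ℕ.⊔ L) (M ℕ.⊔ N)
      ≥MN : ∀ {o} → (K ℕ.⊔ L) ℕ.⊔ (M ℕ.⊔ N) ℕ.≤ o → M ℕ.⊔ N ℕ.≤ o
      ≥MN = ℕ.m⊔n≤o⇒n≤o (K ℕ.⊔ L) (M ℕ.⊔ N)

    -- The helpers avoid with-abstraction, which would normalise the rational
    -- expressions in the goal.
    cauchy-* : Cauchy x → Cauchy y → Cauchy (λ n → x n ℚ.* y n)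
    cauchy-* cx cy ε 0<ε = bounds (cauchy⇒bounded cx) (cauchy⇒bounded cy)
      where
      Modulus : (ℕ → ℚ) → ℚ → Set
      Modulus z η = ∃ λ N → ∀ m n → N ℕ.≤ m → N ℕ.≤ n → ∣ z m ℚ.- z n ∣ ℚ.< η

      bounds : EventuallyBounded x → EventuallyBounded y → Modulus (λ n → x n ℚ.* y n) ε
      bounds (A , 0<A , K , bx) (B , 0<B , L , by) = scale (quotient (ℚ.+-mono-< 0<A 0<B) 0<ε)
        where
        combine : ∀ {δ} → (A ℚ.+ B) ℚ.* δ ≡ ε → Modulus x δ → Modulus y δ →
                  Modulus (λ n → x n ℚ.* y n) ε
        combine eq (M , hx) (N , hy) =
          (K ℕ.⊔ L) ℕ.⊔ (M ℕ.⊔ N) , cauchy-*-bounded 0<A bx 0<B by eq hx hy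

        scale : (∃ λ δ → 0ℚ ℚ.< δ × (A ℚ.+ B) ℚ.* δ ≡ ε) → Modulus (λ n → x n ℚ.* y n) ε
        scale (δ , 0<δ , eq) = combine eq (cx δ 0<δ) (cy δ 0<δ)

infix  8 -ℝ_
infixl 7 _*ℝ_
infixl 6 _+ℝ_

fromℚ : ℚ → ℝ
fromℚ q = mkℝ (λ _ → q) (cauchy-const q)

_+ℝ_ _*ℝ_ : ℝ → ℝ → ℝ
x +ℝ y = mkℝ (λ n → seq x n ℚ.+ seq y n) (cauchy-+ {seq x} {seq y} (cauchy x) (cauchy y))
x *ℝ y = mkℝ (λ n → seq x n ℚ.* seq y n) (cauchy-* {seq x} {seq y} (cauchy x) (cauchy y))

-ℝ_ : ℝ → ℝ
-ℝ x = mkℝ (λ n → ℚ.- seq x n) (cauchy-neg {seq x} (cauchy x))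

record ℂ : Set where
  constructor _+i_
  field
    re im : ℝ

open ℂ public

ℂ-rawRing : RawRing 0ℓ 0ℓ
ℂ-rawRing = record
  { Carrier = ℂ
  ; _≈_     = λ z w → re z ≈ℝ re w × im z ≈ℝ im w
  ; _+_     = λ z w → (re z +ℝ re w) +i (im z +ℝ im w)
  ; _*_     = λ z w → ((re z *ℝ re w) +ℝ (-ℝ (im z *ℝ im w)))
                   +i ((re z *ℝ im w) +ℝ (im z *ℝ re w))
  ; -_      = λ z → (-ℝ re z) +i (-ℝ im z)
  ; 0#      = fromℚ 0ℚ +i fromℚ 0ℚ
  ; 1#      = fromℚ 1ℚ +i fromℚ 0ℚ
  }

open RawRing ℂ-rawRing using (_≈_; 0#; 1#; rawSemiring)
open RawSemiringDefs rawSemiring using (_^_; sum)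

------------------------------------------------------------------------
-- Vanishing sums of roots of unity

IsPrimitiveRoot : ℕ → ℂ → Set
IsPrimitiveRoot n ζ = ζ ^ n ≈ 1# × (∀ m → 0 ℕ.< m → m ℕ.< n → ¬ (ζ ^ m ≈ 1#))

-- A set of distinct exponents k₁, …, k_l in {0, …, n-1} is a Subset n.
rootSum : ∀ {n} → ℂ → Subset n → ℂ
rootSum ζ S = sum λ k → if Vec.lookup S k then ζ ^ toℕ k else 0#

IsVanishing : ∀ {n} → ℂ → Subset n → Set
IsVanishing ζ S = Nonempty S × rootSum ζ S ≈ 0#

IsMinimalVanishing : ∀ {n} → ℂ → Subset n → Set
IsMinimalVanishing ζ S =
  IsVanishing ζ S × (∀ T → T ⊂ S → Nonempty T → ¬ (rootSum ζ T ≈ 0#))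

exponents : ∀ n → Poly → Subset n
exponents n f = Vec.tabulate λ k → does (coeff f (toℕ k) ℤ.≟ 1ℤ)

-- "f(ζ) = 0 is a minimal vanishing sum of n-th roots of unity".  The first two
-- components ensure that f is the sum of the Xᵉ over e in exponents n f.
MinimalVanishingSum : ℕ → ℂ → Poly → Set
MinimalVanishingSum n ζ f =
    (∀ i → coeff f i ≡ 0ℤ ⊎ coeff f i ≡ 1ℤ)
  × (∀ i → n ℕ.≤ i → coeff f i ≡ 0ℤ)
  × IsMinimalVanishing ζ (exponents n f)

{-
Since ζᵐ = -1 for m = n / 2, a set T of exponents of Φₙᵀ has ζ-sum h(ζ), where the coefficients of
h are those of Φₙ on the exponents selected by T and 0 elsewhere.  For the full set h = Φₙ, so the
sum vanishes.  For a proper nonempty T one of h and Φₙ - h has degree less than deg Φₙ, neither is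
zero, and both vanish at ζ if the sum of T does: this contradicts the minimality of deg Φₙ.

Minimality is Landau's proof of the irreducibility of Φₙ.  Let f have minimal degree among the
nonzero integer polynomials vanishing at ζ.  As f(Xᵖ) ≡ f(X)ᵖ modulo p, the remainder of f(Xᵖ) on
division by f is, up to powers of the leading coefficient of f, divisible by p; but its value at ζ
depends only on p modulo n, so f(ζᵖ) = 0 for all large primes p.
Every a coprime to n is congruent modulo n to a product of large primes, so f(ζᵃ) = 0, and f times
the product of the Φ_d for proper divisors d of n vanishes at all powers of ζ.  Hence its degree is
at least n, and deg f ≥ deg Φₙ.

That Φₙ is the exact quotient of Xⁿ - 1 by that product follows from the coprimality over ℚ of Φ_a
and Φ_b for a < b: with g = gcd(a, b), the polynomial Φ_b divides (Xᵇ - 1) / (Xᵍ - 1), which is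
congruent to b / g modulo Xᵍ - 1, and Xᵍ - 1 lies in the ideal of Xᵃ - 1 and Xᵇ - 1.

Equality of complex numbers is not decidable, but the argument uses ℂ only as a commutative ring of
characteristic 0 in which ab = 0 and a ≠ 0 imply b = 0.
-}

module Submission where

open import Defs
open import Algebra.Bundles using (CommutativeRing; RawRing)
import Algebra.Solver.Ring
open import Algebra.Solver.Ring.AlmostCommutativeRing using (fromCommutativeRing; _-Raw-AlmostCommutative⟶_)
open import Algebra.Structures using (IsCommutativeRing)
open import Data.Bool.Base using (true; false; if_then_else_)
open import Data.Fin.Base as Fin using (Fin; zero; suc; toℕ; fromℕ; fromℕ<; inject₁)
import Data.Fin.Properties as Fin
open import Data.Fin.Subset using (Subset; _∈_; _∉_; _⊆_; _⊂_; Nonempty)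
open import Data.Integer.Base as ℤ using (ℤ; 0ℤ; 1ℤ; -1ℤ; +_; -[1+_])
import Data.Integer.Properties as ℤ
open import Data.Integer.Solver using () renaming (module +-*-Solver to ℤ-Solver)
open import Data.List.Base using (List; []; _∷_; map; length; filter; allFin; take; drop)
import Data.List.Base as List
import Data.List.Properties as List
open import Data.List.Relation.Unary.All as All using (All; []; _∷_)
open import Data.Maybe.Base using (Maybe; just; nothing)
open import Data.Nat.Base as ℕ using (ℕ; zero; suc; pred; _!)
open import Data.Nat.Coprimality as Coprime using (Coprime; coprime?; coprime-divisor; gcd≡1⇒coprime)
open import Data.Nat.Divisibility as ℕ∣ using (divides; _∣?_) renaming (_∣_ to _∣ⁿ_)
open import Data.Nat.DivMod using (_/_; _%_; m*n/n≡m; m/n*n≡m; m≡m%n+[m/n]*n; m%n<n)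
open import Data.Nat.GCD using (gcd; gcd-GCD; gcd[m,n]∣m; gcd[m,n]∣n; gcd[m,n]≡0⇒m≡0; gcd[m,n]≡0⇒n≡0; module Bézout)
open import Data.Nat.Induction using (<-rec; <-wellFounded)
open import Data.Nat.ListAction using (product)
open import Data.Nat.ListAction.Properties using (∈⇒∣product)
open import Data.Nat.Primality using (Prime; euclidsLemma; prime⇒nonZero; prime⇒nonTrivial; prime⇒irreducible; prime[2])
open import Data.Nat.Primality.Factorisation using (factorise; module PrimeFactorisation)
import Data.Nat.Properties as ℕ
open import Data.Product.Base using (∃; ∃₂; _×_; _,_; proj₁; proj₂)
open import Data.Rational.Base as ℚ using (ℚ; 0ℚ; 1ℚ; ½)
import Data.Rational.Properties as ℚ
open import Data.Rational.Solver using () renaming (module +-*-Solver to ℚ-Solver)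
open import Data.Sum.Base using (_⊎_; inj₁; inj₂; [_,_]′)
open import Data.Vec.Base as Vec using ([]; _∷_; lookup)
open import Data.Vec.Functional using (Vector)
import Data.Vec.Functional as Vector
import Data.Vec.Properties as Vec
open import Function.Base using (_∘_)
open import Induction.WellFounded using (module FixPoint)
open import Level using (0ℓ)
open import Relation.Binary.PropositionalEquality as ≡ using (_≡_; _≢_; cong; cong₂; subst)
open import Relation.Nullary using (Dec; yes; no; ¬_; contradiction; does)
open import Relation.Nullary.Decidable using (dec-true)

-- Folding needs deg Φₙ < n / 2: only then do f₁ and X^(n/2) f₂ occupy disjoint ranges of exponents,
-- so that each coefficient of h depends on one exponent of T. For n = 2m with m odd and m > 1 the
-- bound holds because X + 1 and Φₙ are coprime and both divide Xᵐ + 1 over ℚ; the factor X + 1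
-- makes the inequality strict.
--
-- Everything takes place over ℤ, without ℚ[X] and without Gauss's lemma. Coprimality is a Bézout
-- identity with a nonzero integer constant, divisibility over ℚ is divisibility up to such a
-- constant, and f, which is not known to be monic, is divided by pseudo-division. Division by a
-- monic polynomial removes the constants again.
--
-- In Landau's proof "large" has to be fixed before p is chosen. This is possible because f(ζᵖ) =
-- f(ζᵃ) for a = p mod n: only the remainders of the n polynomials f(Xᵃ) with a < n matter, and p
-- has to exceed their coefficients and the leading coefficient of f.
--
-- No polynomial of minimal degree is ever selected: an induction on a degree bound provides the
-- minimality at each degree.

-- Integer scalars in a commutative ring

module IntegerScalars (R : CommutativeRing 0ℓ 0ℓ) where
  open CommutativeRing R hiding (zero)
  open import Algebra.Properties.Monoid.Mult.TCOptimised +-monoid using (×-homo-+) renaming (_×_ to _×′_)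
  open import Algebra.Properties.Semiring.Mult.TCOptimised semiring using (×1-homo-*)
  open import Algebra.Properties.Ring ring
    using (-‿distribˡ-*; -‿distribʳ-*; -0#≈0#; -‿involutive; -‿+-comm)
  open import Relation.Binary.Reasoning.Setoid setoid

  -- The canonical homomorphism from ℤ. With the optimised multiples `ι 1ℤ` reduces to `1#`, so
  -- `con 1ℤ` in the solver is `1#` by definition.
  ι : ℤ → Carrier
  ι (+ n)    = n ×′ 1#
  ι -[1+ n ] = - (suc n ×′ 1#)

  ι-neg : ∀ i → ι (ℤ.- i) ≈ - ι i
  ι-neg -[1+ n ]    = sym (-‿involutive _)
  ι-neg (+ zero)    = sym -0#≈0#
  ι-neg (+ (suc n)) = refl

  ι-1+ : ∀ n → suc n ×′ 1# ≈ 1# + n ×′ 1#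
  ι-1+ n = ×-homo-+ 1# 1 n

  ι-⊖ : ∀ m n → ι (m ℤ.⊖ n) ≈ m ×′ 1# + - (n ×′ 1#)
  ι-⊖ m zero = begin
    ι (m ℤ.⊖ 0)           ≡⟨ ≡.cong ι (ℤ.⊖-≥ {m} {0} ℕ.z≤n) ⟩
    m ×′ 1#               ≈⟨ +-identityʳ _ ⟨
    m ×′ 1# + 0#          ≈⟨ +-congˡ -0#≈0# ⟨
    m ×′ 1# + - 0#        ∎
  ι-⊖ zero (suc n) = sym (+-identityˡ _)
  ι-⊖ (suc m) (suc n) = begin
    ι (suc m ℤ.⊖ suc n)                         ≡⟨ ≡.cong ι (ℤ.[1+m]⊖[1+n]≡m⊖n m n) ⟩
    ι (m ℤ.⊖ n)                                 ≈⟨ ι-⊖ m n ⟩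
    a + - b                                     ≈⟨ +-congʳ (+-identityʳ _) ⟨
    (a + 0#) + - b                              ≈⟨ +-congʳ (+-congˡ (-‿inverseʳ 1#)) ⟨
    (a + (1# + - 1#)) + - b                     ≈⟨ +-congʳ (+-assoc _ _ _) ⟨
    ((a + 1#) + - 1#) + - b                     ≈⟨ +-assoc _ _ _ ⟩
    (a + 1#) + (- 1# + - b)                     ≈⟨ +-cong (+-comm a 1#) (-‿+-comm 1# b) ⟩
    (1# + a) + - (1# + b)                       ≈⟨ +-cong (ι-1+ m) (-‿cong (ι-1+ n)) ⟨
    suc m ×′ 1# + - (suc n ×′ 1#)               ∎
    where
    a b : Carrier
    a = m ×′ 1#
    b = n ×′ 1#

  ι-+ : ∀ i j → ι (i ℤ.+ j) ≈ ι i + ι j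
  ι-+ -[1+ m ] -[1+ n ] = begin
    - (suc (suc (m ℕ.+ n)) ×′ 1#)          ≡⟨ ≡.cong (λ k → - (suc k ×′ 1#)) (ℕ.+-suc m n) ⟨
    - ((suc m ℕ.+ suc n) ×′ 1#)            ≈⟨ -‿cong (×-homo-+ 1# (suc m) (suc n)) ⟩
    - (suc m ×′ 1# + suc n ×′ 1#)          ≈⟨ -‿+-comm _ _ ⟨
    - (suc m ×′ 1#) + - (suc n ×′ 1#)      ∎
  ι-+ -[1+ m ] (+ n)    = trans (ι-⊖ n (suc m)) (+-comm _ _)
  ι-+ (+ m)    -[1+ n ] = ι-⊖ m (suc n)
  ι-+ (+ m)    (+ n)    = ×-homo-+ 1# m n

  ι-*⁺ : ∀ i n → ι (i ℤ.* + n) ≈ ι i * ι (+ n)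
  ι-*⁺ (+ m) n = begin
    ι (+ m ℤ.* + n)       ≡⟨ ≡.cong ι (ℤ.pos-* m n) ⟨
    (m ℕ.* n) ×′ 1#       ≈⟨ ×1-homo-* m n ⟩
    ι (+ m) * ι (+ n)     ∎
  ι-*⁺ -[1+ m ] n = begin
    ι (-[1+ m ] ℤ.* + n)             ≡⟨ ≡.cong ι (ℤ.neg-distribˡ-* (+ suc m) (+ n)) ⟨
    ι (ℤ.- (+ suc m ℤ.* + n))        ≈⟨ ι-neg (+ suc m ℤ.* + n) ⟩
    - ι (+ suc m ℤ.* + n)            ≈⟨ -‿cong (ι-*⁺ (+ suc m) n) ⟩
    - (ι (+ suc m) * ι (+ n))        ≈⟨ -‿distribˡ-* _ _ ⟩
    - ι (+ suc m) * ι (+ n)          ∎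

  ι-* : ∀ i j → ι (i ℤ.* j) ≈ ι i * ι j
  ι-* i (+ n) = ι-*⁺ i n
  ι-* i -[1+ n ] = begin
    ι (i ℤ.* -[1+ n ])               ≡⟨ ≡.cong ι (ℤ.neg-distribʳ-* i (+ suc n)) ⟨
    ι (ℤ.- (i ℤ.* + suc n))          ≈⟨ ι-neg (i ℤ.* + suc n) ⟩
    - ι (i ℤ.* + suc n)              ≈⟨ -‿cong (ι-*⁺ i (suc n)) ⟩
    - (ι i * ι (+ suc n))            ≈⟨ -‿distribʳ-* _ _ ⟩
    ι i * - ι (+ suc n)              ∎

  private
    morphism : ℤ.+-*-rawRing -Raw-AlmostCommutative⟶ fromCommutativeRing R
    morphism = record
      { ⟦_⟧    = ι
      ; +-homo = ι-+
      ; *-homo = ι-*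
      ; -‿homo = ι-neg
      ; 0-homo = refl
      ; 1-homo = refl
      }

    ι-≟ : ∀ i j → Maybe (ι i ≈ ι j)
    ι-≟ i j with i ℤ.≟ j
    ... | yes ≡.refl = just refl
    ... | no _       = nothing

  module Solver = Algebra.Solver.Ring ℤ.+-*-rawRing (fromCommutativeRing R) morphism ι-≟

-- Prime divisors of binomial coefficients

module BinomialDivisibility where
  open import Data.Nat.Combinatorics using (_C_; k![n∸k]!∣n!; nCn≡1)
  open import Data.Nat.Combinatorics.Specification using (nCk≡n!/k![n-k]!)

  prime∤! : ∀ {p} → Prime p → ∀ k → k ℕ.< p → ¬ p ∣ⁿ k !
  prime∤! p-prime zero    k<p p∣1 = contradiction (ℕ∣.∣⇒≤ p∣1)
      (ℕ.<⇒≱ (ℕ.nonTrivial⇒n>1 _ {{prime⇒nonTrivial p-prime}}))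
  prime∤! p-prime (suc k) k<p p∣  with euclidsLemma (suc k) (k !) p-prime p∣
  ... | inj₁ p∣k+1 = contradiction (ℕ∣.∣⇒≤ p∣k+1) (ℕ.<⇒≱ k<p)
  ... | inj₂ p∣k!  = prime∤! p-prime k (ℕ.<-trans (ℕ.n<1+n k) k<p) p∣k!

  -- The prime p divides p!, the product of the binomial coefficient with k! and (p - k)!, but
  -- neither of these factorials.
  prime∣C : ∀ {p k} → Prime p → 0 ℕ.< k → k ℕ.< p → p ∣ⁿ p C k
  prime∣C {p@(suc p-1)} {k} p-prime 0<k k<p = [ (λ p∣C → p∣C) , (λ p∣d → contradiction p∣d p∤d) ]′
    (euclidsLemma (p C k) d p-prime (≡.subst (p ∣ⁿ_) (≡.sym C*d≡p!) (ℕ∣.m∣m*n (p-1 !))))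
    where
    k≤p = ℕ.<⇒≤ k<p
    d = k ! ℕ.* (p ℕ.∸ k) !
    instance
      _ = ℕ.m*n≢0 (k !) ((p ℕ.∸ k) !) {{k ℕ.!≢0}} {{(p ℕ.∸ k) ℕ.!≢0}}
    C*d≡p! : (p C k) ℕ.* d ≡ p !
    C*d≡p! = ≡.trans (≡.cong (ℕ._* d) (nCk≡n!/k![n-k]! k≤p)) (m/n*n≡m (k![n∸k]!∣n! k≤p))
    p∤d : ¬ p ∣ⁿ d
    p∤d p∣d with euclidsLemma (k !) ((p ℕ.∸ k) !) p-prime p∣d
    ... | inj₁ p∣k! = prime∤! p-prime k k<p p∣k!
    ... | inj₂ p∣   = prime∤! p-prime (p ℕ.∸ k) (ℕ.∸-monoʳ-< 0<k k≤p) p∣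

open BinomialDivisibility

-- Powers of sums and geometric sums

module PowerIdentities (R : CommutativeRing 0ℓ 0ℓ) where
  open CommutativeRing R hiding (zero)
  open import Data.Nat.Combinatorics using (_C_; nCn≡1)
  open IntegerScalars R using (module Solver)
  open import Algebra.Properties.Semiring.Exp semiring
  open import Algebra.Properties.Monoid.Mult +-monoid public using () renaming
      (_×_ to _⨯_; ×-assocˡ to ⨯-assocˡ; ×-congˡ to ⨯-congˡ; ×-homo-1 to ⨯-homo-1)
  open import Algebra.Properties.CommutativeSemiring.Binomial commutativeSemiring using
      (theorem; binomialTerm; binomial)
  open import Algebra.Properties.Semiring.Sum semiring using (sum; sum-init-last)
  open import Relation.Binary.Reasoning.Setoid setoid

  sum-multiple : ∀ p {n} (t : Fin n → Carrier) → (∀ i → ∃ λ z → t i ≈ p ⨯ z) → ∃ λ z → sum t ≈ p ⨯ z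
  sum-multiple p {zero}  t h = 0# , go p
    where
    go : ∀ p → 0# ≈ p ⨯ 0#
    go zero    = refl
    go (suc p) = trans (go p) (sym (+-identityˡ _))
  sum-multiple p {suc n} t h with h zero | sum-multiple p (λ i → t (suc i)) (λ i → h (suc i))
  ... | z , t₀≈ | w , rest≈ = z + w , trans (+-cong t₀≈ rest≈) (go p)
    where
    open Solver
    go : ∀ p → p ⨯ z + p ⨯ w ≈ p ⨯ (z + w)
    go zero = +-identityˡ _
    go (suc p) = trans
      (solve 4 (λ z a w b → ((z :+ a) :+ (w :+ b)) := ((z :+ w) :+ (a :+ b))) refl z (p ⨯ z) w (p ⨯ w))
      (+-congˡ (go p))

  -- All terms of the binomial sum except the two outer ones are multiples of p. Since p is at least
  -- 2, the outer terms can be split off separately.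
  frobenius : ∀ {p} → Prime p → ∀ x y → ∃ λ z → (x + y) ^ p ≈ x ^ p + y ^ p + p ⨯ z
  frobenius {suc zero} p-prime with () ← prime⇒nonTrivial p-prime
  frobenius {p@(suc (suc q))} p-prime x y = z , (begin
    (x + y) ^ p                                      ≈⟨ theorem p x y ⟩
    t zero + sum (λ i → t (suc i))                   ≈⟨ +-congˡ (sum-init-last (λ i → t (suc i))) ⟩
    t zero + (sum t′ + t (fromℕ p))                  ≈⟨ +-cong first (+-cong (proj₂ middle) last) ⟩
    y ^ p + (p ⨯ z + x ^ p)
      ≈⟨ solve 3 (λ a b c → (a :+ (b :+ c)) := ((c :+ a) :+ b)) refl (y ^ p) (p ⨯ z) (x ^ p) ⟩
    x ^ p + y ^ p + p ⨯ z                            ∎)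
    where
    open Solver using (solve; _:=_; _:+_)
    t : Fin (suc p) → Carrier
    t = binomialTerm x y p
    t′ : Fin (suc q) → Carrier
    t′ i = t (suc (inject₁ i))
    middle : ∃ λ z → sum t′ ≈ p ⨯ z
    middle = sum-multiple p t′ λ i → multiple i (prime∣C {p} {suc (toℕ (inject₁ i))} p-prime (ℕ.s≤s ℕ.z≤n)
      (≡.subst (λ j → suc j ℕ.< p) (≡.sym (Fin.toℕ-inject₁ i)) (ℕ.s<s (Fin.toℕ<n i))))
      where
      multiple : ∀ i → p ∣ⁿ p C suc (toℕ (inject₁ i)) → ∃ λ z → t′ i ≈ p ⨯ z
      multiple i (divides c eq) = c ⨯ b , trans (⨯-congˡ (≡.trans eq (ℕ.*-comm c p))) (sym (⨯-assocˡ b p c))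
        where b = binomial x y p (suc (inject₁ i))
    z : Carrier
    z = proj₁ middle
    first : t zero ≈ y ^ p
    first = trans (⨯-homo-1 _) (*-identityˡ _)
    last : t (fromℕ p) ≈ x ^ p
    last = begin
      (p C toℕ (fromℕ p)) ⨯ (x ^ toℕ (fromℕ p) * y ^ (p ℕ.∸ toℕ (fromℕ p)))
        ≡⟨ ≡.cong (λ k → (p C k) ⨯ (x ^ k * y ^ (p ℕ.∸ k))) (Fin.toℕ-fromℕ p) ⟩
      (p C p) ⨯ (x ^ p * y ^ (p ℕ.∸ p))
        ≡⟨ ≡.cong₂ (λ c k → c ⨯ (x ^ p * y ^ k)) (nCn≡1 p) (ℕ.n∸n≡0 p) ⟩
      1 ⨯ (x ^ p * 1#) ≈⟨ trans (⨯-homo-1 _) (*-identityʳ _) ⟩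
      x ^ p ∎

  -- Here s is 1 + y + ... + y^(k-1). Each of its k terms is 1 modulo y - 1, whence the second
  -- relation.
  geometric : ∀ y k → ∃₂ λ s t → (y ^ k - 1# ≈ (y - 1#) * s) × (s ≈ k ⨯ 1# + (y - 1#) * t)
  geometric y zero = 0# , 0# , solve 1 (λ y → (con 1ℤ :- con 1ℤ) := ((y :- con 1ℤ) :* con 0ℤ)) refl y
                   , solve 1 (λ y → con 0ℤ := (con 0ℤ :+ ((y :- con 1ℤ) :* con 0ℤ))) refl y
    where open Solver
  geometric y (suc k) with geometric y k
  ... | s , t , y^k-1≈ , s≈ = 1# + y * s , s + t , (begin
    y * y ^ k - 1#
      ≈⟨ solve 2 (λ y a → ((y :* a) :- con 1ℤ) := ((y :- con 1ℤ) :+ (y :* (a :- con 1ℤ)))) refl y (y ^ k) ⟩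
    (y - 1#) + y * (y ^ k - 1#)       ≈⟨ +-congˡ (*-congˡ y^k-1≈) ⟩
    (y - 1#) + y * ((y - 1#) * s)
      ≈⟨ solve 2 (λ y s → ((y :- con 1ℤ) :+ (y :* ((y :- con 1ℤ) :* s))) :=
          ((y :- con 1ℤ) :* (con 1ℤ :+ (y :* s)))) refl y s ⟩
    (y - 1#) * (1# + y * s) ∎) , (begin
    1# + y * s
      ≈⟨ solve 2 (λ y s → (con 1ℤ :+ (y :* s)) := ((con 1ℤ :+ s) :+ ((y :- con 1ℤ) :* s))) refl y s ⟩
    (1# + s) + (y - 1#) * s ≈⟨ +-congʳ (+-congˡ s≈) ⟩
    (1# + (k ⨯ 1# + (y - 1#) * t)) + (y - 1#) * s
      ≈⟨ solve 4 (λ y s t a → ((con 1ℤ :+ (a :+ ((y :- con 1ℤ) :* t))) :+ ((y :- con 1ℤ) :* s)) :=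
          ((con 1ℤ :+ a) :+ ((y :- con 1ℤ) :* (s :+ t)))) refl y s t (k ⨯ 1#) ⟩
    (1# + k ⨯ 1#) + (y - 1#) * (s + t) ∎)
    where open Solver

-- The ring of integer polynomials

module PolynomialRing where
  open ≡ using (refl; sym; trans)

  infix 4 _≋_

  -- A record instead of a plain function type, so that `f` and `g` can be inferred from a proof of
  -- `f ≋ g`.
  record _≋_ (f g : Poly) : Set where
    constructor mk≋
    field at : ∀ i → coeff f i ≡ coeff g i

  open _≋_ public

  coeff-+ : ∀ f g i → coeff (f +ₚ g) i ≡ coeff f i ℤ.+ coeff g i
  coeff-+ []      g       i       = sym (ℤ.+-identityˡ _)
  coeff-+ (a ∷ f) []      i       = sym (ℤ.+-identityʳ _)
  coeff-+ (a ∷ f) (b ∷ g) zero    = refl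
  coeff-+ (a ∷ f) (b ∷ g) (suc i) = coeff-+ f g i

  coeff-· : ∀ c f i → coeff (c ·ₚ f) i ≡ c ℤ.* coeff f i
  coeff-· c []      i       = sym (ℤ.*-zeroʳ c)
  coeff-· c (a ∷ f) zero    = refl
  coeff-· c (a ∷ f) (suc i) = coeff-· c f i

  coeff-∷* : ∀ a f g i → coeff ((a ∷ f) *ₚ g) i ≡ a ℤ.* coeff g i ℤ.+ coeff (0ℤ ∷ f *ₚ g) i
  coeff-∷* a f g i = trans (coeff-+ (a ·ₚ g) (0ℤ ∷ f *ₚ g) i) (cong (ℤ._+ coeff (0ℤ ∷ f *ₚ g) i) (coeff-· a g i))

  ≋-refl : ∀ {f} → f ≋ f
  ≋-refl = mk≋ λ _ → refl

  ≋-sym : ∀ {f g} → f ≋ g → g ≋ f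
  ≋-sym e = mk≋ λ i → sym (at e i)

  ≋-trans : ∀ {f g h} → f ≋ g → g ≋ h → f ≋ h
  ≋-trans d e = mk≋ λ i → trans (at d i) (at e i)

  ∷-cong : ∀ {a b f g} → a ≡ b → f ≋ g → a ∷ f ≋ b ∷ g
  ∷-cong a≡b f≋g = mk≋ λ { zero → a≡b ; (suc i) → at f≋g i }

  tail-≋ : ∀ {a b f g} → a ∷ f ≋ b ∷ g → f ≋ g
  tail-≋ e = mk≋ λ i → at e (suc i)

  tail-≋[] : ∀ {a f} → a ∷ f ≋ [] → f ≋ []
  tail-≋[] e = mk≋ λ i → at e (suc i)

  0∷[] : ∀ {f} → f ≋ [] → 0ℤ ∷ f ≋ []
  0∷[] e = mk≋ λ { zero → refl ; (suc i) → at e i }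

  +ₚ-cong : ∀ {f f′ g g′} → f ≋ f′ → g ≋ g′ → f +ₚ g ≋ f′ +ₚ g′
  +ₚ-cong {f} {f′} {g} {g′} d e = mk≋ λ i →
    trans (coeff-+ f g i) (trans (cong₂ ℤ._+_ (at d i) (at e i)) (sym (coeff-+ f′ g′ i)))

  ·ₚ-cong : ∀ {a b f g} → a ≡ b → f ≋ g → a ·ₚ f ≋ b ·ₚ g
  ·ₚ-cong {a} {b} {f} {g} d e = mk≋ λ i →
    trans (coeff-· a f i) (trans (cong₂ ℤ._*_ d (at e i)) (sym (coeff-· b g i)))

  *ₚ-zeroˡ : ∀ {f} g → f ≋ [] → f *ₚ g ≋ []
  *ₚ-zeroˡ {[]}    g e = ≋-refl
  *ₚ-zeroˡ {a ∷ f} g e = mk≋ λ i → trans (coeff-∷* a f g i)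
    (cong₂ ℤ._+_ (cong (ℤ._* coeff g i) (at e 0)) (at (0∷[] (*ₚ-zeroˡ g (tail-≋[] e))) i))

  *ₚ-cong : ∀ {f f′ g g′} → f ≋ f′ → g ≋ g′ → f *ₚ g ≋ f′ *ₚ g′
  *ₚ-cong {[]}    {f′}     {g} {g′} d e = ≋-sym (*ₚ-zeroˡ g′ (≋-sym d))
  *ₚ-cong {a ∷ f} {[]}     {g} {g′} d e = *ₚ-zeroˡ g d
  *ₚ-cong {a ∷ f} {b ∷ f′} d e =
    +ₚ-cong (·ₚ-cong (at d 0) e) (∷-cong refl (*ₚ-cong {f} {f′} (tail-≋ d) e))

  private
    open ℤ-Solver

    +ₚ-assoc : ∀ f g h → (f +ₚ g) +ₚ h ≋ f +ₚ (g +ₚ h)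
    +ₚ-assoc f g h = mk≋ λ i → begin
      coeff ((f +ₚ g) +ₚ h) i                      ≡⟨ coeff-+ (f +ₚ g) h i ⟩
      coeff (f +ₚ g) i ℤ.+ coeff h i               ≡⟨ cong (ℤ._+ _) (coeff-+ f g i) ⟩
      (coeff f i ℤ.+ coeff g i) ℤ.+ coeff h i      ≡⟨ ℤ.+-assoc (coeff f i) _ _ ⟩
      coeff f i ℤ.+ (coeff g i ℤ.+ coeff h i)      ≡⟨ cong (λ z → coeff f i ℤ.+ z) (coeff-+ g h i) ⟨
      coeff f i ℤ.+ coeff (g +ₚ h) i               ≡⟨ coeff-+ f (g +ₚ h) i ⟨
      coeff (f +ₚ (g +ₚ h)) i                      ∎
      where open ≡.≡-Reasoning

    +ₚ-comm : ∀ f g → f +ₚ g ≋ g +ₚ f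
    +ₚ-comm f g = mk≋ λ i →
      trans (coeff-+ f g i) (trans (ℤ.+-comm (coeff f i) _) (sym (coeff-+ g f i)))

    +ₚ-identityʳ : ∀ f → f +ₚ [] ≋ f
    +ₚ-identityʳ f = mk≋ λ i → trans (coeff-+ f [] i) (ℤ.+-identityʳ _)

    +ₚ-inverseʳ : ∀ f → f +ₚ (-1ℤ ·ₚ f) ≋ []
    +ₚ-inverseʳ f = mk≋ λ i → trans (coeff-+ f (-1ℤ ·ₚ f) i)
      (trans (cong (λ z → coeff f i ℤ.+ z) (coeff-· -1ℤ f i))
        (solve 1 (λ a → a :+ con -1ℤ :* a := con 0ℤ) refl (coeff f i)))

    *ₚ-distribʳ : ∀ h f g → (f +ₚ g) *ₚ h ≋ f *ₚ h +ₚ g *ₚ h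
    *ₚ-distribʳ h []      g       = ≋-refl
    *ₚ-distribʳ h (a ∷ f) []      = ≋-sym (+ₚ-identityʳ _)
    *ₚ-distribʳ h (a ∷ f) (b ∷ g) = mk≋ λ i → begin
      coeff ((a ℤ.+ b ∷ f +ₚ g) *ₚ h) i
        ≡⟨ coeff-∷* (a ℤ.+ b) (f +ₚ g) h i ⟩
      (a ℤ.+ b) ℤ.* coeff h i ℤ.+ coeff (0ℤ ∷ (f +ₚ g) *ₚ h) i
        ≡⟨ cong (λ z → (a ℤ.+ b) ℤ.* coeff h i ℤ.+ z) (trans (at (∷-cong {0ℤ} refl (*ₚ-distribʳ h f g)) i)
             (coeff-+ (0ℤ ∷ f *ₚ h) (0ℤ ∷ g *ₚ h) i)) ⟩
      (a ℤ.+ b) ℤ.* coeff h i ℤ.+ (coeff (0ℤ ∷ f *ₚ h) i ℤ.+ coeff (0ℤ ∷ g *ₚ h) i)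
        ≡⟨ solve 5 (λ a b c d e → (a :+ b) :* c :+ (d :+ e) := (a :* c :+ d) :+ (b :* c :+ e)) refl
             a b (coeff h i) (coeff (0ℤ ∷ f *ₚ h) i) (coeff (0ℤ ∷ g *ₚ h) i) ⟩
      (a ℤ.* coeff h i ℤ.+ coeff (0ℤ ∷ f *ₚ h) i) ℤ.+ (b ℤ.* coeff h i ℤ.+ coeff (0ℤ ∷ g *ₚ h) i)
        ≡⟨ cong₂ ℤ._+_ (coeff-∷* a f h i) (coeff-∷* b g h i) ⟨
      coeff ((a ∷ f) *ₚ h) i ℤ.+ coeff ((b ∷ g) *ₚ h) i
        ≡⟨ coeff-+ ((a ∷ f) *ₚ h) ((b ∷ g) *ₚ h) i ⟨
      coeff ((a ∷ f) *ₚ h +ₚ (b ∷ g) *ₚ h) i ∎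
      where open ≡.≡-Reasoning

    0∷-*ₚ : ∀ f g → (0ℤ ∷ f) *ₚ g ≋ 0ℤ ∷ f *ₚ g
    0∷-*ₚ f g = mk≋ λ i → trans (coeff-∷* 0ℤ f g i) (ℤ.+-identityˡ _)

    -- The mirror image of the recursion that defines the product; it makes commutativity an
    -- induction on one factor.
    *ₚ-∷ : ∀ f b g → f *ₚ (b ∷ g) ≋ b ·ₚ f +ₚ (0ℤ ∷ f *ₚ g)
    *ₚ-∷ []      b g = ≋-sym (0∷[] ≋-refl)
    *ₚ-∷ (a ∷ f) b g = mk≋ λ
      { zero    → cong (ℤ._+ 0ℤ) (ℤ.*-comm a b)
      ; (suc i) → begin
          coeff (a ·ₚ g +ₚ f *ₚ (b ∷ g)) i
            ≡⟨ coeff-+ (a ·ₚ g) (f *ₚ (b ∷ g)) i ⟩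
          coeff (a ·ₚ g) i ℤ.+ coeff (f *ₚ (b ∷ g)) i
            ≡⟨ cong (λ z → coeff (a ·ₚ g) i ℤ.+ z) (trans (at (*ₚ-∷ f b g) i) (coeff-+ (b ·ₚ f) (0ℤ ∷ f *ₚ g) i)) ⟩
          coeff (a ·ₚ g) i ℤ.+ (coeff (b ·ₚ f) i ℤ.+ coeff (0ℤ ∷ f *ₚ g) i)
            ≡⟨ solve 3 (λ x y z → x :+ (y :+ z) := y :+ (x :+ z)) refl
                 (coeff (a ·ₚ g) i) (coeff (b ·ₚ f) i) (coeff (0ℤ ∷ f *ₚ g) i) ⟩
          coeff (b ·ₚ f) i ℤ.+ (coeff (a ·ₚ g) i ℤ.+ coeff (0ℤ ∷ f *ₚ g) i)
            ≡⟨ cong (λ z → coeff (b ·ₚ f) i ℤ.+ z) (coeff-+ (a ·ₚ g) (0ℤ ∷ f *ₚ g) i) ⟨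
          coeff (b ·ₚ f) i ℤ.+ coeff ((a ∷ f) *ₚ g) i
            ≡⟨ coeff-+ (b ·ₚ f) ((a ∷ f) *ₚ g) i ⟨
          coeff (b ·ₚ f +ₚ (a ∷ f) *ₚ g) i ∎
      }
      where open ≡.≡-Reasoning

    *ₚ-comm : ∀ f g → f *ₚ g ≋ g *ₚ f
    *ₚ-comm []      g = ≋-sym (zeroʳ g)
      where
      zeroʳ : ∀ g → g *ₚ [] ≋ []
      zeroʳ []      = ≋-refl
      zeroʳ (b ∷ g) = 0∷[] (zeroʳ g)
    *ₚ-comm (a ∷ f) g = ≋-trans (+ₚ-cong (≋-refl {a ·ₚ g}) (∷-cong refl (*ₚ-comm f g))) (≋-sym (*ₚ-∷ g a f))

    ·ₚ-*ₚ : ∀ c f g → c ·ₚ (f *ₚ g) ≋ (c ·ₚ f) *ₚ g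
    ·ₚ-*ₚ c []      g = ≋-refl
    ·ₚ-*ₚ c (a ∷ f) g = mk≋ λ i → begin
      coeff (c ·ₚ ((a ∷ f) *ₚ g)) i
        ≡⟨ coeff-· c ((a ∷ f) *ₚ g) i ⟩
      c ℤ.* coeff ((a ∷ f) *ₚ g) i
        ≡⟨ cong (c ℤ.*_) (coeff-∷* a f g i) ⟩
      c ℤ.* (a ℤ.* coeff g i ℤ.+ coeff (0ℤ ∷ f *ₚ g) i)
        ≡⟨ solve 4 (λ c a x y → c :* (a :* x :+ y) := (c :* a) :* x :+ c :* y) refl c a (coeff g i) _ ⟩
      (c ℤ.* a) ℤ.* coeff g i ℤ.+ c ℤ.* coeff (0ℤ ∷ f *ₚ g) i
        ≡⟨ cong (λ z → (c ℤ.* a) ℤ.* coeff g i ℤ.+ z) (shift i) ⟩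
      (c ℤ.* a) ℤ.* coeff g i ℤ.+ coeff (0ℤ ∷ (c ·ₚ f) *ₚ g) i
        ≡⟨ coeff-∷* (c ℤ.* a) (c ·ₚ f) g i ⟨
      coeff ((c ·ₚ (a ∷ f)) *ₚ g) i ∎
      where
      open ≡.≡-Reasoning
      shift : ∀ i → c ℤ.* coeff (0ℤ ∷ f *ₚ g) i ≡ coeff (0ℤ ∷ (c ·ₚ f) *ₚ g) i
      shift zero    = ℤ.*-zeroʳ c
      shift (suc i) = trans (sym (coeff-· c (f *ₚ g) i)) (at (·ₚ-*ₚ c f g) i)

    *ₚ-assoc : ∀ f g h → (f *ₚ g) *ₚ h ≋ f *ₚ (g *ₚ h)
    *ₚ-assoc []      g h = ≋-refl
    *ₚ-assoc (a ∷ f) g h = ≋-trans (*ₚ-distribʳ h (a ·ₚ g) (0ℤ ∷ f *ₚ g))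
      (+ₚ-cong (≋-sym (·ₚ-*ₚ a g h))
        (≋-trans (0∷-*ₚ (f *ₚ g) h) (∷-cong refl (*ₚ-assoc f g h))))

    *ₚ-identityˡ : ∀ f → 1ₚ *ₚ f ≋ f
    *ₚ-identityˡ f = mk≋ λ i → begin
      coeff (1ₚ *ₚ f) i                            ≡⟨ coeff-∷* 1ℤ [] f i ⟩
      1ℤ ℤ.* coeff f i ℤ.+ coeff (0ℤ ∷ []) i
        ≡⟨ cong₂ ℤ._+_ (ℤ.*-identityˡ (coeff f i)) (at (0∷[] (≋-refl {[]})) i) ⟩
      coeff f i ℤ.+ 0ℤ                             ≡⟨ ℤ.+-identityʳ _ ⟩
      coeff f i                                    ∎
      where open ≡.≡-Reasoning

  infixl 6 _⊕_
  infixl 7 _⊗_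
  infix  8 ⊝_

  -- Opaque copies of the operations: their applications then no longer reduce,
  -- so that arguments can be inferred from them.
  opaque
    _⊕_ _⊗_ : Poly → Poly → Poly
    _⊕_ = _+ₚ_
    _⊗_ = _*ₚ_

    ⊝_ : Poly → Poly
    ⊝_ = -1ℤ ·ₚ_

    ⊗≡*ₚ : ∀ f g → f ⊗ g ≡ f *ₚ g
    ⊗≡*ₚ f g = refl

    ⊕≡+ₚ : ∀ f g → f ⊕ g ≡ f +ₚ g
    ⊕≡+ₚ f g = refl

    -ₚ≡⊕⊝ : ∀ f g → f -ₚ g ≡ f ⊕ ⊝ g
    -ₚ≡⊕⊝ f g = refl

    coeff-⊕ : ∀ f g i → coeff (f ⊕ g) i ≡ coeff f i ℤ.+ coeff g i
    coeff-⊕ = coeff-+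

    coeff-⊝ : ∀ f i → coeff (⊝ f) i ≡ -1ℤ ℤ.* coeff f i
    coeff-⊝ = coeff-· -1ℤ

    coeff-[]⊗ : ∀ g i → coeff ([] ⊗ g) i ≡ 0ℤ
    coeff-[]⊗ g i = refl

    coeff-∷⊗ : ∀ a f g i → coeff ((a ∷ f) ⊗ g) i ≡ a ℤ.* coeff g i ℤ.+ coeff (0ℤ ∷ f ⊗ g) i
    coeff-∷⊗ = coeff-∷*

    ⊕-⊗-isCommutativeRing : IsCommutativeRing _≋_ _⊕_ _⊗_ ⊝_ [] 1ₚ
    ⊕-⊗-isCommutativeRing = record
      { isRing = record
        { +-isAbelianGroup = record
          { isGroup = record
            { isMonoid = record
              { isSemigroup = record
                { isMagma = record
                  { isEquivalence = record { refl = ≋-refl ; sym = ≋-sym ; trans = ≋-trans }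
                  ; ∙-cong = +ₚ-cong
                  }
                ; assoc = +ₚ-assoc
                }
              ; identity = (λ _ → ≋-refl) , +ₚ-identityʳ
              }
            ; inverse = (λ f → ≋-trans (+ₚ-comm (-1ℤ ·ₚ f) f) (+ₚ-inverseʳ f)) , +ₚ-inverseʳ
            ; ⁻¹-cong = ·ₚ-cong { -1ℤ } refl
            }
          ; comm = +ₚ-comm
          }
        ; *-cong = *ₚ-cong
        ; *-assoc = *ₚ-assoc
        ; *-identity = *ₚ-identityˡ , λ f → ≋-trans (*ₚ-comm f 1ₚ) (*ₚ-identityˡ f)
        ; distrib = (λ f g h → ≋-trans (*ₚ-comm f (g +ₚ h)) (≋-trans (*ₚ-distribʳ f g h)
                      (+ₚ-cong (*ₚ-comm g f) (*ₚ-comm h f))))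
                  , *ₚ-distribʳ
        }
      ; *-comm = *ₚ-comm
      }

  ℤ[X] : CommutativeRing 0ℓ 0ℓ
  ℤ[X] = record { isCommutativeRing = ⊕-⊗-isCommutativeRing }

open PolynomialRing

module ℤX where
  open CommutativeRing ℤ[X] public
    using (*-congˡ; *-congʳ; +-congˡ; +-congʳ; setoid; +-cong; *-cong; *-assoc; *-comm; +-assoc; +-comm;
           +-identityˡ; +-identityʳ; *-identityˡ; *-identityʳ; -‿cong; -‿inverseʳ; _-_; distribʳ; zeroˡ; zeroʳ)
  open IntegerScalars ℤ[X] public using (module Solver)
  open import Algebra.Properties.Semiring.Exp (CommutativeRing.semiring ℤ[X]) public using
      (_^_; ^-homo-*; ^-assocʳ; ^-congˡ)
  open import Algebra.Properties.CommutativeSemigroup.Divisibility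
    (CommutativeRing.*-commutativeSemigroup ℤ[X]) public

-- Degrees, division and pseudo-division

module Degrees where
  open ≡ using (refl; sym; trans)
  open ℤX

  open import Relation.Binary.Reasoning.Setoid setoid

  record DegBelow (f : Poly) (d : ℕ) : Set where
    constructor mk-below
    field vanish : ∀ i → d ℕ.≤ i → coeff f i ≡ 0ℤ

  open DegBelow public

  -- The coefficient `c` may be 0. Where a true leading coefficient is meant, `c ≢ 0ℤ` is required
  -- separately.
  record Lead (f : Poly) (d : ℕ) (c : ℤ) : Set where
    constructor lead
    field
      top   : coeff f d ≡ c
      above : DegBelow f (suc d)

  open Lead public

  Monic : Poly → ℕ → Set
  Monic f d = Lead f d 1ℤ

  below-resp : ∀ {f g d} → f ≋ g → DegBelow f d → DegBelow g d
  below-resp e b = mk-below λ i d≤i → trans (sym (at e i)) (vanish b i d≤i)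

  lead-resp : ∀ {f g d c} → f ≋ g → Lead f d c → Lead g d c
  lead-resp {d = d} e (lead t b) = lead (trans (sym (at e d)) t) (below-resp e b)

  below-mono : ∀ {f d e} → d ℕ.≤ e → DegBelow f d → DegBelow f e
  below-mono d≤e b = mk-below λ i e≤i → vanish b i (ℕ.≤-trans d≤e e≤i)

  below-0 : ∀ {f} → DegBelow f 0 → f ≋ []
  below-0 b = mk≋ λ i → vanish b i ℕ.z≤n

  below-[] : ∀ {f d} → f ≋ [] → DegBelow f d
  below-[] e = mk-below λ i _ → at e i

  below-tail : ∀ {a f d} → DegBelow (a ∷ f) (suc d) → DegBelow f d
  below-tail b = mk-below λ i d≤i → vanish b (suc i) (ℕ.s≤s d≤i)

  below-∷ : ∀ {a f d} → DegBelow f d → DegBelow (a ∷ f) (suc d)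
  below-∷ b = mk-below λ { (suc i) (ℕ.s≤s d≤i) → vanish b i d≤i }

  below-⊕ : ∀ {f g d} → DegBelow f d → DegBelow g d → DegBelow (f ⊕ g) d
  below-⊕ {f} {g} b b′ = mk-below λ i d≤i → trans (coeff-⊕ f g i) (cong₂ ℤ._+_ (vanish b i d≤i) (vanish b′ i d≤i))

  below-⊝ : ∀ {f d} → DegBelow f d → DegBelow (⊝ f) d
  below-⊝ {f} b = mk-below λ i d≤i → trans (coeff-⊝ f i) (cong (-1ℤ ℤ.*_) (vanish b i d≤i))

  lead<below : ∀ {f d e c} → c ≢ 0ℤ → Lead f d c → DegBelow f e → d ℕ.< e
  lead<below {d = d} {e} c≢0 l b with d ℕ.<? e
  ... | yes d<e = d<e
  ... | no d≮e  = contradiction (trans (sym (top l)) (vanish b d (ℕ.≮⇒≥ d≮e))) c≢0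

  -- The bounds are asymmetric, deg f < d and deg g ≤ e, so that their sum is a strict bound without
  -- subtracting 1.
  below-⊗ : ∀ {f g d e} → DegBelow f d → DegBelow g (suc e) → DegBelow (f ⊗ g) (d ℕ.+ e)
  below-⊗ {f} {g} b b′ = mk-below (go f b)
    where
    go : ∀ f {d} → DegBelow f d → ∀ i → d ℕ.+ _ ℕ.≤ i → coeff (f ⊗ g) i ≡ 0ℤ
    go []      b i h = coeff-[]⊗ g i
    go (a ∷ f) {zero}  b i h = at (≋-trans (*-congʳ (below-0 b)) (zeroˡ g)) i
    go (a ∷ f) {suc d} b (suc i) (ℕ.s≤s h) = trans (coeff-∷⊗ a f g (suc i))
      (cong₂ ℤ._+_ (trans (cong (a ℤ.*_) (vanish b′ (suc i) (ℕ.s≤s (ℕ.m+n≤o⇒n≤o d h)))) (ℤ.*-zeroʳ a))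
                   (go f (below-tail b) i h))

  lead-⊗ : ∀ {f g d e a b} → Lead f d a → Lead g e b → Lead (f ⊗ g) (d ℕ.+ e) (a ℤ.* b)
  lead-⊗ {f} {g} {e = e} {b = b} l l′ = lead (go f l) (below-⊗ (above l) (above l′))
    where
    go : ∀ f {d a} → Lead f d a → coeff (f ⊗ g) (d ℕ.+ e) ≡ a ℤ.* b
    go [] {d} (lead refl _) = coeff-[]⊗ g (d ℕ.+ e)
    go (c ∷ f) {zero} (lead refl below) = trans (coeff-∷⊗ c f g e)
      (trans (cong₂ ℤ._+_ (cong (c ℤ.*_) (top l′))
          (at (0∷[] (≋-trans (*-congʳ (below-0 (below-tail below))) (zeroˡ g))) e))
        (ℤ.+-identityʳ _))
    go (c ∷ f) {suc d} (lead t below) = trans (coeff-∷⊗ c f g (suc d ℕ.+ e))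
      (trans (cong₂ ℤ._+_ (trans (cong (c ℤ.*_) (vanish (above l′) (suc d ℕ.+ e) (ℕ.s≤s (ℕ.m≤n+m e d))))
          (ℤ.*-zeroʳ c))
                          (go f (lead t (below-tail below))))
        (ℤ.+-identityˡ _))

  ∃lead : ∀ f → f ≋ [] ⊎ ∃₂ λ d c → c ≢ 0ℤ × Lead f d c
  ∃lead [] = inj₁ ≋-refl
  ∃lead (a ∷ f) with ∃lead f
  ... | inj₂ (d , c , c≢0 , lead t b) = inj₂ (suc d , c , c≢0 , lead t (below-∷ b))
  ... | inj₁ f≋[] with a ℤ.≟ 0ℤ
  ...   | yes refl = inj₁ (0∷[] f≋[])
  ...   | no a≢0   = inj₂ (0 , a , a≢0 , lead refl (below-∷ (below-[] f≋[])))

  lead-unique : ∀ {f d e a b} → a ≢ 0ℤ → b ≢ 0ℤ → Lead f d a → Lead f e b → d ≡ e × a ≡ b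
  lead-unique a≢0 b≢0 l l′
    with refl ← ℕ.≤-antisym (ℕ.s≤s⁻¹ (lead<below a≢0 l (above l′))) (ℕ.s≤s⁻¹ (lead<below b≢0 l′ (above l)))
    = refl , trans (sym (top l)) (top l′)

  trim-[] : ∀ {f} → f ≋ [] → trim f ≡ []
  trim-[] {[]}    e = refl
  trim-[] {a ∷ f} e rewrite trim-[] {f} (tail-≋[] e) with a ℤ.≟ 0ℤ
  ... | yes _  = refl
  ... | no a≢0 = contradiction (at e 0) a≢0

  length-trim : ∀ {f d c} → c ≢ 0ℤ → Lead f d c → length (trim f) ≡ suc d
  length-trim {[]}    c≢0 (lead refl b) = contradiction refl c≢0
  length-trim {a ∷ f} {zero} c≢0 (lead refl b) rewrite trim-[] {f} (below-0 (below-tail b)) with a ℤ.≟ 0ℤ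
  ... | yes a≡0 = contradiction a≡0 c≢0
  ... | no _    = refl
  length-trim {a ∷ f} {suc d} c≢0 (lead t b)
    with trim f | length-trim {f} c≢0 (lead t (below-tail b))
  ... | _ ∷ _ | eq = cong suc eq

  degree-lead : ∀ {f d c} → c ≢ 0ℤ → Lead f d c → degree f ≡ d
  degree-lead c≢0 l = cong pred (length-trim c≢0 l)

  1≢0 : 1ℤ ≢ 0ℤ
  1≢0 ()

  C : ℤ → Poly
  C c = c ∷ []

  X : Poly
  X = 0ℤ ∷ 1ℤ ∷ []

  coeff-C⊗ : ∀ c f i → coeff (C c ⊗ f) i ≡ c ℤ.* coeff f i
  coeff-C⊗ c f i = trans (coeff-∷⊗ c [] f i)
    (trans (cong (λ z → c ℤ.* coeff f i ℤ.+ z) (at (0∷[] (zeroˡ f)) i)) (ℤ.+-identityʳ _))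

  X⊗ : ∀ f → X ⊗ f ≋ 0ℤ ∷ f
  X⊗ f = mk≋ λ i → trans (coeff-∷⊗ 0ℤ 1ₚ f i) (trans (ℤ.+-identityˡ _) (at (∷-cong {0ℤ} refl (*-identityˡ f)) i))

  ∷≋C⊕X⊗ : ∀ a f → a ∷ f ≋ C a ⊕ X ⊗ f
  ∷≋C⊕X⊗ a f = mk≋ λ
    { zero    → sym (trans (coeff-⊕ (C a) (X ⊗ f) 0) (trans (cong (λ z → a ℤ.+ z) (at (X⊗ f) 0)) (ℤ.+-identityʳ a)))
    ; (suc i) → sym (trans (coeff-⊕ (C a) (X ⊗ f) (suc i)) (trans (ℤ.+-identityˡ _) (at (X⊗ f) (suc i))))
    }

  C-⊗ : ∀ a b → C (a ℤ.* b) ≋ C a ⊗ C b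
  C-⊗ a b = mk≋ λ i → trans (lemma i) (sym (coeff-C⊗ a (C b) i))
    where
    lemma : ∀ i → coeff (C (a ℤ.* b)) i ≡ a ℤ.* coeff (C b) i
    lemma zero    = refl
    lemma (suc i) = sym (ℤ.*-zeroʳ a)

  C-⊕ : ∀ a b → C (a ℤ.+ b) ≋ C a ⊕ C b
  C-⊕ a b = mk≋ λ { zero → sym (coeff-⊕ (C a) (C b) 0) ; (suc i) → sym (coeff-⊕ (C a) (C b) (suc i)) }

  below-C⊗ : ∀ {f d} c → DegBelow f d → DegBelow (C c ⊗ f) d
  below-C⊗ {f} c b = mk-below λ i d≤i → trans (coeff-C⊗ c f i) (trans (cong (c ℤ.*_) (vanish b i d≤i)) (ℤ.*-zeroʳ c))

  C⊗≋[]⇒≋[] : ∀ {c f} → c ≢ 0ℤ → C c ⊗ f ≋ [] → f ≋ []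
  C⊗≋[]⇒≋[] {c} {f} c≢0 e = mk≋ λ i →
    [ (λ c≡0 → contradiction c≡0 c≢0) , (λ fᵢ≡0 → fᵢ≡0) ]′
      (ℤ.i*j≡0⇒i≡0∨j≡0 c (trans (sym (coeff-C⊗ c f i)) (at e i)))

  private
    combination-0 : ∀ {a b} x y → a ≡ 0ℤ → b ≡ 0ℤ → x ℤ.* a ℤ.+ -1ℤ ℤ.* (y ℤ.* b) ≡ 0ℤ
    combination-0 x y refl refl = ZS.solve 2 (λ x y → x :* con 0ℤ :+ con -1ℤ :* (y :* con 0ℤ) := con 0ℤ) refl x y
      where
      module ZS = ℤ-Solver
      open ZS

    combination-swap : ∀ x y → x ℤ.* y ℤ.+ -1ℤ ℤ.* (y ℤ.* x) ≡ 0ℤ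
    combination-swap = ℤ-Solver.solve 2 (λ x y → x :* y :+ con -1ℤ :* (y :* x) := con 0ℤ) refl
      where open ℤ-Solver

  -- The elimination step common to both divisions. Scaling `f` by the leading coefficient of `g`
  -- avoids dividing by it.
  below-cancel : ∀ {g m c f} → Lead g m c → DegBelow f (suc m) → DegBelow (C c ⊗ f - C (coeff f m) ⊗ g) m
  below-cancel {g} {m} {c} {f} lg f-below = mk-below λ i m≤i → trans (expand i) (cancel i (ℕ.m≤n⇒m<n∨m≡n m≤i))
    where
    t : ℤ
    t = coeff f m
    expand : ∀ i → coeff (C c ⊗ f - C t ⊗ g) i ≡ c ℤ.* coeff f i ℤ.+ -1ℤ ℤ.* (t ℤ.* coeff g i)
    expand i = trans (coeff-⊕ (C c ⊗ f) _ i) (cong₂ ℤ._+_ (coeff-C⊗ c f i)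
      (trans (coeff-⊝ (C t ⊗ g) i) (cong (-1ℤ ℤ.*_) (coeff-C⊗ t g i))))
    cancel : ∀ i → m ℕ.< i ⊎ m ≡ i → c ℤ.* coeff f i ℤ.+ -1ℤ ℤ.* (t ℤ.* coeff g i) ≡ 0ℤ
    cancel i (inj₁ m<i)  = combination-0 c t (vanish f-below i m<i) (vanish (above lg) i m<i)
    cancel i (inj₂ refl) = trans (cong (λ z → c ℤ.* t ℤ.+ -1ℤ ℤ.* (t ℤ.* z)) (top lg)) (combination-swap c t)

  ·ₚ≋C⊗ : ∀ c f → c ·ₚ f ≋ C c ⊗ f
  ·ₚ≋C⊗ c f = mk≋ λ i → trans (coeff-· c f i) (sym (coeff-C⊗ c f i))

  quotRem-spec : ∀ {g D} → Monic g D → ∀ f →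
    f ≋ proj₁ (quotRem f g) ⊗ g ⊕ proj₂ (quotRem f g) × DegBelow (proj₂ (quotRem f g)) D
  quotRem-spec {g} mg [] = ≋-sym (≋-trans (+-identityʳ _) (zeroˡ g)) , mk-below λ _ _ → refl
  quotRem-spec {g} {D} mg (a ∷ f) with quotRem f g | quotRem-spec mg f
  ... | q , r | f≋ , r-below = (begin
      a ∷ f                                          ≈⟨ ∷-cong refl f≋ ⟩
      a ∷ q ⊗ g ⊕ r                                  ≈⟨ ∷≋C⊕X⊗ a _ ⟩
      C a ⊕ X ⊗ (q ⊗ g ⊕ r)
        ≈⟨ solve 6 (λ a x q g r c → (a :+ x :* (q :* g :+ r)) :=
            ((c :+ x :* q) :* g :+ ((a :+ x :* r) :- c :* g))) ≋-refl (C a) X q g r (C c) ⟩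
      (C c ⊕ X ⊗ q) ⊗ g ⊕ ((C a ⊕ X ⊗ r) - (C c ⊗ g))
        ≈⟨ +-cong (*-congʳ (∷≋C⊕X⊗ c q)) (+-congʳ (∷≋C⊕X⊗ a r)) ⟨
      (c ∷ q) ⊗ g ⊕ ((a ∷ r) - C c ⊗ g)             ≈⟨ +-congˡ remainder ⟨
      (c ∷ q) ⊗ g ⊕ ((a ∷ r) -ₚ (c ·ₚ g))          ∎)
    , below-resp (≋-sym remainder) (below-resp
        (+-cong (*-identityˡ (a ∷ r)) (-‿cong (*-congʳ (∷-cong (sym c≡) ≋-refl))))
        (below-cancel mg (below-∷ r-below)))
    where
    open Solver
    c : ℤ
    c = coeff (a ∷ r) (degree g)
    c≡ : c ≡ coeff (a ∷ r) D
    c≡ = cong (coeff (a ∷ r)) (degree-lead 1≢0 mg)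
    remainder : (a ∷ r) -ₚ (c ·ₚ g) ≋ (a ∷ r) - C c ⊗ g
    remainder = subst (_≋ (a ∷ r) - C c ⊗ g) (sym (-ₚ≡⊕⊝ (a ∷ r) (c ·ₚ g))) (+-congˡ (-‿cong (·ₚ≋C⊗ c g)))

  -- The leading coefficient need not be a unit, so the dividend is multiplied by it once for each
  -- of its coefficients; `k` is their number.
  pseudo-division : ∀ {g m c} → Lead g m c → ∀ f →
    ∃ λ k → ∃₂ λ q s → C c ^ k ⊗ f ≋ q ⊗ g ⊕ s × DegBelow s m
  pseudo-division {g} lg [] = 0 , [] , [] ,
    ≋-trans (*-identityˡ []) (≋-sym (≋-trans (+-identityʳ _) (zeroˡ g))) , below-[] ≋-refl
  pseudo-division {g} {m} {c} lg (a ∷ f) with pseudo-division lg f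
  ... | k , q , s , f≋ , s-below = suc k , C c ⊗ (X ⊗ q) ⊕ C t , C c ⊗ s′ - C t ⊗ g , (begin
      (C c ⊗ C c ^ k) ⊗ (a ∷ f)                     ≈⟨ *-congˡ (∷≋C⊕X⊗ a f) ⟩
      (C c ⊗ C c ^ k) ⊗ (C a ⊕ X ⊗ f)
        ≈⟨ solve 5 (λ c ck a x f → (c :* ck) :* (a :+ x :* f) := (c :* (ck :* a) :+ (c :* (x :* (ck :* f)))))
            ≋-refl (C c) (C c ^ k) (C a) X f ⟩
      C c ⊗ (C c ^ k ⊗ C a) ⊕ C c ⊗ (X ⊗ (C c ^ k ⊗ f))
        ≈⟨ +-congˡ (*-congˡ (*-congˡ f≋)) ⟩
      C c ⊗ (C c ^ k ⊗ C a) ⊕ C c ⊗ (X ⊗ (q ⊗ g ⊕ s))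
        ≈⟨ solve 7 (λ c cka x q g s t → c :* cka :+ c :* (x :* (q :* g :+ s)) :=
                                         (c :* (x :* q) :+ t) :* g :+ (c :* (cka :+ x :* s) :- t :* g)) ≋-refl
             (C c) (C c ^ k ⊗ C a) X q g s (C t) ⟩
      (C c ⊗ (X ⊗ q) ⊕ C t) ⊗ g ⊕ (C c ⊗ s′ - C t ⊗ g) ∎) , below-cancel lg s′-below
    where
    open Solver
    s′ : Poly
    s′ = C c ^ k ⊗ C a ⊕ X ⊗ s
    t : ℤ
    t = coeff s′ m
    constant-below : ∀ k → DegBelow (C c ^ k ⊗ C a) 1
    constant-below zero    = below-resp (≋-sym (*-identityˡ (C a))) (mk-below λ { (suc i) _ → refl })
    constant-below (suc k) = below-resp (≋-sym (*-assoc (C c) (C c ^ k) (C a))) (below-C⊗ c (constant-below k))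
    s′-below : DegBelow s′ (suc m)
    -- The constant term has degree below 1, and 1 ≤ `suc m` even for m = 0.
    s′-below = below-⊕ (below-mono (ℕ.s≤s ℕ.z≤n) (constant-below k)) (below-resp (≋-sym (X⊗ s)) (below-∷ s-below))

  -- A nonzero `q` would give the product a leading term of exponent at least D. This is the
  -- cancellation law for monic polynomials.
  ⊗-monic-below⇒≋[] : ∀ {q g D} → Monic g D → DegBelow (q ⊗ g) D → q ≋ []
  ⊗-monic-below⇒≋[] {q} {g} {D} mg b with ∃lead q
  ... | inj₁ q≋[] = q≋[]
  ... | inj₂ (d , c , c≢0 , l) = contradiction
    (lead<below (λ c1≡0 → c≢0 (trans (sym (ℤ.*-identityʳ c)) c1≡0)) (lead-⊗ l mg) b)
    (ℕ.≤⇒≯ (ℕ.m≤n+m D d))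

  -- For a monic divisor, divisibility over ℚ implies divisibility over ℤ, with the computed
  -- quotient: if r is the remainder, c r is a multiple of g of degree below D, so it is 0, and r is
  -- 0 as well.
  monic-∣-remainder : ∀ {g D c f} → Monic g D → c ≢ 0ℤ → g ∣ C c ⊗ f → f ≋ proj₁ (quotRem f g) ⊗ g
  monic-∣-remainder {g} {D} {c} {f} mg c≢0 (q′ , q′g≋cf) = begin
      f              ≈⟨ f≋ ⟩
      q ⊗ g ⊕ r      ≈⟨ +-congˡ r≋[] ⟩
      q ⊗ g ⊕ []     ≈⟨ +-identityʳ _ ⟩
      q ⊗ g          ∎
    where
    open Solver
    q r : Poly
    q = proj₁ (quotRem f g)
    r = proj₂ (quotRem f g)
    f≋ = proj₁ (quotRem-spec mg f)
    r-below = proj₂ (quotRem-spec mg f)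
    ug≋cr : (q′ - C c ⊗ q) ⊗ g ≋ C c ⊗ r
    ug≋cr = begin
      (q′ - C c ⊗ q) ⊗ g
        ≈⟨ solve 4 (λ q′ c q g → (q′ :- c :* q) :* g := q′ :* g :- c :* (q :* g)) ≋-refl q′ (C c) q g ⟩
      q′ ⊗ g - C c ⊗ (q ⊗ g)     ≈⟨ +-congʳ (≋-trans q′g≋cf (*-congˡ f≋)) ⟩
      C c ⊗ (q ⊗ g ⊕ r) - C c ⊗ (q ⊗ g)
        ≈⟨ solve 3 (λ c y r → c :* (y :+ r) :- c :* y := c :* r) ≋-refl (C c) (q ⊗ g) r ⟩
      C c ⊗ r ∎
    r≋[] : r ≋ []
    r≋[] = C⊗≋[]⇒≋[] c≢0 (≋-trans (≋-sym ug≋cr)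
      (≋-trans (*-congʳ (⊗-monic-below⇒≋[] mg (below-resp (≋-sym ug≋cr) (below-C⊗ c r-below)))) (zeroˡ g)))

open Degrees

-- Coprimality and exactness of the cyclotomic quotient

module CyclotomicFactors where
  open ≡ using (refl; sym; trans)
  open ℤX

  open import Relation.Binary.Reasoning.Setoid setoid
  open Solver using (solve; con; _:=_; _:+_; _:*_; _:-_; :-_)

  ∣-cong : ∀ {f f′ g g′} → f ≋ f′ → g ≋ g′ → f ∣ g → f′ ∣ g′
  ∣-cong e e′ f∣g = ∣ʳ-respʳ-≈ e′ (∣ʳ-respˡ-≈ e f∣g)

  ∣ₚ-refl : ∀ {f} → f ∣ f
  ∣ₚ-refl = 1ₚ , *-identityˡ _

  1∣ : ∀ {f} → 1ₚ ∣ f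
  1∣ {f} = f , *-identityʳ f

  -- Coprimality over ℚ, expressed over ℤ.
  infix 4 _⊥_

  record _⊥_ (f g : Poly) : Set where
    constructor mk⊥
    field
      {constant} : ℤ
      nonzero    : constant ≢ 0ℤ
      {cofˡ cofʳ} : Poly
      bezout     : cofˡ ⊗ f ⊕ cofʳ ⊗ g ≋ C constant

  ⊥-sym : ∀ {f g} → f ⊥ g → g ⊥ f
  ⊥-sym (mk⊥ c≢0 e) = mk⊥ c≢0 (≋-trans (+-comm _ _) e)

  ⊥-1 : ∀ {f} → f ⊥ 1ₚ
  ⊥-1 {f} = mk⊥ 1≢0 {[]} {1ₚ} (≋-trans (+-cong (zeroˡ f) (*-identityˡ _)) (+-identityˡ _))

  ⊥-∣ : ∀ {f g h} → g ∣ h → f ⊥ h → f ⊥ g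
  ⊥-∣ {f} {g} {h} (q , qg≋h) (mk⊥ c≢0 {u} {v} e) = mk⊥ c≢0 {u} {v ⊗ q}
    (≋-trans (+-congˡ (≋-trans (*-assoc v q g) (*-congˡ qg≋h))) e)

  private
    *-≢0 : ∀ {a b} → a ≢ 0ℤ → b ≢ 0ℤ → a ℤ.* b ≢ 0ℤ
    *-≢0 {a} a≢0 b≢0 e = [ a≢0 , b≢0 ]′ (ℤ.i*j≡0⇒i≡0∨j≡0 a e)

  -- In the product of the two Bézout identities every term except v v′ g h contains f.
  ⊥-⊗ : ∀ {f g h} → f ⊥ g → f ⊥ h → f ⊥ g ⊗ h
  ⊥-⊗ {f} {g} {h} (mk⊥ {c} c≢0 {u} {v} e) (mk⊥ {d} d≢0 {u′} {v′} e′) =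
    mk⊥ (*-≢0 c≢0 d≢0) {u ⊗ (u′ ⊗ f ⊕ v′ ⊗ h) ⊕ v ⊗ g ⊗ u′} {v ⊗ v′} (begin
      (u ⊗ (u′ ⊗ f ⊕ v′ ⊗ h) ⊕ v ⊗ g ⊗ u′) ⊗ f ⊕ v ⊗ v′ ⊗ (g ⊗ h)
        ≈⟨ solve 7 (λ f g h u v u′ v′ → (u :* (u′ :* f :+ v′ :* h) :+ v :* g :* u′) :* f :+ v :* v′ :* (g :* h)
                     := (u :* f :+ v :* g) :* (u′ :* f :+ v′ :* h)) ≋-refl f g h u v u′ v′ ⟩
      (u ⊗ f ⊕ v ⊗ g) ⊗ (u′ ⊗ f ⊕ v′ ⊗ h)   ≈⟨ *-cong e e′ ⟩
      C c ⊗ C d                              ≈⟨ C-⊗ c d ⟨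
      C (c ℤ.* d)                            ∎)

  -- Multiply the Bézout identity by h, then write h as a multiple of g in the term with f, and as a
  -- multiple of f in the term with g.
  ⊥-∣⊗ : ∀ {f g h} → f ⊥ g → f ∣ h → g ∣ h → ∃ λ c → c ≢ 0ℤ × f ⊗ g ∣ C c ⊗ h
  ⊥-∣⊗ {f} {g} {h} (mk⊥ {c} c≢0 {u} {v} e) (a , af≋h) (b , bg≋h) = c , c≢0 , u ⊗ b ⊕ v ⊗ a , (begin
    (u ⊗ b ⊕ v ⊗ a) ⊗ (f ⊗ g)
      ≈⟨ solve 6 (λ f g u v a b → (u :* b :+ v :* a) :* (f :* g) := u :* f :* (b :* g) :+ v :* g :* (a :* f))
          ≋-refl f g u v a b ⟩
    u ⊗ f ⊗ (b ⊗ g) ⊕ v ⊗ g ⊗ (a ⊗ f)   ≈⟨ +-cong (*-congˡ bg≋h) (*-congˡ af≋h) ⟩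
    u ⊗ f ⊗ h ⊕ v ⊗ g ⊗ h               ≈⟨ distribʳ h (u ⊗ f) (v ⊗ g) ⟨
    (u ⊗ f ⊕ v ⊗ g) ⊗ h                 ≈⟨ *-congʳ e ⟩
    C c ⊗ h                              ∎)

  Π : ℕ → (ℕ → Poly) → Poly
  Π zero    g = 1ₚ
  Π (suc n) g = g 0 ⊗ Π n (g ∘ suc)

  Π-∣-cong : ∀ n {g h} → (∀ i → i ℕ.< n → g i ∣ h i) → Π n g ∣ Π n h
  Π-∣-cong zero    d = ∣ₚ-refl
  Π-∣-cong (suc n) d = ∙-cong-∣ (d 0 (ℕ.s≤s ℕ.z≤n)) (Π-∣-cong n λ i i<n → d (suc i) (ℕ.s≤s i<n))

  Π-∣-mono : ∀ {m n} g → m ℕ.≤ n → Π m g ∣ Π n g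
  Π-∣-mono g ℕ.z≤n       = 1∣
  Π-∣-mono g (ℕ.s≤s m≤n) = x∣y⇒zx∣zy (g 0) (Π-∣-mono (g ∘ suc) m≤n)

  Π-snoc : ∀ n g → Π (suc n) g ≋ Π n g ⊗ g n
  Π-snoc zero    g = *-comm _ _
  Π-snoc (suc n) g = ≋-trans (*-congˡ (Π-snoc n (g ∘ suc))) (≋-sym (*-assoc _ _ _))

  Π-monic : ∀ n {g} → (∀ i → i ℕ.< n → ∃ λ d → Monic (g i) d) → ∃ λ d → Monic (Π n g) d
  Π-monic zero    m = 0 , lead refl (mk-below λ { (suc i) _ → refl })
  Π-monic (suc n) m with m 0 (ℕ.s≤s ℕ.z≤n) | Π-monic n (λ i i<n → m (suc i) (ℕ.s≤s i<n))
  ... | d , mg | e , mΠ = d ℕ.+ e , lead-⊗ mg mΠ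

  ⊥-Π : ∀ n {f g} → (∀ i → i ℕ.< n → f ⊥ g i) → f ⊥ Π n g
  ⊥-Π zero    c = ⊥-1
  ⊥-Π (suc n) c = ⊥-⊗ (c 0 (ℕ.s≤s ℕ.z≤n)) (⊥-Π n λ i i<n → c (suc i) (ℕ.s≤s i<n))

  ∣-C⊗ : ∀ {f g} c → f ∣ g → f ∣ C c ⊗ g
  ∣-C⊗ c f∣g = x∣ʳy⇒x∣ʳzy (C c) f∣g

  ∣-C⊗-trans : ∀ {a b f g h} → f ∣ C b ⊗ g → g ≋ C a ⊗ h → f ∣ C (b ℤ.* a) ⊗ h
  ∣-C⊗-trans {a} {b} {h = h} f∣ g≋ = ∣ʳ-respʳ-≈ (begin
    C b ⊗ _              ≈⟨ *-congˡ g≋ ⟩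
    C b ⊗ (C a ⊗ h)      ≈⟨ *-assoc _ _ _ ⟨
    C b ⊗ C a ⊗ h        ≈⟨ *-congʳ (C-⊗ b a) ⟨
    C (b ℤ.* a) ⊗ h      ∎) f∣

  -- The first factor is coprime to the product of the others. Coprimality over ℚ costs one nonzero
  -- constant per factor.
  Π-∣ : ∀ n {g h} → (∀ i → i ℕ.< n → g i ∣ h) → (∀ i j → i ℕ.< j → j ℕ.< n → g i ⊥ g j) →
        ∃ λ c → c ≢ 0ℤ × Π n g ∣ C c ⊗ h
  Π-∣ zero    d c = 1ℤ , 1≢0 , 1∣
  Π-∣ (suc n) {g} {h} d c = extend
    (Π-∣ n {g ∘ suc} {h} (λ i i<n → d (suc i) (ℕ.s≤s i<n))
        (λ i j i<j j<n → c (suc i) (suc j) (ℕ.s≤s i<j) (ℕ.s≤s j<n)))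
    where
    extend : (∃ λ a → a ≢ 0ℤ × Π n (g ∘ suc) ∣ C a ⊗ h) → ∃ λ c → c ≢ 0ℤ × Π (suc n) g ∣ C c ⊗ h
    extend (a , a≢0 , Π∣) = scale
      (⊥-∣⊗ (⊥-Π n (λ j j<n → c 0 (suc j) (ℕ.s≤s ℕ.z≤n) (ℕ.s≤s j<n))) (∣-C⊗ a (d 0 (ℕ.s≤s ℕ.z≤n))) Π∣)
      where
      scale : (∃ λ b → b ≢ 0ℤ × Π (suc n) g ∣ C b ⊗ (C a ⊗ h)) → ∃ λ c → c ≢ 0ℤ × Π (suc n) g ∣ C c ⊗ h
      scale (b , b≢0 , Π∣′) = b ℤ.* a , *-≢0 b≢0 a≢0 , ∣-C⊗-trans Π∣′ ≋-refl

  Xⁿ-1 : ℕ → Poly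
  Xⁿ-1 n = (X^ n *ₚ 1ₚ) -ₚ 1ₚ

  properDivisors : ∀ n → List (Fin n)
  properDivisors n = filter (λ d → toℕ d ∣? n) (allFin n)

  opaque
    -- Opaque, so that the well-founded recursion never unfolds during type checking; `Φ°-unfold`
    -- gives its defining equation.
    Φ° : ℕ → Poly
    Φ° = Φ

    Φ≡Φ° : ∀ n → Φ n ≡ Φ° n
    Φ≡Φ° n = refl

    Φ°-unfold : ∀ n → Φ° n ≡ Xⁿ-1 n quot List.foldr _*ₚ_ 1ₚ (map (λ d → Φ° (toℕ d)) (properDivisors n))
    Φ°-unfold n = FixPoint.unfold-wfRec <-wellFounded (λ _ → Poly) step step-ext {n}
      where
      step : ∀ n → (∀ {m} → m ℕ.< n → Poly) → Poly
      step n rec = Xⁿ-1 n quot List.foldr _*ₚ_ 1ₚ (map (λ d → rec (Fin.toℕ<n d)) (properDivisors n))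
      step-ext : ∀ n {rec rec′ : ∀ {m} → m ℕ.< n → Poly} →
                 (∀ {m} (m<n : m ℕ.< n) → rec m<n ≡ rec′ m<n) → step n rec ≡ step n rec′
      step-ext n eq = cong (λ fs → Xⁿ-1 n quot List.foldr _*ₚ_ 1ₚ fs)
        (List.map-cong (λ d → eq (Fin.toℕ<n d)) (properDivisors n))

  -- Padding with 1 turns the product over the proper divisors into one over all `d < n`. For n > 0
  -- the index 0 contributes 1, as 0 does not divide n.
  Φ-factor : ℕ → ℕ → Poly
  Φ-factor n d = if does (d ∣? n) then Φ° d else 1ₚ

  Φ-factor-∣ : ∀ {n d} → d ∣ⁿ n → Φ-factor n d ≡ Φ° d
  Φ-factor-∣ {n} {d} d∣n = cong (if_then Φ° d else 1ₚ) (dec-true (d ∣? n) d∣n)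

  module _ (P : Poly → Set) where
    Φ-factor-elim : ∀ {n d} → (d ∣ⁿ n → P (Φ° d)) → P 1ₚ → P (Φ-factor n d)
    Φ-factor-elim {n} {d} p q with d ∣? n
    ... | yes d∣n = p d∣n
    ... | no  _   = q

  Πproper : ℕ → Poly
  Πproper n = Π n (Φ-factor n)

  *ₚ≋⊗ : ∀ f g → f *ₚ g ≋ f ⊗ g
  *ₚ≋⊗ f g = subst (f *ₚ g ≋_) (sym (⊗≡*ₚ f g)) ≋-refl

  foldr≋Π : ∀ n → List.foldr _*ₚ_ 1ₚ (map (λ d → Φ° (toℕ d)) (properDivisors n)) ≋ Πproper n
  foldr≋Π n = go n (λ i → i) (Φ-factor n) (λ _ → refl)
    where
    -- The index map `φ` is arbitrary because the tail of `allFin` is not itself an `allFin`.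
    go : ∀ m (φ : Fin m → Fin n) (g : ℕ → Poly) → (∀ i → Φ-factor n (toℕ (φ i)) ≡ g (toℕ i)) →
         List.foldr _*ₚ_ 1ₚ (map (λ d → Φ° (toℕ d)) (filter (λ d → toℕ d ∣? n) (List.tabulate φ))) ≋ Π m g
    go zero    φ g eq = ≋-refl
    go (suc m) φ g eq with rest ← go m (φ ∘ Fin.suc) (g ∘ suc) (λ i → eq (Fin.suc i))
                         | eq₀ ← eq Fin.zero | toℕ (φ Fin.zero) ∣? n
    ... | yes _ rewrite sym eq₀ = ≋-trans (*ₚ≋⊗ _ _) (*-congˡ rest)
    ... | no _  rewrite sym eq₀ = ≋-trans rest (≋-sym (*-identityˡ _))

  P : ℕ → Poly
  P n = X ^ n - 1ₚ

  X^≋ : ∀ n f → X^ n *ₚ f ≋ X ^ n ⊗ f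
  X^≋ zero    f = ≋-sym (*-identityˡ f)
  X^≋ (suc n) f = ≋-trans (∷-cong refl (X^≋ n f)) (≋-trans (≋-sym (X⊗ _)) (≋-sym (*-assoc _ _ _)))

  Xⁿ-1≋P : ∀ n → Xⁿ-1 n ≋ P n
  Xⁿ-1≋P n = subst (_≋ P n) (sym (-ₚ≡⊕⊝ _ _)) (+-congʳ (≋-trans (X^≋ n 1ₚ) (*-identityʳ _)))

  X-monic : Monic X 1
  X-monic = lead refl (mk-below λ { (suc (suc i)) _ → refl ; (suc zero) (ℕ.s≤s ()) })

  1-monic : Monic 1ₚ 0
  1-monic = lead refl (mk-below λ { (suc i) _ → refl })

  X^-monic : ∀ n → Monic (X ^ n) n
  X^-monic zero    = 1-monic
  X^-monic (suc n) = lead-⊗ X-monic (X^-monic n)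

  lead-⊕ : ∀ {f g d c} → Lead f d c → DegBelow g d → Lead (f ⊕ g) d c
  lead-⊕ {f} {g} {d} l b = lead (trans (coeff-⊕ f g d)
      (trans (cong₂ ℤ._+_ (top l) (vanish b d ℕ.≤-refl)) (ℤ.+-identityʳ _)))
    (below-⊕ (above l) (below-mono (ℕ.n≤1+n d) b))

  lead-C⊗ : ∀ {f d a} c → Lead f d a → Lead (C c ⊗ f) d (c ℤ.* a)
  lead-C⊗ {f} {d} c l = lead (trans (coeff-C⊗ c f d) (cong (c ℤ.*_) (top l))) (below-C⊗ c (above l))

  P-monic : ∀ {n} → 0 ℕ.< n → Monic (P n) n
  P-monic {n} 0<n = lead-⊕ (X^-monic n) (below-⊝ (below-mono 0<n (above 1-monic)))

  open PowerIdentities ℤ[X] using (geometric; frobenius; _⨯_)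

  ⨯1≋C : ∀ k → k ⨯ 1ₚ ≋ C (+ k)
  ⨯1≋C zero    = ≋-sym (0∷[] ≋-refl)
  ⨯1≋C (suc k) = ≋-trans (+-congˡ (⨯1≋C k)) (≋-sym (C-⊕ 1ℤ (+ k)))

  P-* : ∀ d k → ∃₂ λ s t → P (d ℕ.* k) ≋ s ⊗ P d × s ≋ C (+ k) ⊕ t ⊗ P d
  P-* d k with geometric (X ^ d) k
  ... | s , t , e , e′ = s , t , ≋-trans (+-congʳ (≋-sym (^-assocʳ X d k))) (≋-trans e (*-comm _ _))
                               , ≋-trans e′ (+-cong (⨯1≋C k) (*-comm _ _))

  P-∣ : ∀ {d n} → d ∣ⁿ n → P d ∣ P n
  P-∣ {d} (divides k refl) with P-* d k
  ... | s , _ , e , _ = s , ≋-sym (subst (λ n → P n ≋ s ⊗ P d) (ℕ.*-comm d k) e)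

  -- X^d - 1 = (X^(d + yn) - 1) - X^d (X^(yn) - 1), where the exponent d + yn is a multiple of m.
  P-combination : ∀ {d m n} x y → d ℕ.+ y ℕ.* n ≡ x ℕ.* m → ∃₂ λ u v → P d ≋ u ⊗ P m ⊕ v ⊗ P n
  P-combination {d} {m} {n} x y eq with P-∣ {m} {x ℕ.* m} (divides x refl) | P-∣ {n} {y ℕ.* n} (divides y refl)
  ... | a , am≋ | b , bn≋ = a , ⊝ (X ^ d ⊗ b) , (begin
    P d
      ≈⟨ solve 2 (λ x z → x :- con 1ℤ := (x :* z :- con 1ℤ) :- (x :* (z :- con 1ℤ))) ≋-refl (X ^ d) (X ^ (y ℕ.* n)) ⟩
    (X ^ d ⊗ X ^ (y ℕ.* n) - 1ₚ) - X ^ d ⊗ P (y ℕ.* n)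
      ≈⟨ +-congʳ (+-congʳ (^-homo-* X d (y ℕ.* n))) ⟨
    P (d ℕ.+ y ℕ.* n) - X ^ d ⊗ P (y ℕ.* n)  ≡⟨ cong (λ k → P k - X ^ d ⊗ P (y ℕ.* n)) eq ⟩
    P (x ℕ.* m) - X ^ d ⊗ P (y ℕ.* n)        ≈⟨ +-cong am≋ (-‿cong (*-congˡ bn≋)) ⟨
    a ⊗ P m - X ^ d ⊗ (b ⊗ P n)
      ≈⟨ solve 5 (λ a b x p q → a :* p :- x :* (b :* q) := a :* p :+ (:- (x :* b)) :* q) ≋-refl a b (X ^ d)
          (P m) (P n) ⟩
    a ⊗ P m ⊕ (⊝ (X ^ d ⊗ b)) ⊗ P n ∎)

  P-gcd : ∀ m n → ∃₂ λ u v → P (gcd m n) ≋ u ⊗ P m ⊕ v ⊗ P n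
  P-gcd m n = conclude (Bézout.identity (gcd-GCD m n))
    where
    swap : (∃₂ λ u v → P (gcd m n) ≋ u ⊗ P n ⊕ v ⊗ P m) → ∃₂ λ u v → P (gcd m n) ≋ u ⊗ P m ⊕ v ⊗ P n
    swap (u , v , e) = v , u , ≋-trans e (+-comm _ _)
    conclude : Bézout.Identity (gcd m n) m n → ∃₂ λ u v → P (gcd m n) ≋ u ⊗ P m ⊕ v ⊗ P n
    conclude (Bézout.+- x y eq) = P-combination x y eq
    conclude (Bézout.-+ x y eq) = swap (P-combination y x eq)

  -- Monicity belongs to the induction hypothesis because `quot` is meaningful only for monic
  -- divisors.
  record Exact (n : ℕ) : Set where
    constructor mk-exact
    field
      {deg} : ℕ
      monic : Monic (Φ° n) deg
      exact : P n ≋ Φ° n ⊗ Πproper n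

  open Exact

  Φ∣P : ∀ {n} → Exact n → Φ° n ∣ P n
  Φ∣P {n} e = Πproper n , ≋-trans (*-comm _ _) (≋-sym (exact e))

  -- `P d` is the product of the `Φ° i` over all `i ∣ d`, including `i = d`. Each of them is also a
  -- factor of `Πproper n`, whose range contains `d` because `d < n`.
  P∣Πproper : ∀ {d n} → Exact d → d ∣ⁿ n → d ℕ.< n → P d ∣ Πproper n
  P∣Πproper {d} {n} ed d∣n d<n = ∣-cong (≋-sym P≋) ≋-refl
    (∣ʳ-trans (Π-∣-cong (suc d) λ i _ → factor i) (Π-∣-mono (Φ-factor n) d<n))
    where
    P≋ : P d ≋ Π (suc d) (Φ-factor d)
    P≋ = begin
      P d                              ≈⟨ exact ed ⟩
      Φ° d ⊗ Πproper d                  ≈⟨ *-comm _ _ ⟩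
      Πproper d ⊗ Φ° d                  ≡⟨ cong (Πproper d ⊗_) (Φ-factor-∣ (ℕ∣.∣-refl {d})) ⟨
      Πproper d ⊗ Φ-factor d d         ≈⟨ Π-snoc d (Φ-factor d) ⟨
      Π (suc d) (Φ-factor d)           ∎
    factor : ∀ i → Φ-factor d i ∣ Φ-factor n i
    factor i = Φ-factor-elim (_∣ Φ-factor n i)
      (λ i∣d → subst (Φ° i ∣_) (sym (Φ-factor-∣ (ℕ∣.∣-trans i∣d d∣n))) ∣ₚ-refl) 1∣

  -- (Xᵇ - 1) / (Xᵉ - 1) is a multiple of Φ° b, and it is congruent to b / e modulo Xᵉ - 1.
  Φ⊥P : ∀ {e b} → Exact e → Exact b → 0 ℕ.< e → e ∣ⁿ b → e ℕ.< b → Φ° b ⊥ P e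
  Φ⊥P {e} {b} ee eb 0<e e∣b@(divides k b≡ke) e<b = conclude (P∣Πproper ee e∣b e<b) (P-* e k)
    where
    k≢0 : + k ≢ 0ℤ
    k≢0 refl = contradiction (subst (e ℕ.<_) b≡ke e<b) (λ ())
    conclude : P e ∣ Πproper b → (∃₂ λ s t → P (e ℕ.* k) ≋ s ⊗ P e × s ≋ C (+ k) ⊕ t ⊗ P e) → Φ° b ⊥ P e
    conclude (w , wP≋G) (s , t , P≋ , s≋) = mk⊥ k≢0 {w} {⊝ t} (begin
      w ⊗ Φ° b ⊕ (⊝ t) ⊗ P e             ≈⟨ +-congʳ s≋wΦ ⟨
      s ⊕ (⊝ t) ⊗ P e                    ≈⟨ +-congʳ s≋ ⟩
      (C (+ k) ⊕ t ⊗ P e) ⊕ (⊝ t) ⊗ P e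
        ≈⟨ solve 3 (λ c t p → (c :+ t :* p) :+ (:- t) :* p := c) ≋-refl (C (+ k)) t (P e) ⟩
      C (+ k)                            ∎)
      where
      -- Both `s` and `w ⊗ Φ° b` give `P b` when multiplied by `P e`, and the monic `P e` can be
      -- cancelled.
      difference : (s - w ⊗ Φ° b) ⊗ P e ≋ []
      difference = begin
        (s - w ⊗ Φ° b) ⊗ P e
          ≈⟨ solve 4 (λ s w f p → (s :- w :* f) :* p := s :* p :- f :* (w :* p)) ≋-refl s w (Φ° b) (P e) ⟩
        s ⊗ P e - Φ° b ⊗ (w ⊗ P e)    ≈⟨ +-cong P≋ (-‿cong (*-congˡ (≋-sym wP≋G))) ⟨
        P (e ℕ.* k) - Φ° b ⊗ Πproper b ≈⟨ +-congˡ (-‿cong (exact eb)) ⟨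
        P (e ℕ.* k) - P b             ≡⟨ cong (λ n → P n - P b) (trans (ℕ.*-comm e k) (sym b≡ke)) ⟩
        P b - P b                     ≈⟨ -‿inverseʳ (P b) ⟩
        []                            ∎
      s≋wΦ : s ≋ w ⊗ Φ° b
      s≋wΦ = begin
        s                              ≈⟨ solve 2 (λ s z → s := (s :- z) :+ z) ≋-refl s (w ⊗ Φ° b) ⟩
        (s - w ⊗ Φ° b) ⊕ w ⊗ Φ° b      ≈⟨ +-congʳ (⊗-monic-below⇒≋[] (P-monic 0<e) (below-[] difference)) ⟩
        [] ⊕ w ⊗ Φ° b                  ≈⟨ +-identityˡ _ ⟩
        w ⊗ Φ° b                       ∎

  -- The gcd is at most a < b, hence a proper divisor of b, and `Φ⊥P` applies to it even when a
  -- divides b. Its `P` lies in the ideal of `P a` and `P b`, and so in that of `Φ° a` and `Φ° b`.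
  Φ⊥Φ : ∀ {a b} → (∀ {d} → 0 ℕ.< d → d ℕ.≤ b → Exact d) → 0 ℕ.< a → a ℕ.< b → Φ° a ⊥ Φ° b
  Φ⊥Φ {a} {b} ex 0<a a<b = conclude
    (Φ∣P (ex 0<a (ℕ.<⇒≤ a<b))) (Φ∣P (ex 0<b ℕ.≤-refl)) (P-gcd a b)
    (Φ⊥P (ex 0<g (ℕ.<⇒≤ g<b)) (ex 0<b ℕ.≤-refl) 0<g (gcd[m,n]∣n a b) g<b)
    where
    0<b : 0 ℕ.< b
    0<b = ℕ.<-trans 0<a a<b
    0<g : 0 ℕ.< gcd a b
    0<g = ℕ.n≢0⇒n>0 λ g≡0 → ℕ.>⇒≢ 0<a (gcd[m,n]≡0⇒m≡0 g≡0)
    g<b : gcd a b ℕ.< b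
    g<b = ℕ.≤-<-trans (ℕ∣.∣⇒≤ {{ℕ.>-nonZero 0<a}} (gcd[m,n]∣m a b)) a<b
    conclude : Φ° a ∣ P a → Φ° b ∣ P b → (∃₂ λ u v → P (gcd a b) ≋ u ⊗ P a ⊕ v ⊗ P b) →
               Φ° b ⊥ P (gcd a b) → Φ° a ⊥ Φ° b
    conclude (α , α≋) (β , β≋) (u , v , Pg≋) (mk⊥ {c} c≢0 {u′} {v′} e) =
      mk⊥ c≢0 {v′ ⊗ u ⊗ α} {u′ ⊕ v′ ⊗ v ⊗ β} (begin
        v′ ⊗ u ⊗ α ⊗ Φ° a ⊕ (u′ ⊕ v′ ⊗ v ⊗ β) ⊗ Φ° b
          ≈⟨ solve 8 (λ u v u′ v′ α β x y → v′ :* u :* α :* x :+ (u′ :+ v′ :* v :* β) :* y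
                        := u′ :* y :+ v′ :* (u :* (α :* x) :+ v :* (β :* y))) ≋-refl u v u′ v′ α β (Φ° a) (Φ° b) ⟩
        u′ ⊗ Φ° b ⊕ v′ ⊗ (u ⊗ (α ⊗ Φ° a) ⊕ v ⊗ (β ⊗ Φ° b))
          ≈⟨ +-congˡ (*-congˡ (+-cong (*-congˡ α≋) (*-congˡ β≋))) ⟩
        u′ ⊗ Φ° b ⊕ v′ ⊗ (u ⊗ P a ⊕ v ⊗ P b)   ≈⟨ +-congˡ (*-congˡ Pg≋) ⟨
        u′ ⊗ Φ° b ⊕ v′ ⊗ P (gcd a b)           ≈⟨ e ⟩
        C c                                    ∎)

  exact-step : ∀ {n} → 0 ℕ.< n → (∀ {d} → 0 ℕ.< d → d ℕ.< n → Exact d) → Exact n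
  exact-step {n} 0<n ex = mk-exact (proj₂ Φ-monic) (≋-trans P≋ (*-congˡ (foldr≋Π n)))
    where
    G : Poly
    G = List.foldr _*ₚ_ 1ₚ (map (λ d → Φ° (toℕ d)) (properDivisors n))
    positive : ∀ {i} → i ∣ⁿ n → 0 ℕ.< i
    positive {zero}  0∣n = contradiction (ℕ∣.0∣⇒≡0 0∣n) (ℕ.>⇒≢ 0<n)
    positive {suc i} _   = ℕ.s≤s ℕ.z≤n
    ∣P : ∀ i → i ℕ.< n → Φ-factor n i ∣ P n
    ∣P i i<n = Φ-factor-elim (_∣ P n) (λ i∣n → ∣ʳ-trans (Φ∣P (ex (positive i∣n) i<n)) (P-∣ i∣n)) 1∣
    factors-⊥ : ∀ i j → i ℕ.< j → j ℕ.< n → Φ-factor n i ⊥ Φ-factor n j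
    factors-⊥ i j i<j j<n = Φ-factor-elim (_⊥ Φ-factor n j)
      (λ i∣n → Φ-factor-elim (Φ° i ⊥_)
        (λ j∣n → Φ⊥Φ (λ 0<d d≤j → ex 0<d (ℕ.≤-<-trans d≤j j<n)) (positive i∣n) i<j) ⊥-1)
      (⊥-sym ⊥-1)
    Π∣P : ∃ λ c → c ≢ 0ℤ × Πproper n ∣ C c ⊗ P n
    Π∣P = Π-∣ n ∣P factors-⊥
    Π-monic′ : ∃ λ d → Monic (Πproper n) d
    Π-monic′ = Π-monic n λ i i<n → Φ-factor-elim (λ f → ∃ λ d → Monic f d)
      (λ i∣n → _ , monic (ex (positive i∣n) i<n)) (0 , 1-monic)
    G-monic : Monic G (proj₁ Π-monic′)
    G-monic = lead-resp (≋-sym (foldr≋Π n)) (proj₂ Π-monic′)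
    P≋ : P n ≋ Φ° n ⊗ G
    P≋ = begin
      P n                     ≈⟨ Xⁿ-1≋P n ⟨
      Xⁿ-1 n                 ≈⟨ monic-∣-remainder G-monic (proj₁ (proj₂ Π∣P))
                                   (∣-cong (≋-sym (foldr≋Π n)) (*-congˡ (≋-sym (Xⁿ-1≋P n))) (proj₂ (proj₂ Π∣P))) ⟩
      (Xⁿ-1 n quot G) ⊗ G    ≡⟨ cong (_⊗ G) (Φ°-unfold n) ⟨
      Φ° n ⊗ G                 ∎
    -- `P n` and `G` are monic, so comparing leading terms in `P n ≋ Φ° n ⊗ G` forces the leading
    -- coefficient of `Φ° n` to be 1.
    Φ-monic : ∃ λ d → Monic (Φ° n) d
    Φ-monic with ∃lead (Φ° n)
    ... | inj₁ Φ≋[] = contradiction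
        (trans (sym (top (P-monic 0<n))) (at (≋-trans P≋ (≋-trans (*-congʳ Φ≋[]) (zeroˡ G))) n)) 1≢0
    ... | inj₂ (d , c , c≢0 , l) = d , subst (Lead (Φ° n) d) c≡1 l
      where
      c*1≢0 : c ℤ.* 1ℤ ≢ 0ℤ
      c*1≢0 e = c≢0 (trans (sym (ℤ.*-identityʳ c)) e)
      c≡1 : c ≡ 1ℤ
      c≡1 = trans (sym (ℤ.*-identityʳ c)) (proj₂ (lead-unique c*1≢0 1≢0
        (lead-resp (≋-sym P≋) (lead-⊗ l G-monic)) (P-monic 0<n)))

  Φ-exact : ∀ {n} → 0 ℕ.< n → Exact n
  Φ-exact {n} = <-rec (λ n → 0 ℕ.< n → Exact n) (λ n ih 0<n → exact-step 0<n (λ 0<d d<n → ih d<n 0<d)) n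

  -- Φ° (2m) and X + 1 are coprime up to constants, and both divide Xᵐ + 1 up to constants.
  degree-Φ-2* : ∀ {m D} h → 0 ℕ.< h → m ≡ suc (h ℕ.* 2) → Monic (Φ° (2 ℕ.* m)) D → D ℕ.< m
  degree-Φ-2* {m} {D} h 0<h m≡ mΦ = conclude Φ⊥Pm
    where
    n : ℕ
    n = 2 ℕ.* m
    1<m : 1 ℕ.< m
    1<m = subst (1 ℕ.<_) (sym m≡) (ℕ.s≤s (ℕ.≤-trans 0<h (ℕ.m≤m*n h 2)))
    0<m : 0 ℕ.< m
    0<m = ℕ.<-trans (ℕ.s≤s ℕ.z≤n) 1<m
    m<n : m ℕ.< n
    m<n = ℕ.m<m+n m (ℕ.<-≤-trans 0<m (ℕ.m≤m+n m 0))
    Φn-exact : Exact n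
    Φn-exact = Φ-exact (ℕ.<-trans 0<m m<n)
    Q : Poly
    Q = X ^ m ⊕ 1ₚ
    P≋PQ : P n ≋ P m ⊗ Q
    P≋PQ = begin
      X ^ n - 1ₚ           ≡⟨ cong (λ k → X ^ k - 1ₚ) (cong (m ℕ.+_) (ℕ.+-identityʳ m)) ⟩
      X ^ (m ℕ.+ m) - 1ₚ   ≈⟨ +-congʳ (^-homo-* X m m) ⟩
      X ^ m ⊗ X ^ m - 1ₚ   ≈⟨ solve 1 (λ y → y :* y :- con 1ℤ := (y :- con 1ℤ) :* (y :+ con 1ℤ)) ≋-refl (X ^ m) ⟩
      P m ⊗ Q              ∎
    Φ⊥Pm : Φ° n ⊥ P m
    Φ⊥Pm = Φ⊥P (Φ-exact 0<m) Φn-exact 0<m (divides 2 refl) m<n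
    X²-1≋ : (X - 1ₚ) ⊗ (X ⊕ 1ₚ) ≋ P 2
    X²-1≋ = solve 1 (λ x → (x :- con 1ℤ) :* (x :+ con 1ℤ) := x :* (x :* con 1ℤ) :- con 1ℤ) ≋-refl X
    -- X + 1 divides X² - 1, and 2 is a proper divisor of n because m > 1.
    Φ⊥X+1 : Φ° n ⊥ X ⊕ 1ₚ
    Φ⊥X+1 = ⊥-∣ (X - 1ₚ , X²-1≋)
      (Φ⊥P (Φ-exact {2} (ℕ.s≤s ℕ.z≤n)) Φn-exact (ℕ.s≤s ℕ.z≤n) (divides m (ℕ.*-comm 2 m)) (ℕ.≤-<-trans 1<m m<n))
    -- As m = 1 + 2h, Xᵐ + 1 = X (X^(2h) - 1) + (X + 1), and X² - 1 divides X^(2h) - 1.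
    X+1∣Q : X ⊕ 1ₚ ∣ Q
    X+1∣Q = go (P-∣ {2} {h ℕ.* 2} (divides h refl))
      where
      go : P 2 ∣ P (h ℕ.* 2) → X ⊕ 1ₚ ∣ Q
      go (s , sP≋) = X ⊗ (s ⊗ (X - 1ₚ)) ⊕ 1ₚ , (begin
        (X ⊗ (s ⊗ (X - 1ₚ)) ⊕ 1ₚ) ⊗ (X ⊕ 1ₚ)
          ≈⟨ solve 2 (λ x s → (x :* (s :* (x :- con 1ℤ)) :+ con 1ℤ) :* (x :+ con 1ℤ)
                         := x :* (s :* ((x :- con 1ℤ) :* (x :+ con 1ℤ))) :+ (x :+ con 1ℤ)) ≋-refl X s ⟩
        X ⊗ (s ⊗ ((X - 1ₚ) ⊗ (X ⊕ 1ₚ))) ⊕ (X ⊕ 1ₚ)     ≈⟨ +-congʳ (*-congˡ (≋-trans (*-congˡ X²-1≋) sP≋)) ⟩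
        X ⊗ (X ^ (h ℕ.* 2) - 1ₚ) ⊕ (X ⊕ 1ₚ)
          ≈⟨ solve 2 (λ x y → x :* (y :- con 1ℤ) :+ (x :+ con 1ℤ) := x :* y :+ con 1ℤ) ≋-refl X (X ^ (h ℕ.* 2)) ⟩
        X ^ suc (h ℕ.* 2) ⊕ 1ₚ                         ≡⟨ cong (λ k → X ^ k ⊕ 1ₚ) m≡ ⟨
        Q                                              ∎)
    -- Multiplying the Bézout identity by `Q` turns `P m` into `P n`, which is a multiple of `Φ° n`.
    Φ∣cQ : ∀ {c u v} → u ⊗ Φ° n ⊕ v ⊗ P m ≋ C c → Φ° n ∣ C c ⊗ Q
    Φ∣cQ {c} {u} {v} e = u ⊗ Q ⊕ v ⊗ Πproper n , (begin
      (u ⊗ Q ⊕ v ⊗ Πproper n) ⊗ Φ° n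
        ≈⟨ solve 5 (λ u v q g f → (u :* q :+ v :* g) :* f := u :* f :* q :+ v :* (f :* g)) ≋-refl u v Q
            (Πproper n) (Φ° n) ⟩
      u ⊗ Φ° n ⊗ Q ⊕ v ⊗ (Φ° n ⊗ Πproper n)
        ≈⟨ +-congˡ (*-congˡ (≋-trans (≋-sym P≋PQ) (exact Φn-exact))) ⟨
      u ⊗ Φ° n ⊗ Q ⊕ v ⊗ (P m ⊗ Q)
        ≈⟨ solve 5 (λ u v q p f → u :* f :* q :+ v :* (p :* q) := (u :* f :+ v :* p) :* q) ≋-refl u v Q (P m) (Φ° n) ⟩
      (u ⊗ Φ° n ⊕ v ⊗ P m) ⊗ Q   ≈⟨ *-congʳ e ⟩
      C c ⊗ Q ∎)
    -- This divisor of a nonzero multiple of `Q` has degree D + 1, so D + 1 ≤ m.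
    divisor : Monic (Φ° n ⊗ (X ⊕ 1ₚ)) (D ℕ.+ 1)
    divisor = lead-⊗ mΦ (lead-⊕ X-monic (above 1-monic))
    degrees : ∀ {a} → a ≢ 0ℤ → Φ° n ⊗ (X ⊕ 1ₚ) ∣ C a ⊗ Q → D ℕ.< m
    degrees {a} a≢0 (q , q≋) = compare (∃lead q)
      where
      right : Lead (C a ⊗ Q) m (a ℤ.* 1ℤ)
      right = lead-C⊗ a (lead-⊕ (X^-monic m) (below-mono 0<m (above 1-monic)))
      right≢0 : a ℤ.* 1ℤ ≢ 0ℤ
      right≢0 = *-≢0 a≢0 1≢0
      compare : (q ≋ [] ⊎ ∃₂ λ d b → b ≢ 0ℤ × Lead q d b) → D ℕ.< m
      compare (inj₁ q≋[]) = contradiction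
        (trans (sym (top right)) (at (≋-trans (≋-sym q≋) (≋-trans (*-congʳ q≋[]) (zeroˡ _))) m)) right≢0
      compare (inj₂ (d , b , b≢0 , l)) = subst (ℕ._≤ m) (ℕ.+-comm D 1) (ℕ.m+n≤o⇒n≤o d (ℕ.≤-reflexive
        (proj₁ (lead-unique (*-≢0 b≢0 1≢0) right≢0 (lead-resp q≋ (lead-⊗ l divisor)) right))))
    conclude : Φ° n ⊥ P m → D ℕ.< m
    conclude (mk⊥ {c} c≢0 e) = conclude′ (⊥-∣⊗ Φ⊥X+1 (Φ∣cQ e) (∣-C⊗ c X+1∣Q))
      where
      conclude′ : (∃ λ b → b ≢ 0ℤ × Φ° n ⊗ (X ⊕ 1ₚ) ∣ C b ⊗ (C c ⊗ Q)) → D ℕ.< m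
      conclude′ (b , b≢0 , ∣cQ) = degrees (*-≢0 b≢0 c≢0) (∣-C⊗-trans ∣cQ ≋-refl)

open CyclotomicFactors

-- Evaluation in a commutative ring and synthetic division

module Evaluation (K : CommutativeRing 0ℓ 0ℓ) where
  open CommutativeRing K hiding (zero)
  open IntegerScalars K
  open Solver using (solve; con; _:=_; _:+_; _:*_; _:-_; :-_)
  open import Algebra.Properties.Semiring.Exp semiring using (_^_; ^-congˡ; ^-assocʳ)
  open import Relation.Binary.Reasoning.Setoid setoid
  open ℤX using (_∣_; _,_)

  -- Coefficients in K are allowed because division by X - α leaves the polynomials over ℤ.
  horner : Carrier → List Carrier → Carrier
  horner x []      = 0#
  horner x (a ∷ f) = a + x * horner x f

  eval : Carrier → Poly → Carrier
  eval x f = horner x (map ι f)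

  eval-≋[] : ∀ x {f} → f ≋ [] → eval x f ≈ 0#
  eval-≋[] x {[]}    e = refl
  eval-≋[] x {a ∷ f} e = begin
    ι a + x * eval x f   ≈⟨ +-cong (reflexive (cong ι (at e 0))) (*-congˡ (eval-≋[] x (tail-≋[] e))) ⟩
    0# + x * 0#          ≈⟨ solve 1 (λ x → con 0ℤ :+ x :* con 0ℤ := con 0ℤ) refl x ⟩
    0#                   ∎

  eval-cong : ∀ x {f g} → f ≋ g → eval x f ≈ eval x g
  eval-cong x {[]}    {g}     e = sym (eval-≋[] x (≋-sym e))
  eval-cong x {a ∷ f} {[]}    e = eval-≋[] x e
  eval-cong x {a ∷ f} {b ∷ g} e = +-cong (reflexive (cong ι (at e 0))) (*-congˡ (eval-cong x (tail-≋ e)))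

  eval-congˡ : ∀ {x y} f → x ≈ y → eval x f ≈ eval y f
  eval-congˡ []      e = refl
  eval-congˡ (a ∷ f) e = +-congˡ (*-cong e (eval-congˡ f e))

  eval-+ₚ : ∀ x f g → eval x (f +ₚ g) ≈ eval x f + eval x g
  eval-+ₚ x []      g       = sym (+-identityˡ _)
  eval-+ₚ x (a ∷ f) []      = sym (+-identityʳ _)
  eval-+ₚ x (a ∷ f) (b ∷ g) = begin
    ι (a ℤ.+ b) + x * eval x (f +ₚ g)              ≈⟨ +-cong (ι-+ a b) (*-congˡ (eval-+ₚ x f g)) ⟩
    (ι a + ι b) + x * (eval x f + eval x g)
      ≈⟨ solve 5 (λ a b x u v → (a :+ b) :+ x :* (u :+ v) := (a :+ x :* u) :+ (b :+ x :* v)) refl (ι a) (ι b) x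
          (eval x f) (eval x g) ⟩
    (ι a + x * eval x f) + (ι b + x * eval x g)    ∎

  eval-⊕ : ∀ x f g → eval x (f ⊕ g) ≈ eval x f + eval x g
  eval-⊕ x f g = trans (reflexive (cong (eval x) (⊕≡+ₚ f g))) (eval-+ₚ x f g)

  eval-·ₚ : ∀ x c f → eval x (c ·ₚ f) ≈ ι c * eval x f
  eval-·ₚ x c []      = sym (zeroʳ _)
  eval-·ₚ x c (a ∷ f) = begin
    ι (c ℤ.* a) + x * eval x (c ·ₚ f)    ≈⟨ +-cong (ι-* c a) (*-congˡ (eval-·ₚ x c f)) ⟩
    ι c * ι a + x * (ι c * eval x f)
      ≈⟨ solve 4 (λ c a x u → c :* a :+ x :* (c :* u) := c :* (a :+ x :* u)) refl (ι c) (ι a) x (eval x f) ⟩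
    ι c * (ι a + x * eval x f)           ∎

  eval-C⊗ : ∀ x c f → eval x (C c ⊗ f) ≈ ι c * eval x f
  eval-C⊗ x c f = trans (eval-cong x (≋-sym (·ₚ≋C⊗ c f))) (eval-·ₚ x c f)

  eval-X⊗ : ∀ x f → eval x (X ⊗ f) ≈ x * eval x f
  eval-X⊗ x f = trans (eval-cong x (X⊗ f)) (+-identityˡ _)

  eval-⊗ : ∀ x f g → eval x (f ⊗ g) ≈ eval x f * eval x g
  eval-⊗ x []      g = trans (eval-≋[] x (ℤX.zeroˡ g)) (sym (zeroˡ _))
  eval-⊗ x (a ∷ f) g = begin
    eval x ((a ∷ f) ⊗ g)
      ≈⟨ eval-cong x (≋-trans (ℤX.*-congʳ (∷≋C⊕X⊗ a f)) (ℤX.distribʳ g (C a) (X ⊗ f))) ⟩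
    eval x (C a ⊗ g ⊕ X ⊗ f ⊗ g)                   ≈⟨ eval-⊕ x (C a ⊗ g) (X ⊗ f ⊗ g) ⟩
    eval x (C a ⊗ g) + eval x (X ⊗ f ⊗ g)
      ≈⟨ +-cong (eval-C⊗ x a g) (trans (eval-cong x (ℤX.*-assoc X f g)) (eval-X⊗ x (f ⊗ g))) ⟩
    ι a * eval x g + x * eval x (f ⊗ g)            ≈⟨ +-congˡ (*-congˡ (eval-⊗ x f g)) ⟩
    ι a * eval x g + x * (eval x f * eval x g)
      ≈⟨ solve 4 (λ a x u v → a :* v :+ x :* (u :* v) := (a :+ x :* u) :* v) refl (ι a) x (eval x f) (eval x g) ⟩
    (ι a + x * eval x f) * eval x g                ∎

  eval-⊝ : ∀ x f → eval x (⊝ f) ≈ - eval x f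
  eval-⊝ x f = begin
    eval x (⊝ f)
      ≈⟨ eval-cong x {⊝ f} {C -1ℤ ⊗ f} (mk≋ λ i → ≡.trans (coeff-⊝ f i) (≡.sym (coeff-C⊗ -1ℤ f i))) ⟩
    eval x (C -1ℤ ⊗ f)    ≈⟨ eval-C⊗ x -1ℤ f ⟩
    - 1# * eval x f       ≈⟨ solve 1 (λ u → con -1ℤ :* u := :- u) refl (eval x f) ⟩
    - eval x f            ∎

  eval-1ₚ : ∀ x → eval x 1ₚ ≈ 1#
  eval-1ₚ x = trans (+-congˡ (zeroʳ x)) (+-identityʳ 1#)

  eval-^ : ∀ x f k → eval x (f ℤX.^ k) ≈ eval x f ^ k
  eval-^ x f zero    = eval-1ₚ x
  eval-^ x f (suc k) = trans (eval-⊗ x f (f ℤX.^ k)) (*-congˡ (eval-^ x f k))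

  eval-C : ∀ x c → eval x (C c) ≈ ι c
  eval-C x c = trans (+-congˡ (zeroʳ x)) (+-identityʳ _)

  eval-X : ∀ x → eval x X ≈ x
  eval-X x = solve 1 (λ x → con 0ℤ :+ x :* (con 1ℤ :+ x :* con 0ℤ) := x) refl x

  eval-P : ∀ x n → eval x (P n) ≈ x ^ n - 1#
  eval-P x n = trans (eval-⊕ x (X ℤX.^ n) (⊝ 1ₚ))
    (+-cong (trans (eval-^ x X n) (^-congˡ n (eval-X x))) (trans (eval-⊝ x 1ₚ) (-‿cong (eval-1ₚ x))))

  eval-∣ : ∀ x {f g} → f ∣ g → eval x f ≈ 0# → eval x g ≈ 0#
  eval-∣ x {f} {g} (q , qf≋g) fx≈0 = begin
    eval x g               ≈⟨ eval-cong x qf≋g ⟨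
    eval x (q ⊗ f)         ≈⟨ eval-⊗ x q f ⟩
    eval x q * eval x f    ≈⟨ *-congˡ fx≈0 ⟩
    eval x q * 0#          ≈⟨ zeroʳ _ ⟩
    0#                     ∎

  -- The quotient of a ∷ f by X - α does not depend on a.
  quotient : Carrier → List Carrier → List Carrier
  quotient α []      = []
  quotient α (b ∷ f) = horner α (b ∷ f) ∷ quotient α f

  length-quotient : ∀ α f → length (quotient α f) ≡ length f
  length-quotient α []      = ≡.refl
  length-quotient α (b ∷ f) = cong suc (length-quotient α f)

  -- Synthetic division: the Horner values at α of the successive tails are the coefficients of the
  -- quotient by X - α.
  horner-quotient : ∀ α x a f → horner x (a ∷ f) ≈ horner α (a ∷ f) + (x - α) * horner x (quotient α f)
  horner-quotient α x a [] =
    solve 3 (λ a x α → a :+ x :* con 0ℤ := (a :+ α :* con 0ℤ) :+ (x :- α) :* con 0ℤ) refl a x α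
  horner-quotient α x a f@(b ∷ f′) = begin
    a + x * horner x f               ≈⟨ +-congˡ (*-congˡ (horner-quotient α x b f′)) ⟩
    a + x * (Fα + (x - α) * Qx)
      ≈⟨ solve 5 (λ a x α F Q → a :+ x :* (F :+ (x :- α) :* Q) := (a :+ α :* F) :+ (x :- α) :* (F :+ x :* Q))
          refl a x α Fα Qx ⟩
    (a + α * Fα) + (x - α) * (Fα + x * Qx) ∎
    where
    Fα Qx : Carrier
    Fα = horner α f
    Qx = horner x (quotient α f′)

  -- Each coefficient is the difference of a Horner value and α times the next one, and all of these
  -- vanish.
  quotient-zero : ∀ α a f → All (_≈ 0#) (quotient α f) → horner α (a ∷ f) ≈ 0# → All (_≈ 0#) (a ∷ f)
  quotient-zero α a [] [] e = trans (sym (trans (+-congˡ (zeroʳ α)) (+-identityʳ a))) e ∷ []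
  quotient-zero α a (b ∷ f) (Fα≈0 ∷ Q) e =
    trans (sym (trans (+-congˡ (trans (*-congˡ Fα≈0) (zeroʳ α))) (+-identityʳ a))) e ∷ quotient-zero α b f Q Fα≈0

-- Counting roots in a domain of characteristic 0

-- zero-product is not stated as a disjunction, which is not constructively provable for ℂ.
record IsDomain₀ (K : CommutativeRing 0ℓ 0ℓ) : Set where
  open CommutativeRing K
  open IntegerScalars K using (ι)
  field
    zero-product : ∀ {a b} → ¬ a ≈ 0# → a * b ≈ 0# → b ≈ 0#
    char-0       : ∀ n → ¬ ι (+ suc n) ≈ 0#

coeff-take : ∀ n f {i} → i ℕ.< n → coeff (take n f) i ≡ coeff f i
coeff-take (suc n) []      _                 = ≡.refl
coeff-take (suc n) (a ∷ f) {zero}  _         = ≡.refl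
coeff-take (suc n) (a ∷ f) {suc i} (ℕ.s≤s h) = coeff-take n f h

below-take : ∀ n f → DegBelow (take n f) n
below-take zero    f       = below-[] ≋-refl
below-take (suc n) []      = below-[] ≋-refl
below-take (suc n) (a ∷ f) = below-∷ (below-take n f)

-- Root counting goes by the length of the list, which trailing zeros may make larger than the
-- degree warrants; truncation repairs this.
take-≋ : ∀ {n f} → DegBelow f n → take n f ≋ f
take-≋ {n} {f} b = mk≋ λ i → go i (i ℕ.<? n)
  where
  go : ∀ i → _ → coeff (take n f) i ≡ coeff f i
  go i (yes i<n) = coeff-take n f i<n
  go i (no i≮n)  = ≡.trans (vanish (below-take n f) i (ℕ.≮⇒≥ i≮n)) (≡.sym (vanish b i (ℕ.≮⇒≥ i≮n)))

module Roots (K : CommutativeRing 0ℓ 0ℓ) (dom : IsDomain₀ K) where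
  open CommutativeRing K hiding (zero)
  open IntegerScalars K
  open Evaluation K
  open IsDomain₀ dom
  open import Algebra.Properties.Semiring.Exp semiring using (_^_)
  open import Algebra.Properties.Ring ring using (-0#≈0#; -‿involutive)
  open import Algebra.Properties.Group +-group using (x∙y⁻¹≈ε⇒x≈y)
  open Solver using (solve; con; _:=_; _:+_; _:*_; _:-_; :-_)
  open import Relation.Binary.Reasoning.Setoid setoid

  ι≈0⇒≡0 : ∀ {c} → ι c ≈ 0# → c ≡ 0ℤ
  ι≈0⇒≡0 {+ zero}    e = ≡.refl
  ι≈0⇒≡0 {+ suc n}   e = contradiction e (char-0 n)
  ι≈0⇒≡0 { -[1+ n ]} e = contradiction (trans (sym (-‿involutive _)) (trans (-‿cong e) -0#≈0#)) (char-0 n)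

  ι^-cancel : ∀ {c b} k → c ≢ 0ℤ → ι c ^ k * b ≈ 0# → b ≈ 0#
  ι^-cancel zero    c≢0 e = trans (sym (*-identityˡ _)) e
  ι^-cancel (suc k) c≢0 e = ι^-cancel k c≢0
      (zero-product (λ ιc≈0 → c≢0 (ι≈0⇒≡0 ιc≈0)) (trans (sym (*-assoc _ _ _)) e))

  -- Divide by X - x₀. The remaining points are roots of the quotient, since `zero-product` only
  -- asks for the negated equality that distinctness supplies.
  roots-bound : ∀ N f (x : ℕ → Carrier) → length f ℕ.≤ N →
    (∀ i j → i ℕ.< j → j ℕ.< N → ¬ x i ≈ x j) → (∀ i → i ℕ.< N → horner (x i) f ≈ 0#) → All (_≈ 0#) f
  roots-bound N       []      x len≤  distinct root = []
  roots-bound (suc N) (a ∷ f) x (ℕ.s≤s len≤) distinct root = quotient-zero α a f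
    (roots-bound N (quotient α f) (x ∘ suc) (subst (ℕ._≤ N) (≡.sym (length-quotient α f)) len≤)
      (λ i j i<j j<N → distinct (suc i) (suc j) (ℕ.s≤s i<j) (ℕ.s≤s j<N)) root′)
    (root 0 (ℕ.s≤s ℕ.z≤n))
    where
    α : Carrier
    α = x 0
    root′ : ∀ i → i ℕ.< N → horner (x (suc i)) (quotient α f) ≈ 0#
    root′ i i<N = zero-product
      (λ y-α≈0 → distinct 0 (suc i) (ℕ.s≤s ℕ.z≤n) (ℕ.s≤s i<N) (sym (x∙y⁻¹≈ε⇒x≈y _ _ y-α≈0))) (begin
      (y - α) * Q                      ≈⟨ +-identityˡ _ ⟨
      0# + (y - α) * Q                 ≈⟨ +-congʳ (root 0 (ℕ.s≤s ℕ.z≤n)) ⟨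
      horner α (a ∷ f) + (y - α) * Q   ≈⟨ horner-quotient α y a f ⟨
      horner y (a ∷ f)                 ≈⟨ root (suc i) (ℕ.s≤s i<N) ⟩
      0#                               ∎)
      where
      y Q : Carrier
      y = x (suc i)
      Q = horner y (quotient α f)

  All-ι≈0⇒≋[] : ∀ f → All (_≈ 0#) (map ι f) → f ≋ []
  All-ι≈0⇒≋[] []      []      = ≋-refl
  All-ι≈0⇒≋[] (a ∷ f) (e ∷ es) = mk≋ λ { zero → ι≈0⇒≡0 e ; (suc i) → at (All-ι≈0⇒≋[] f es) i }

  vanishing⇒≋[] : ∀ {N f} (x : ℕ → Carrier) → DegBelow f N →
    (∀ i j → i ℕ.< j → j ℕ.< N → ¬ x i ≈ x j) → (∀ i → i ℕ.< N → eval (x i) f ≈ 0#) → f ≋ []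
  vanishing⇒≋[] {N} {f} x b distinct root = ≋-trans (≋-sym (take-≋ b))
    (All-ι≈0⇒≋[] (take N f) (roots-bound N (map ι (take N f)) x
      (ℕ.≤-trans (ℕ.≤-reflexive (List.length-map ι (take N f)))
        (ℕ.≤-trans (ℕ.≤-reflexive (List.length-take N f)) (ℕ.m⊓n≤m N (length f))))
      distinct (λ i i<N → trans (eval-cong (x i) (take-≋ b)) (root i i<N))))

-- The Frobenius congruence for polynomials

module FrobeniusModP where
  open ≡ using (refl; sym; trans)
  open ℤX

  open PowerIdentities ℤ[X] using (_⨯_; frobenius)
  open import Relation.Binary.Reasoning.Setoid setoid
  open Solver using (solve; con; _:=_; _:+_; _:*_; _:-_; :-_)
  open import Algebra.Properties.CommutativeSemiring.Exp (CommutativeRing.commutativeSemiring ℤ[X]) using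
      (^-distrib-*)

  ⨯≋C⊗ : ∀ k f → k ⨯ f ≋ C (+ k) ⊗ f
  ⨯≋C⊗ zero    f = ≋-sym (≋-trans (*-congʳ (0∷[] ≋-refl)) (zeroˡ f))
  ⨯≋C⊗ (suc k) f = begin
    f ⊕ k ⨯ f                  ≈⟨ +-cong (≋-sym (*-identityˡ f)) (⨯≋C⊗ k f) ⟩
    1ₚ ⊗ f ⊕ C (+ k) ⊗ f       ≈⟨ distribʳ f 1ₚ (C (+ k)) ⟨
    (1ₚ ⊕ C (+ k)) ⊗ f         ≈⟨ *-congʳ (C-⊕ 1ℤ (+ k)) ⟨
    C (+ suc k) ⊗ f            ∎

  freshman : ∀ {p} → Prime p → ∀ f g → ∃ λ h → (f ⊕ g) ^ p ≋ f ^ p ⊕ g ^ p ⊕ C (+ p) ⊗ h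
  freshman {p} pr f g = go (frobenius pr f g)
    where
    go : (∃ λ h → (f ⊕ g) ^ p ≋ f ^ p ⊕ g ^ p ⊕ p ⨯ h) → ∃ λ h → (f ⊕ g) ^ p ≋ f ^ p ⊕ g ^ p ⊕ C (+ p) ⊗ h
    go (h , e) = h , ≋-trans e (+-congˡ (⨯≋C⊗ p h))

  []^ : ∀ {p} → Prime p → [] ^ p ≋ []
  []^ {zero}  pr with () ← prime⇒nonZero pr
  []^ {suc p} pr = zeroˡ _

  1^ : ∀ k → 1ₚ ^ k ≋ 1ₚ
  1^ zero    = ≋-refl
  1^ (suc k) = ≋-trans (*-identityˡ _) (1^ k)

  module _ {p} (pr : Prime p) where
    private
      Fermat : ℤ → Set
      Fermat a = ∃ λ h → C a ^ p ≋ C a ⊕ C (+ p) ⊗ h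

      fermat⁺ : ∀ k → Fermat (+ k)
      fermat⁺ zero = [] , (begin
        C 0ℤ ^ p                 ≈⟨ ^-congˡ p (0∷[] (≋-refl {[]})) ⟩
        [] ^ p                   ≈⟨ []^ pr ⟩
        []                       ≈⟨ 0∷[] ≋-refl ⟨
        C 0ℤ                     ≈⟨ +-identityʳ _ ⟨
        C 0ℤ ⊕ []                ≈⟨ +-congˡ (zeroʳ (C (+ p))) ⟨
        C 0ℤ ⊕ C (+ p) ⊗ []      ∎)
      fermat⁺ (suc k) = go (fermat⁺ k) (freshman pr 1ₚ (C (+ k)))
        where
        go : Fermat (+ k) → (∃ λ h → (1ₚ ⊕ C (+ k)) ^ p ≋ 1ₚ ^ p ⊕ C (+ k) ^ p ⊕ C (+ p) ⊗ h) → Fermat (+ suc k)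
        go (h , e) (h′ , e′) = h ⊕ h′ , (begin
          C (+ suc k) ^ p                                        ≈⟨ ^-congˡ p (C-⊕ 1ℤ (+ k)) ⟩
          (1ₚ ⊕ C (+ k)) ^ p                                     ≈⟨ e′ ⟩
          1ₚ ^ p ⊕ C (+ k) ^ p ⊕ C (+ p) ⊗ h′                    ≈⟨ +-congʳ (+-cong (1^ p) e) ⟩
          1ₚ ⊕ (C (+ k) ⊕ C (+ p) ⊗ h) ⊕ C (+ p) ⊗ h′
            ≈⟨ solve 5 (λ o k p h h′ → (o :+ (k :+ p :* h)) :+ p :* h′ := (o :+ k) :+ p :* (h :+ h′)) ≋-refl 1ₚ
                (C (+ k)) (C (+ p)) h h′ ⟩
          (1ₚ ⊕ C (+ k)) ⊕ C (+ p) ⊗ (h ⊕ h′)                    ≈⟨ +-congʳ (C-⊕ 1ℤ (+ k)) ⟨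
          C (+ suc k) ⊕ C (+ p) ⊗ (h ⊕ h′)                       ∎)

    -- A negative constant is treated by expanding the p-th power of b + (-b) = 0. This avoids the
    -- sign of (-1)ᵖ and a special case for p = 2.
    fermat : ∀ a → Fermat a
    fermat (+ k)    = fermat⁺ k
    fermat -[1+ k ] = go (fermat⁺ (suc k)) (freshman pr (C b) (C -[1+ k ]))
      where
      b : ℤ
      b = + suc k
      b-b≋[] : C b ⊕ C -[1+ k ] ≋ []
      b-b≋[] = ≋-trans (≋-sym (C-⊕ b -[1+ k ])) (≋-trans (∷-cong (ℤ.+-inverseʳ b) ≋-refl) (0∷[] ≋-refl))
      go : Fermat b → (∃ λ h → (C b ⊕ C -[1+ k ]) ^ p ≋ C b ^ p ⊕ C -[1+ k ] ^ p ⊕ C (+ p) ⊗ h) → Fermat -[1+ k ]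
      go (h , e) (h′ , e′) = ⊝ (h ⊕ h′) , (begin
        y
          ≈⟨ solve 5 (λ x y p h h′ → y := ((x :+ p :* h) :+ y :+ p :* h′) :- x :- p :* (h :+ h′)) ≋-refl (C b) y
              (C (+ p)) h h′ ⟩
        ((C b ⊕ C (+ p) ⊗ h) ⊕ y ⊕ C (+ p) ⊗ h′) - C b - C (+ p) ⊗ (h ⊕ h′)
          ≈⟨ +-congʳ (+-congʳ (≋-trans (≋-sym (≋-trans e′ (+-congʳ (+-congʳ e))))
              (≋-trans (^-congˡ p b-b≋[]) ([]^ pr)))) ⟩
        ([] - C b) - C (+ p) ⊗ (h ⊕ h′)
          ≈⟨ +-congʳ (+-congʳ b-b≋[]) ⟨
        ((C b ⊕ C -[1+ k ]) - C b) - C (+ p) ⊗ (h ⊕ h′)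
          ≈⟨ solve 4 (λ x z p h → (x :+ z) :- x :- p :* h := z :+ p :* (:- h)) ≋-refl (C b) (C -[1+ k ])
              (C (+ p)) (h ⊕ h′) ⟩
        C -[1+ k ] ⊕ C (+ p) ⊗ (⊝ (h ⊕ h′)) ∎)
        where
        y : Poly
        y = C -[1+ k ] ^ p

  -- The polynomial f(Xᵖ).
  expand : ℕ → Poly → Poly
  expand p []      = []
  expand p (a ∷ f) = C a ⊕ X ^ p ⊗ expand p f

  -- Induction along Horner's scheme: `freshman` splits off the constant term, and `fermat` replaces
  -- its p-th power by the constant itself.
  ^p≡expand : ∀ {p} → Prime p → ∀ f → ∃ λ h → f ^ p ≋ expand p f ⊕ C (+ p) ⊗ h
  ^p≡expand {p} pr [] = [] , ≋-trans ([]^ pr) (≋-sym (≋-trans (+-identityˡ _) (zeroʳ _)))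
  ^p≡expand {p} pr (a ∷ f) = go (fermat pr a) (^p≡expand pr f) (freshman pr (C a) (X ⊗ f))
    where
    go : (∃ λ h → C a ^ p ≋ C a ⊕ C (+ p) ⊗ h) → (∃ λ h → f ^ p ≋ expand p f ⊕ C (+ p) ⊗ h) →
         (∃ λ h → (C a ⊕ X ⊗ f) ^ p ≋ C a ^ p ⊕ (X ⊗ f) ^ p ⊕ C (+ p) ⊗ h) →
         ∃ λ h → (a ∷ f) ^ p ≋ expand p (a ∷ f) ⊕ C (+ p) ⊗ h
    go (h , e) (h′ , e′) (h″ , e″) = h ⊕ X ^ p ⊗ h′ ⊕ h″ , (begin
      (a ∷ f) ^ p                                      ≈⟨ ^-congˡ p (∷≋C⊕X⊗ a f) ⟩
      (C a ⊕ X ⊗ f) ^ p                                ≈⟨ e″ ⟩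
      C a ^ p ⊕ (X ⊗ f) ^ p ⊕ C (+ p) ⊗ h″
        ≈⟨ +-congʳ (+-cong e (≋-trans (^-distrib-* X f p) (*-congˡ e′))) ⟩
      (C a ⊕ C (+ p) ⊗ h) ⊕ X ^ p ⊗ (expand p f ⊕ C (+ p) ⊗ h′) ⊕ C (+ p) ⊗ h″
        ≈⟨ solve 7 (λ a p h x f h′ h″ → (a :+ p :* h) :+ x :* (f :+ p :* h′) :+ p :* h″ := (a :+ x :* f) :+ p :*
            (h :+ x :* h′ :+ h″))
             ≋-refl (C a) (C (+ p)) h (X ^ p) (expand p f) h′ h″ ⟩
      expand p (a ∷ f) ⊕ C (+ p) ⊗ (h ⊕ X ^ p ⊗ h′ ⊕ h″) ∎)

open FrobeniusModP

-- Large prime factors in residue classes, and bounds on coefficients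

prime≢1 : ∀ {p} → Prime p → p ≢ 1
prime≢1 pr ≡.refl with () ← prime⇒nonTrivial pr

coprime-*ˡ : ∀ {m k a} → Coprime m a → Coprime k a → Coprime (m ℕ.* k) a
coprime-*ˡ {m} {k} {a} m⊥a k⊥a {i} (i∣mk , i∣a) = k⊥a (coprime-divisor {i} {m} {k} i⊥m i∣mk , i∣a)
  where
  i⊥m : Coprime i m
  i⊥m (d∣i , d∣m) = m⊥a (d∣m , ℕ∣.∣-trans d∣i i∣a)

prime∤⇒coprime : ∀ {p a} → Prime p → ¬ p ∣ⁿ a → Coprime p a
prime∤⇒coprime pr p∤a {d} (d∣p , d∣a) with prime⇒irreducible pr d∣p
... | inj₁ d≡1    = d≡1
... | inj₂ ≡.refl = contradiction d∣a p∤a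

module _ (a : ℕ) where
  private
    factor : ∀ q → Dec (Coprime q a) → ℕ
    factor q (yes _) = q
    factor q (no _)  = 1

    coprimePart : ℕ → ℕ
    coprimePart zero    = 1
    coprimePart (suc b) = factor (suc b) (coprime? (suc b) a) ℕ.* coprimePart b

    coprimePart-coprime : ∀ b → Coprime (coprimePart b) a
    coprimePart-coprime zero    = Coprime.1-coprimeTo a
    coprimePart-coprime (suc b) = coprime-*ˡ (factor-coprime (coprime? (suc b) a)) (coprimePart-coprime b)
      where
      factor-coprime : (d : Dec (Coprime (suc b) a)) → Coprime (factor (suc b) d) a
      factor-coprime (yes c) = c
      factor-coprime (no _)  = Coprime.1-coprimeTo a

    ∣coprimePart : ∀ {q} b → 0 ℕ.< q → q ℕ.≤ b → Coprime q a → q ∣ⁿ coprimePart b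
    ∣coprimePart zero    0<q q≤0 q⊥a = contradiction q≤0 (ℕ.<⇒≱ 0<q)
    ∣coprimePart (suc b) 0<q q≤b q⊥a with ℕ.m≤n⇒m<n∨m≡n q≤b
    ... | inj₁ (ℕ.s≤s q≤b′) = ℕ∣.∣n⇒∣m*n (factor (suc b) (coprime? (suc b) a)) (∣coprimePart b 0<q q≤b′ q⊥a)
    ... | inj₂ ≡.refl = ℕ∣.∣m⇒∣m*n (coprimePart b) (∣factor (coprime? (suc b) a))
      where
      ∣factor : (d : Dec (Coprime (suc b) a)) → suc b ∣ⁿ factor (suc b) d
      ∣factor (yes _) = ℕ∣.∣-refl
      ∣factor (no ¬c) = contradiction (λ {i} → q⊥a {i}) ¬c

  -- Take for k the product of all q ≤ b coprime to a. A prime p ≤ b that divides a divides neither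
  -- n nor k; a prime p ≤ b that does not divide a divides k. In both cases p divides exactly one of
  -- a and nk, so it does not divide a + nk. This elementary fact takes the place of Dirichlet's
  -- theorem.
  coprime⇒∃-largePrimes : ∀ {n} b → Coprime a n → ∃ λ k → ∀ {p} → Prime p → p ∣ⁿ a ℕ.+ n ℕ.* k → b ℕ.< p
  coprime⇒∃-largePrimes {n} b a⊥n = k , λ pr p∣ → ℕ.≰⇒> λ p≤b → small pr p∣ p≤b
    where
    k : ℕ
    k = coprimePart b
    small : ∀ {p} → Prime p → p ∣ⁿ a ℕ.+ n ℕ.* k → ¬ p ℕ.≤ b
    small {p} pr p∣a+nk p≤b with p ∣? a
    ... | yes p∣a with euclidsLemma n k pr (ℕ∣.∣m+n∣m⇒∣n p∣a+nk p∣a)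
    ...   | inj₁ p∣n = prime≢1 pr (a⊥n (p∣a , p∣n))
    ...   | inj₂ p∣k = prime≢1 pr (coprimePart-coprime b (p∣k , p∣a))
    small {p} pr p∣a+nk p≤b | no p∤a = p∤a
        (ℕ∣.∣m+n∣m⇒∣n (subst (p ∣ⁿ_) (ℕ.+-comm a (n ℕ.* k)) p∣a+nk) (ℕ∣.∣n⇒∣m*n n p∣k))
      where
      p∣k : p ∣ⁿ k
      p∣k = ∣coprimePart b (ℕ.>-nonZero⁻¹ p {{prime⇒nonZero pr}}) p≤b (prime∤⇒coprime pr p∤a)

bound : ∀ (g : ℕ → ℕ) n → ∃ λ b → ∀ i → i ℕ.< n → g i ℕ.≤ b
bound g zero    = 0 , λ _ ()
bound g (suc n) with bound g n
... | b , g≤b = b ℕ.⊔ g n , λ i i<1+n → [ (λ i<n → ℕ.≤-trans (g≤b i i<n) (ℕ.m≤m⊔n b (g n)))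
                                        , (λ { ≡.refl → ℕ.m≤n⊔m b (g i) }) ]′ (ℕ.m≤n⇒m<n∨m≡n (ℕ.s≤s⁻¹ i<1+n))

coeff≤height : ∀ f i → ℤ.∣ coeff f i ∣ ℕ.≤ height f
coeff≤height []      i       = ℕ.z≤n
coeff≤height (a ∷ f) zero    = ℕ.m≤m⊔n ℤ.∣ a ∣ (height f)
coeff≤height (a ∷ f) (suc i) = ℕ.≤-trans (coeff≤height f i) (ℕ.m≤n⊔m ℤ.∣ a ∣ (height f))

coeff-C^⊗ : ∀ c k f i → coeff (C c ℤX.^ k ⊗ f) i ≡ (c ℤ.^ k) ℤ.* coeff f i
coeff-C^⊗ c zero    f i = ≡.trans (at (ℤX.*-identityˡ f) i) (≡.sym (ℤ.*-identityˡ _))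
coeff-C^⊗ c (suc k) f i = ≡.trans (at (ℤX.*-assoc (C c) (C c ℤX.^ k) f) i) (≡.trans (coeff-C⊗ c (C c ℤX.^ k ⊗ f) i)
  (≡.trans (cong (c ℤ.*_) (coeff-C^⊗ c k f i)) (≡.sym (ℤ.*-assoc c (c ℤ.^ k) _))))

∣∧<⇒≡0 : ∀ {p x} → p ∣ⁿ x → x ℕ.< p → x ≡ 0
∣∧<⇒≡0 {x = zero}  _   _   = ≡.refl
∣∧<⇒≡0 {x = suc x} p∣x x<p = contradiction (ℕ∣.∣⇒≤ p∣x) (ℕ.<⇒≱ x<p)

-- Disposes of the powers of the leading coefficient that pseudo-division introduces: p exceeds |c|
-- and c ≠ 0, so p divides b, which is too small unless it is 0.
prime∣^*⇒≡0 : ∀ {p c} → Prime p → c ≢ 0ℤ → ℤ.∣ c ∣ ℕ.< p → ∀ k {b} → ℤ.∣ b ∣ ℕ.< p → p ∣ⁿ ℤ.∣ (c ℤ.^ k) ℤ.* b ∣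
    → b ≡ 0ℤ
prime∣^*⇒≡0 {p} pr c≢0 c<p zero {b} b<p p∣ =
  ℤ.∣i∣≡0⇒i≡0 (∣∧<⇒≡0 (subst (λ z → p ∣ⁿ ℤ.∣ z ∣) (ℤ.*-identityˡ b) p∣) b<p)
prime∣^*⇒≡0 {p} {c} pr c≢0 c<p (suc k) {b} b<p p∣ =
  [ (λ p∣c → contradiction (ℤ.∣i∣≡0⇒i≡0 (∣∧<⇒≡0 p∣c c<p)) c≢0) , prime∣^*⇒≡0 pr c≢0 c<p k b<p ]′
    (euclidsLemma ℤ.∣ c ∣ ℤ.∣ (c ℤ.^ k) ℤ.* b ∣ pr
      (subst (p ∣ⁿ_) (≡.trans (cong ℤ.∣_∣ (ℤ.*-assoc c (c ℤ.^ k) b)) (ℤ.abs-* c _)) p∣))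

-- Primitive roots and the minimality of the cyclotomic degree

module PrimitiveRoots (K : CommutativeRing 0ℓ 0ℓ) (dom : IsDomain₀ K) where
  open CommutativeRing K hiding (zero)
  open IntegerScalars K
  open Evaluation K
  open IsDomain₀ dom
  open Roots K dom
  open import Algebra.Properties.Semiring.Exp semiring using (_^_; ^-homo-*; ^-assocʳ; ^-congˡ)
  open import Algebra.Properties.Group +-group using (x∙y⁻¹≈ε⇒x≈y; x≈y⇒x∙y⁻¹≈ε)
  open Solver using (solve; con; _:=_; _:+_; _:*_; _:-_; :-_)
  open import Relation.Binary.Reasoning.Setoid setoid

  1≉0 : ¬ 1# ≈ 0#
  1≉0 = char-0 0

  ≈1-^ : ∀ {x} k → x ≈ 1# → x ^ k ≈ 1#
  ≈1-^ zero    e = refl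
  ≈1-^ (suc k) e = trans (*-cong e (≈1-^ k e)) (*-identityˡ 1#)

  ^-cong≡ : ∀ x {m n} → m ≡ n → x ^ m ≈ x ^ n
  ^-cong≡ x ≡.refl = refl

  eval-expand : ∀ x p f → eval x (expand p f) ≈ eval (x ^ p) f
  eval-expand x p []      = refl
  eval-expand x p (a ∷ f) = begin
    eval x (C a ⊕ X ℤX.^ p ⊗ expand p f)                  ≈⟨ eval-⊕ x (C a) (X ℤX.^ p ⊗ expand p f) ⟩
    eval x (C a) + eval x (X ℤX.^ p ⊗ expand p f)
      ≈⟨ +-cong (eval-C x a) (trans (eval-⊗ x (X ℤX.^ p) (expand p f))
           (*-cong (trans (eval-^ x X p) (^-congˡ p (eval-X x))) (eval-expand x p f))) ⟩
    ι a + x ^ p * eval (x ^ p) f                          ∎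

  module Root {n} (1<n : 1 ℕ.< n) (ζ : Carrier) (ζ^n≈1 : ζ ^ n ≈ 1#)
              (order≥ : ∀ m → 0 ℕ.< m → m ℕ.< n → ¬ ζ ^ m ≈ 1#) where

    0<n : 0 ℕ.< n
    0<n = ℕ.<-trans (ℕ.s≤s ℕ.z≤n) 1<n

    instance
      n≢0 : ℕ.NonZero n
      n≢0 = ℕ.>-nonZero 0<n

    ζ^[a+nk] : ∀ a k → ζ ^ (a ℕ.+ n ℕ.* k) ≈ ζ ^ a
    ζ^[a+nk] a k = begin
      ζ ^ (a ℕ.+ n ℕ.* k)      ≈⟨ ^-homo-* ζ a (n ℕ.* k) ⟩
      ζ ^ a * ζ ^ (n ℕ.* k)    ≈⟨ *-congˡ (^-assocʳ ζ n k) ⟨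
      ζ ^ a * (ζ ^ n) ^ k      ≈⟨ *-congˡ (≈1-^ k ζ^n≈1) ⟩
      ζ ^ a * 1#               ≈⟨ *-identityʳ _ ⟩
      ζ ^ a                    ∎

    ζ^-% : ∀ a → ζ ^ a ≈ ζ ^ (a % n)
    ζ^-% a = trans (^-cong≡ ζ (≡.trans (m≡m%n+[m/n]*n a n) (cong (a % n ℕ.+_) (ℕ.*-comm (a / n) n))))
      (ζ^[a+nk] (a % n) (a / n))

    -- Division by ζⁱ is replaced by multiplication with ζ^(n-i): adding the period n to j - i gives
    -- j + (n - i), where ζʲ can be exchanged for ζⁱ.
    ζ^-distinct : ∀ i j → i ℕ.< j → j ℕ.< n → ¬ ζ ^ i ≈ ζ ^ j
    ζ^-distinct i j i<j j<n e = order≥ (j ℕ.∸ i) (ℕ.m<n⇒0<n∸m i<j) (ℕ.≤-<-trans (ℕ.m∸n≤m j i) j<n) (begin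
      ζ ^ (j ℕ.∸ i)                    ≈⟨ ζ^[a+nk] (j ℕ.∸ i) 1 ⟨
      ζ ^ (j ℕ.∸ i ℕ.+ n ℕ.* 1)        ≈⟨ ^-cong≡ ζ eq ⟩
      ζ ^ (j ℕ.+ (n ℕ.∸ i))            ≈⟨ ^-homo-* ζ j (n ℕ.∸ i) ⟩
      ζ ^ j * ζ ^ (n ℕ.∸ i)            ≈⟨ *-congʳ e ⟨
      ζ ^ i * ζ ^ (n ℕ.∸ i)            ≈⟨ ^-homo-* ζ i (n ℕ.∸ i) ⟨
      ζ ^ (i ℕ.+ (n ℕ.∸ i))            ≈⟨ ^-cong≡ ζ (ℕ.m+[n∸m]≡n (ℕ.<⇒≤ (ℕ.<-trans i<j j<n))) ⟩
      ζ ^ n                            ≈⟨ ζ^n≈1 ⟩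
      1#                               ∎)
      where
      eq : j ℕ.∸ i ℕ.+ n ℕ.* 1 ≡ j ℕ.+ (n ℕ.∸ i)
      eq = ≡.trans (cong (j ℕ.∸ i ℕ.+_) (ℕ.*-identityʳ n)) (≡.trans (≡.sym (ℕ.+-∸-comm n (ℕ.<⇒≤ i<j)))
             (ℕ.+-∸-assoc j (ℕ.<⇒≤ (ℕ.<-trans i<j j<n))))

    Π-≉0 : ∀ x m {g} → (∀ i → i ℕ.< m → ¬ eval x (g i) ≈ 0#) → ¬ eval x (Π m g) ≈ 0#
    Π-≉0 x zero    g≉0 e = 1≉0 (trans (sym (eval-1ₚ x)) e)
    Π-≉0 x (suc m) {g} g≉0 e = Π-≉0 x m (λ i i<m → g≉0 (suc i) (ℕ.s≤s i<m))
      (zero-product (g≉0 0 (ℕ.s≤s ℕ.z≤n)) (trans (sym (eval-⊗ x (g 0) (Π m (g ∘ suc)))) e))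

    divisor>0 : ∀ {d} → d ∣ⁿ n → 0 ℕ.< d
    divisor>0 {zero}  0∣n = contradiction (ℕ∣.0∣⇒≡0 0∣n) (ℕ.>⇒≢ 0<n)
    divisor>0 {suc d} _   = ℕ.s≤s ℕ.z≤n

    -- The factors for proper divisors i do not vanish at ζ, as `Φ° i` divides `P i` and ζⁱ ≠ 1. So
    -- the zero of `P n` at ζ has to come from `Φ° n`.
    Φ-root : eval ζ (Φ° n) ≈ 0#
    Φ-root = zero-product Π≉0 (begin
      eval ζ (Πproper n) * eval ζ (Φ° n)   ≈⟨ *-comm _ _ ⟩
      eval ζ (Φ° n) * eval ζ (Πproper n)   ≈⟨ eval-⊗ ζ (Φ° n) (Πproper n) ⟨
      eval ζ (Φ° n ⊗ Πproper n)            ≈⟨ eval-cong ζ (Exact.exact (Φ-exact 0<n)) ⟨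
      eval ζ (P n)                         ≈⟨ eval-P ζ n ⟩
      ζ ^ n - 1#                           ≈⟨ x≈y⇒x∙y⁻¹≈ε ζ^n≈1 ⟩
      0#                                   ∎)
      where
      Π≉0 : ¬ eval ζ (Πproper n) ≈ 0#
      Π≉0 = Π-≉0 ζ n λ i i<n → Φ-factor-elim (λ f → ¬ eval ζ f ≈ 0#)
        (λ i∣n Φi≈0 → order≥ i (divisor>0 i∣n) i<n
          (x∙y⁻¹≈ε⇒x≈y _ _ (trans (sym (eval-P ζ i)) (eval-∣ ζ (Φ∣P (Φ-exact (divisor>0 i∣n))) Φi≈0))))
        (λ e → 1≉0 (trans (sym (eval-1ₚ ζ)) e))

    -- Landau's argument: for large primes p the remainder of f(Xᵖ) modulo f is divisible by p,
    -- and it depends on p only modulo n, so it vanishes.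
    module Minimal {f m c} (c≢0 : c ≢ 0ℤ) (lead-f : Lead f m c) (f[ζ]≈0 : eval ζ f ≈ 0#)
                   (minimal : ∀ h → DegBelow h m → eval ζ h ≈ 0# → h ≋ []) where

      -- By minimality the pseudo-remainder of h modulo f is 0, so f divides a nonzero multiple of
      -- h, and every root of f is a root of h.
      kernel : ∀ {z} → eval z f ≈ 0# → ∀ h → eval ζ h ≈ 0# → eval z h ≈ 0#
      kernel {z} f[z]≈0 h h[ζ]≈0 = go (pseudo-division lead-f h)
        where
        combine : ∀ x k {q s} → C c ℤX.^ k ⊗ h ≋ q ⊗ f ⊕ s → eval x f ≈ 0# → ι c ^ k * eval x h ≈ eval x s
        combine x k {q} {s} e f≈0 = begin
          ι c ^ k * eval x h               ≈⟨ *-congʳ (trans (eval-^ x (C c) k) (^-congˡ k (eval-C x c))) ⟨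
          eval x (C c ℤX.^ k) * eval x h   ≈⟨ eval-⊗ x (C c ℤX.^ k) h ⟨
          eval x (C c ℤX.^ k ⊗ h)          ≈⟨ eval-cong x e ⟩
          eval x (q ⊗ f ⊕ s)               ≈⟨ trans (eval-⊕ x (q ⊗ f) s) (+-congʳ (eval-⊗ x q f)) ⟩
          eval x q * eval x f + eval x s   ≈⟨ +-congʳ (trans (*-congˡ f≈0) (zeroʳ _)) ⟩
          0# + eval x s                    ≈⟨ +-identityˡ _ ⟩
          eval x s                         ∎
        go : (∃ λ k → ∃₂ λ q s → C c ℤX.^ k ⊗ h ≋ q ⊗ f ⊕ s × DegBelow s m) → eval z h ≈ 0#
        go (k , q , s , e , s-below) = ι^-cancel k c≢0 (trans (combine z k e f[z]≈0) (eval-≋[] z s≋[]))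
          where
          s≋[] : s ≋ []
          s≋[] = minimal s s-below (trans (sym (combine ζ k e f[ζ]≈0)) (trans (*-congˡ h[ζ]≈0) (zeroʳ _)))

      division : ∀ a → ∃ λ k → ∃₂ λ q s → C c ℤX.^ k ⊗ expand a f ≋ q ⊗ f ⊕ s × DegBelow s m
      division a = pseudo-division lead-f (expand a f)

      remainder : ℕ → Poly
      remainder a = proj₁ (proj₂ (proj₂ (division a)))

      -- Only the remainders for exponents below n enter, so the bound is independent of the prime
      -- that is to exceed it.
      threshold : ℕ
      threshold = ℤ.∣ c ∣ ℕ.⊔ proj₁ (bound (height ∘ remainder) n)

      large-prime-root : ∀ {p} → Prime p → threshold ℕ.< p → eval (ζ ^ p) f ≈ 0#
      large-prime-root {p} pr t<p = go (^p≡expand pr f)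
        where
        a k : ℕ
        a = p % n
        k = proj₁ (division a)
        q r : Poly
        q = proj₁ (proj₂ (division a))
        r = remainder a
        c^kf≋ : C c ℤX.^ k ⊗ expand a f ≋ q ⊗ f ⊕ r
        c^kf≋ = proj₁ (proj₂ (proj₂ (proj₂ (division a))))
        r-below : DegBelow r m
        r-below = proj₂ (proj₂ (proj₂ (proj₂ (division a))))
        c<p : ℤ.∣ c ∣ ℕ.< p
        c<p = ℕ.≤-<-trans (ℕ.m≤m⊔n _ _) t<p
        rᵢ<p : ∀ i → ℤ.∣ coeff r i ∣ ℕ.< p
        rᵢ<p i = ℕ.≤-<-trans (ℕ.≤-trans (coeff≤height r i)
          (ℕ.≤-trans (proj₂ (bound (height ∘ remainder) n) a (m%n<n p n)) (ℕ.m≤n⊔m ℤ.∣ c ∣ _))) t<p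
        eval-C^⊗ : ∀ j g → eval ζ (C c ℤX.^ j ⊗ g) ≈ ι c ^ j * eval ζ g
        eval-C^⊗ j g = trans (eval-⊗ ζ (C c ℤX.^ j) g) (*-congʳ (trans (eval-^ ζ (C c) j) (^-congˡ j (eval-C ζ c))))
        f[ζ^a]≈ : eval ζ (expand a f) ≈ eval (ζ ^ p) f
        f[ζ^a]≈ = trans (eval-expand ζ a f) (eval-congˡ f (sym (ζ^-% p)))
        reduce : ∀ j {g u s} → C c ℤX.^ j ⊗ g ≋ u ⊗ f ⊕ s → eval ζ s ≈ ι c ^ j * eval ζ g
        reduce j {g} {u} {s} e = begin
          eval ζ s                         ≈⟨ +-identityˡ _ ⟨
          0# + eval ζ s                    ≈⟨ +-congʳ (trans (*-congˡ f[ζ]≈0) (zeroʳ _)) ⟨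
          eval ζ u * eval ζ f + eval ζ s   ≈⟨ trans (eval-⊕ ζ (u ⊗ f) s) (+-congʳ (eval-⊗ ζ u f)) ⟨
          eval ζ (u ⊗ f ⊕ s)               ≈⟨ eval-cong ζ e ⟨
          eval ζ (C c ℤX.^ j ⊗ g)          ≈⟨ eval-C^⊗ j g ⟩
          ι c ^ j * eval ζ g               ∎
        0^p≈0 : 0# ^ p ≈ 0#
        0^p≈0 = power p (prime⇒nonZero pr)
          where
          power : ∀ p → ℕ.NonZero p → 0# ^ p ≈ 0#
          power (suc p) _ = zeroˡ _
        go : (∃ λ h → f ℤX.^ p ≋ expand p f ⊕ C (+ p) ⊗ h) → eval (ζ ^ p) f ≈ 0#
        go (h , f^p≋) = go′ (pseudo-division lead-f h)
          where
          f[ζ^p]+ph[ζ]≈0 : eval (ζ ^ p) f + ι (+ p) * eval ζ h ≈ 0#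
          f[ζ^p]+ph[ζ]≈0 = begin
            eval (ζ ^ p) f + ι (+ p) * eval ζ h        ≈⟨ +-cong (eval-expand ζ p f) (eval-C⊗ ζ (+ p) h) ⟨
            eval ζ (expand p f) + eval ζ (C (+ p) ⊗ h) ≈⟨ eval-⊕ ζ (expand p f) (C (+ p) ⊗ h) ⟨
            eval ζ (expand p f ⊕ C (+ p) ⊗ h)          ≈⟨ eval-cong ζ f^p≋ ⟨
            eval ζ (f ℤX.^ p)                          ≈⟨ eval-^ ζ f p ⟩
            eval ζ f ^ p                               ≈⟨ ^-congˡ p f[ζ]≈0 ⟩
            0# ^ p                                     ≈⟨ 0^p≈0 ⟩
            0#                                         ∎
          go′ : (∃ λ j → ∃₂ λ u s → C c ℤX.^ j ⊗ h ≋ u ⊗ f ⊕ s × DegBelow s m) → eval (ζ ^ p) f ≈ 0#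
          go′ (j , u , s , e , s-below) =
            trans (sym f[ζ^a]≈) (ι^-cancel k c≢0 (trans (sym (reduce k c^kf≋)) (eval-≋[] ζ r≋[])))
            where
            -- At ζ the remainders r and s take the values cᵏ f(ζᵖ) and cʲ h(ζ), so d takes the
            -- value cʲ cᵏ (f(ζᵖ) + p h(ζ)), which is f(ζ)ᵖ = 0 up to the factor. Its degree is
            -- below m, so d is 0.
            d : Poly
            d = C c ℤX.^ j ⊗ r ⊕ C c ℤX.^ k ⊗ (C (+ p) ⊗ s)
            below-C^ : ∀ i {g} → DegBelow g m → DegBelow (C c ℤX.^ i ⊗ g) m
            below-C^ i {g} b = mk-below λ l m≤l → ≡.trans (coeff-C^⊗ c i g l)
              (≡.trans (cong ((c ℤ.^ i) ℤ.*_) (vanish b l m≤l)) (ℤ.*-zeroʳ (c ℤ.^ i)))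
            d[ζ]≈0 : eval ζ d ≈ 0#
            d[ζ]≈0 = begin
              eval ζ d
                ≈⟨ trans (eval-⊕ ζ _ _) (+-cong (trans (eval-C^⊗ j r) (*-congˡ (reduce k c^kf≋)))
                     (trans (eval-C^⊗ k (C (+ p) ⊗ s))
                         (*-congˡ (trans (eval-C⊗ ζ (+ p) s) (*-congˡ (reduce j e)))))) ⟩
              ι c ^ j * (ι c ^ k * eval ζ (expand a f)) + ι c ^ k * (ι (+ p) * (ι c ^ j * eval ζ h))
                ≈⟨ solve 5 (λ x y F z H → x :* (y :* F) :+ y :* (z :* (x :* H)) := x :* y :* (F :+ z :* H)) refl
                     (ι c ^ j) (ι c ^ k) (eval ζ (expand a f)) (ι (+ p)) (eval ζ h) ⟩
              ι c ^ j * ι c ^ k * (eval ζ (expand a f) + ι (+ p) * eval ζ h)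
                ≈⟨ *-congˡ (trans (+-congʳ f[ζ^a]≈) f[ζ^p]+ph[ζ]≈0) ⟩
              ι c ^ j * ι c ^ k * 0#
                ≈⟨ zeroʳ _ ⟩
              0# ∎
            d≋[] : d ≋ []
            d≋[] = minimal d (below-⊕ (below-C^ j r-below) (below-C^ k (below-C⊗ (+ p) s-below))) d[ζ]≈0
            -- Read off coefficientwise from d = 0: cʲ rᵢ = -(cᵏ sᵢ) p.
            p∣ : ∀ i → p ∣ⁿ ℤ.∣ (c ℤ.^ j) ℤ.* coeff r i ∣
            p∣ i = divides ℤ.∣ w ∣ (≡.trans (cong ℤ.∣_∣ equation)
                (≡.trans (ℤ.∣-i∣≡∣i∣ (w ℤ.* + p)) (ℤ.abs-* w (+ p))))
              where
              w y : ℤ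
              w = (c ℤ.^ k) ℤ.* coeff s i
              y = (c ℤ.^ j) ℤ.* coeff r i
              sum≡0 : y ℤ.+ w ℤ.* + p ≡ 0ℤ
              sum≡0 = ≡.trans (cong₂ ℤ._+_ (≡.sym (coeff-C^⊗ c j r i))
                (≡.trans (≡.trans (ℤ.*-assoc (c ℤ.^ k) _ (+ p))
                    (cong ((c ℤ.^ k) ℤ.*_) (≡.trans (ℤ.*-comm _ (+ p)) (≡.sym (coeff-C⊗ (+ p) s i)))))
                  (≡.sym (coeff-C^⊗ c k (C (+ p) ⊗ s) i))))
                (≡.trans (≡.sym (coeff-⊕ (C c ℤX.^ j ⊗ r) _ i)) (at d≋[] i))
              equation : y ≡ ℤ.- (w ℤ.* + p)
              equation = ℤ.i-j≡0⇒i≡j y (ℤ.- (w ℤ.* + p))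
                (≡.trans (cong (λ z → y ℤ.+ z) (ℤ.neg-involutive (w ℤ.* + p))) sum≡0)
            r≋[] : r ≋ []
            r≋[] = mk≋ λ i → prime∣^*⇒≡0 pr c≢0 c<p j (rᵢ<p i) (p∣ i)

      -- Large primes are known to give roots only as exponents of ζ itself, not of its powers.
      -- Hence the quantification over h: by `kernel` h(Xᵖ) vanishes at ζ, and the induction
      -- hypothesis is applied to h(Xᵖ).
      product-root : ∀ ps → All Prime ps → All (threshold ℕ.<_) ps → ∀ h → eval ζ h ≈ 0# → eval (ζ ^ product ps)
          h ≈ 0#
      product-root []       []         []         h h≈0 = trans (eval-congˡ h (*-identityʳ ζ)) h≈0
      product-root (p ∷ ps) (pr ∷ prs) (t<p ∷ ts) h h≈0 = begin
        eval (ζ ^ (p ℕ.* product ps)) h       ≈⟨ eval-congˡ h (^-cong≡ ζ (ℕ.*-comm p (product ps))) ⟩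
        eval (ζ ^ (product ps ℕ.* p)) h       ≈⟨ eval-congˡ h (^-assocʳ ζ (product ps) p) ⟨
        eval ((ζ ^ product ps) ^ p) h         ≈⟨ eval-expand (ζ ^ product ps) p h ⟨
        eval (ζ ^ product ps) (expand p h)
          ≈⟨ product-root ps prs ts (expand p h)
               (trans (eval-expand ζ p h) (kernel (large-prime-root pr t<p) h h≈0)) ⟩
        0#                                    ∎

      coprime-root : ∀ {a} → Coprime a n → eval (ζ ^ a) f ≈ 0#
      coprime-root {a} a⊥n = go (coprime⇒∃-largePrimes a threshold a⊥n)
        where
        -- Factorisation needs a nonzero number; 0 is coprime only to 1, and n > 1.
        0<a : 0 ℕ.< a
        0<a = ℕ.n≢0⇒n>0 λ { ≡.refl → ℕ.<⇒≢ 1<n (≡.sym (Coprime.0-coprimeTo-m⇒m≡1 (λ {i} → a⊥n {i}))) }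
        go : (∃ λ k → ∀ {p} → Prime p → p ∣ⁿ a ℕ.+ n ℕ.* k → threshold ℕ.< p) → eval (ζ ^ a) f ≈ 0#
        go (k , large) = trans (eval-congˡ f (sym (trans (^-cong≡ ζ (≡.sym isFactorisation)) (ζ^[a+nk] a k))))
          (product-root factors factorsPrime
            (All.tabulate λ {p} p∈ → large (All.lookup factorsPrime p∈)
                (subst (p ∣ⁿ_) (≡.sym isFactorisation) (∈⇒∣product p∈)))
            f f[ζ]≈0)
          where
          open PrimeFactorisation (factorise (a ℕ.+ n ℕ.* k) {{ℕ.>-nonZero (ℕ.<-≤-trans 0<a (ℕ.m≤m+n a _))}})

      -- For g = gcd(a, n) > 1 and d = n / g, the exponent a d is a multiple of n, so ζᵃ is a root
      -- of `P d`, and d is a proper divisor of n.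
      noncoprime-root : ∀ {a} → ¬ Coprime a n → eval (ζ ^ a) (Πproper n) ≈ 0#
      noncoprime-root {a} ¬a⊥n = go (gcd[m,n]∣m a n) (gcd[m,n]∣n a n)
        where
        g : ℕ
        g = gcd a n
        go : g ∣ⁿ a → g ∣ⁿ n → eval (ζ ^ a) (Πproper n) ≈ 0#
        go (divides b a≡bg) (divides d n≡dg) = eval-∣ (ζ ^ a) (P∣Πproper (Φ-exact 0<d) d∣n d<n) (begin
            eval (ζ ^ a) (P d)      ≈⟨ eval-P (ζ ^ a) d ⟩
            (ζ ^ a) ^ d - 1#        ≈⟨ x≈y⇒x∙y⁻¹≈ε (begin
              (ζ ^ a) ^ d           ≈⟨ ^-assocʳ ζ a d ⟩
              ζ ^ (a ℕ.* d)         ≈⟨ ^-cong≡ ζ ad≡nb ⟩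
              ζ ^ (0 ℕ.+ n ℕ.* b)   ≈⟨ ζ^[a+nk] 0 b ⟩
              1#                    ∎) ⟩
            0#                      ∎)
          where
          d∣n : d ∣ⁿ n
          d∣n = divides g (≡.trans n≡dg (ℕ.*-comm d g))
          0<d : 0 ℕ.< d
          0<d = divisor>0 d∣n
          g≢0 : g ≢ 0
          g≢0 g≡0 = ℕ.>⇒≢ 0<n (gcd[m,n]≡0⇒n≡0 a g≡0)
          1<g : 1 ℕ.< g
          1<g = ℕ.≤∧≢⇒< (ℕ.n≢0⇒n>0 g≢0) (λ 1≡g → ¬a⊥n (gcd≡1⇒coprime (≡.sym 1≡g)))
          d<n : d ℕ.< n
          d<n = subst (d ℕ.<_) (≡.sym n≡dg) (ℕ.m<m*n d g {{ℕ.>-nonZero 0<d}} 1<g)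
          ad≡nb : a ℕ.* d ≡ n ℕ.* b
          ad≡nb = ≡.trans (cong (ℕ._* d) a≡bg) (≡.trans (ℕ.*-assoc b g d) (≡.trans (ℕ.*-comm b (g ℕ.* d))
            (cong (ℕ._* b) (≡.trans (ℕ.*-comm g d) (≡.sym n≡dg)))))

      -- f times the proper factors of Xⁿ - 1 vanishes at all n powers of ζ.
      degree≥ : ∀ {D} → Monic (Φ° n) D → D ℕ.≤ m
      degree≥ {D} mΦ = ℕ.≮⇒≥ λ m<D → go m<D (Π-monic n (λ i i<n → Φ-factor-elim (λ f → ∃ λ d → Monic f d)
          (λ i∣n → _ , Exact.monic (Φ-exact (divisor>0 i∣n))) (0 , 1-monic)))
        where
        go : m ℕ.< D → ¬ ∃ λ E → Monic (Πproper n) E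
        go m<D (E , mΠ) = c*1≢0 (≡.trans (≡.sym (top W-lead)) (at W≋[] (m ℕ.+ E)))
          where
          W : Poly
          W = f ⊗ Πproper n
          W-lead : Lead W (m ℕ.+ E) (c ℤ.* 1ℤ)
          W-lead = lead-⊗ lead-f mΠ
          c*1≢0 : c ℤ.* 1ℤ ≢ 0ℤ
          c*1≢0 e = c≢0 (≡.trans (≡.sym (ℤ.*-identityʳ c)) e)
          D+E≡n : D ℕ.+ E ≡ n
          D+E≡n = proj₁ (lead-unique 1≢0 1≢0 (lead-resp (≋-sym (Exact.exact (Φ-exact 0<n))) (lead-⊗ mΦ mΠ))
              (P-monic 0<n))
          W-below : DegBelow W n
          W-below = below-mono (subst (suc (m ℕ.+ E) ℕ.≤_) D+E≡n (ℕ.+-monoˡ-≤ E m<D)) (above W-lead)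
          W-root : ∀ i → i ℕ.< n → eval (ζ ^ i) W ≈ 0#
          W-root i _ = trans (eval-⊗ (ζ ^ i) f (Πproper n)) (vanishes (coprime? i n))
            where
            vanishes : Dec (Coprime i n) → eval (ζ ^ i) f * eval (ζ ^ i) (Πproper n) ≈ 0#
            vanishes (yes i⊥n) = trans (*-congʳ (coprime-root (λ {d} → i⊥n {d}))) (zeroˡ _)
            vanishes (no ¬i⊥n) = trans (*-congˡ (noncoprime-root ¬i⊥n)) (zeroʳ _)
          W≋[] : W ≋ []
          W≋[] = vanishing⇒≋[] (ζ ^_) W-below ζ^-distinct W-root

    -- If the coefficient of h at m is nonzero, the induction hypothesis for m is exactly the
    -- minimality that `Minimal` asks of h, and the degree bound contradicts m < D. Only the
    -- decidability of equality in ℤ is used for the case distinction.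
    Φ-minimal : ∀ {D} → Monic (Φ° n) D → ∀ h → DegBelow h D → eval ζ h ≈ 0# → h ≋ []
    Φ-minimal {D} mΦ = go D ℕ.≤-refl
      where
      go : ∀ m → m ℕ.≤ D → ∀ h → DegBelow h m → eval ζ h ≈ 0# → h ≋ []
      go zero    m≤D h b h≈0 = below-0 b
      go (suc m) m<D h b h≈0 with coeff h m ℤ.≟ 0ℤ
      ... | yes hₘ≡0 = go m (ℕ.<⇒≤ m<D) h (mk-below λ i m≤i →
              [ vanish b i , (λ { ≡.refl → hₘ≡0 }) ]′ (ℕ.m≤n⇒m<n∨m≡n m≤i)) h≈0
      ... | no hₘ≢0 = contradiction m<D (ℕ.≤⇒≯
              (Minimal.degree≥ hₘ≢0 (lead ≡.refl b) h≈0 (go m (ℕ.<⇒≤ m<D)) mΦ))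

-- The complex numbers as a domain of characteristic 0

module ComplexNumbers where
  open ≡ using (refl; sym; trans)
  open import Data.Rational.Base using (∣_∣)

  open ℚ-Solver using (solve; con; _:=_; _:+_; _:*_; _:-_; :-_)

  -- `x ≈ℝ y` unfolds to `Null` of the difference sequence, so facts about real equality become
  -- facts about null sequences.
  Null : (ℕ → ℚ) → Set
  Null z = ∀ ε → 0ℚ ℚ.< ε → ∃ λ N → ∀ n → N ℕ.≤ n → ∣ z n ∣ ℚ.< ε

  *-pos : ∀ {p q} → 0ℚ ℚ.< p → 0ℚ ℚ.< q → 0ℚ ℚ.< p ℚ.* q
  *-pos {p} {q} 0<p 0<q = subst (ℚ._< p ℚ.* q) (ℚ.*-zeroʳ p) (ℚ.*-monoʳ-<-pos p {{ℚ.positive 0<p}} 0<q)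

  half-pos : ∀ {ε} → 0ℚ ℚ.< ε → 0ℚ ℚ.< ε ℚ.* ½
  half-pos 0<ε = *-pos 0<ε (ℚ.positive⁻¹ ½)

  halves : ∀ ε → ε ℚ.* ½ ℚ.+ ε ℚ.* ½ ≡ ε
  halves ε = trans (sym (ℚ.*-distribˡ-+ ε ½ ½)) (ℚ.*-identityʳ ε)

  null-≗ : ∀ {z w} → (∀ n → z n ≡ w n) → Null z → Null w
  null-≗ z≗w nz ε 0<ε with nz ε 0<ε
  ... | N , h = N , λ n N≤n → subst (λ q → ∣ q ∣ ℚ.< ε) (z≗w n) (h n N≤n)

  null-0 : Null (λ _ → 0ℚ)
  null-0 ε 0<ε = 0 , λ _ _ → 0<ε

  null-+ : ∀ {z w} → Null z → Null w → Null (λ n → z n ℚ.+ w n)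
  null-+ {z} {w} nz nw ε 0<ε with nz (ε ℚ.* ½) (half-pos 0<ε) | nw (ε ℚ.* ½) (half-pos 0<ε)
  ... | M , hz | N , hw = M ℕ.⊔ N , λ n ≤n → begin-strict
    ∣ z n ℚ.+ w n ∣          ≤⟨ ℚ.∣p+q∣≤∣p∣+∣q∣ (z n) (w n) ⟩
    ∣ z n ∣ ℚ.+ ∣ w n ∣      <⟨ ℚ.+-mono-< (hz n (ℕ.m⊔n≤o⇒m≤o M N ≤n)) (hw n (ℕ.m⊔n≤o⇒n≤o M N ≤n)) ⟩
    ε ℚ.* ½ ℚ.+ ε ℚ.* ½      ≡⟨ halves ε ⟩
    ε                        ∎
    where open ℚ.≤-Reasoning

  null-neg : ∀ {z} → Null z → Null (λ n → ℚ.- z n)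
  null-neg {z} nz ε 0<ε with nz ε 0<ε
  ... | N , h = N , λ n N≤n → subst (ℚ._< ε) (sym (ℚ.∣-p∣≡∣p∣ (z n))) (h n N≤n)

  *-cancel-∣∣ : ∀ {p q δ η} → 0ℚ ℚ.< δ → 0ℚ ℚ.< η → ∣ p ℚ.* q ∣ ℚ.< δ ℚ.* η → η ℚ.≤ ∣ q ∣ → ∣ p ∣ ℚ.< δ
  *-cancel-∣∣ {p} {q} {δ} {η} 0<δ 0<η pq< η≤q = ℚ.≰⇒> λ δ≤p → ℚ.<-irrefl refl (begin-strict
    δ ℚ.* η            ≤⟨ ℚ.*-monoˡ-≤-nonNeg δ {{ℚ.nonNegative (ℚ.<⇒≤ 0<δ)}} η≤q ⟩
    δ ℚ.* ∣ q ∣        ≤⟨ ℚ.*-monoʳ-≤-nonNeg ∣ q ∣ {{ℚ.∣-∣-nonNeg q}} δ≤p ⟩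
    ∣ p ∣ ℚ.* ∣ q ∣    ≡⟨ ℚ.∣p*q∣≡∣p∣*∣q∣ p q ⟨
    ∣ p ℚ.* q ∣        <⟨ pq< ⟩
    δ ℚ.* η            ∎)
    where open ℚ.≤-Reasoning

  -- From an index M on, a Cauchy sequence x is bounded by B = 1 + |x M|; the null sequence is then
  -- taken below ε / B.
  null-cauchy-* : ∀ {x z} → Cauchy x → Null z → Null (λ n → x n ℚ.* z n)
  null-cauchy-* {x} {z} cx nz ε 0<ε = conclude (cx 1ℚ (ℚ.positive⁻¹ 1ℚ))
    where
    conclude : (∃ λ N → ∀ m n → N ℕ.≤ m → N ℕ.≤ n → ∣ x m ℚ.- x n ∣ ℚ.< 1ℚ) →
               ∃ λ N → ∀ n → N ℕ.≤ n → ∣ x n ℚ.* z n ∣ ℚ.< ε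
    conclude (M , hx) = combine (nz δ 0<δ)
      where
      B : ℚ
      B = 1ℚ ℚ.+ ∣ x M ∣
      0<B : 0ℚ ℚ.< B
      0<B = ℚ.+-mono-<-≤ (ℚ.positive⁻¹ 1ℚ) (ℚ.0≤∣p∣ (x M))
      instance
        B-pos : ℚ.Positive B
        B-pos = ℚ.positive 0<B
        B-nonZero : ℚ.NonZero B
        B-nonZero = ℚ.pos⇒nonZero B
      δ : ℚ
      δ = ℚ.1/ B ℚ.* ε
      0<δ : 0ℚ ℚ.< δ
      0<δ = *-pos (ℚ.positive⁻¹ (ℚ.1/ B) {{ℚ.1/pos⇒pos B}}) 0<ε
      Bδ≡ε : B ℚ.* δ ≡ ε
      Bδ≡ε = trans (sym (ℚ.*-assoc B (ℚ.1/ B) ε)) (trans (cong (ℚ._* ε) (ℚ.*-inverseʳ B)) (ℚ.*-identityˡ ε))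
      x≤B : ∀ n → M ℕ.≤ n → ∣ x n ∣ ℚ.≤ B
      x≤B n M≤n = begin
        ∣ x n ∣                          ≡⟨ cong ∣_∣ (solve 2 (λ a b → a := (a :- b) :+ b) refl (x n) (x M)) ⟩
        ∣ (x n ℚ.- x M) ℚ.+ x M ∣        ≤⟨ ℚ.∣p+q∣≤∣p∣+∣q∣ (x n ℚ.- x M) (x M) ⟩
        ∣ x n ℚ.- x M ∣ ℚ.+ ∣ x M ∣      ≤⟨ ℚ.+-monoˡ-≤ ∣ x M ∣ (ℚ.<⇒≤ (hx n M M≤n ℕ.≤-refl)) ⟩
        B                                ∎
        where open ℚ.≤-Reasoning
      combine : (∃ λ N → ∀ n → N ℕ.≤ n → ∣ z n ∣ ℚ.< δ) → ∃ λ N → ∀ n → N ℕ.≤ n → ∣ x n ℚ.* z n ∣ ℚ.< ε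
      combine (N , hz) = M ℕ.⊔ N , λ n ≤n → begin-strict
        ∣ x n ℚ.* z n ∣        ≡⟨ ℚ.∣p*q∣≡∣p∣*∣q∣ (x n) (z n) ⟩
        ∣ x n ∣ ℚ.* ∣ z n ∣    ≤⟨ ℚ.*-monoʳ-≤-nonNeg ∣ z n ∣ {{ℚ.∣-∣-nonNeg (z n)}} (x≤B n (ℕ.m⊔n≤o⇒m≤o M N ≤n)) ⟩
        B ℚ.* ∣ z n ∣          <⟨ ℚ.*-monoʳ-<-pos B (hz n (ℕ.m⊔n≤o⇒n≤o M N ≤n)) ⟩
        B ℚ.* δ                ≡⟨ Bδ≡ε ⟩
        ε                      ∎
        where open ℚ.≤-Reasoning

  -- One rational comparison replaces the undecidable test for zero. Let N be a Cauchy index of q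
  -- for ε/4. If |q N| < ε/2, then |q n| < ε from N on. Otherwise |q n| ≥ ε/4 from N on, and then p
  -- would be null because p q is.
  null-zero-product : ∀ {p q} → Cauchy q → ¬ Null p → Null (λ n → p n ℚ.* q n) → Null q
  null-zero-product {p} {q} cq ¬np npq ε 0<ε = conclude (cq η′ 0<η′)
    where
    η η′ : ℚ
    η  = ε ℚ.* ½
    η′ = η ℚ.* ½
    0<η : 0ℚ ℚ.< η
    0<η = half-pos 0<ε
    0<η′ : 0ℚ ℚ.< η′
    0<η′ = half-pos 0<η
    conclude : (∃ λ N → ∀ m n → N ℕ.≤ m → N ℕ.≤ n → ∣ q m ℚ.- q n ∣ ℚ.< η′) →
               ∃ λ N → ∀ n → N ℕ.≤ n → ∣ q n ∣ ℚ.< ε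
    conclude (N , hq) = decide (∣ q N ∣ ℚ.<? η)
      where
      near : ∀ m n → ∣ q m ∣ ℚ.≤ ∣ q m ℚ.- q n ∣ ℚ.+ ∣ q n ∣
      near m n = begin
        ∣ q m ∣                          ≡⟨ cong ∣_∣ (solve 2 (λ a b → a := (a :- b) :+ b) refl (q m) (q n)) ⟩
        ∣ (q m ℚ.- q n) ℚ.+ q n ∣        ≤⟨ ℚ.∣p+q∣≤∣p∣+∣q∣ (q m ℚ.- q n) (q n) ⟩
        ∣ q m ℚ.- q n ∣ ℚ.+ ∣ q n ∣      ∎
        where open ℚ.≤-Reasoning
      η′<η : η′ ℚ.< η
      η′<η = begin-strict
        η′              ≡⟨ ℚ.+-identityʳ η′ ⟨
        η′ ℚ.+ 0ℚ       <⟨ ℚ.+-monoʳ-< η′ 0<η′ ⟩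
        η′ ℚ.+ η′       ≡⟨ halves η ⟩
        η               ∎
        where open ℚ.≤-Reasoning
      decide : Dec (∣ q N ∣ ℚ.< η) → ∃ λ N → ∀ n → N ℕ.≤ n → ∣ q n ∣ ℚ.< ε
      decide (yes qN<η) = N , λ n N≤n → begin-strict
        ∣ q n ∣                          ≤⟨ near n N ⟩
        ∣ q n ℚ.- q N ∣ ℚ.+ ∣ q N ∣      <⟨ ℚ.+-mono-< (ℚ.<-trans (hq n N N≤n ℕ.≤-refl) η′<η) qN<η ⟩
        η ℚ.+ η                          ≡⟨ halves ε ⟩
        ε                                ∎
        where open ℚ.≤-Reasoning
      decide (no qN≮η) = contradiction np ¬np
        where
        η′≤q : ∀ n → N ℕ.≤ n → η′ ℚ.≤ ∣ q n ∣
        η′≤q n N≤n = ℚ.≮⇒≥ λ qn<η′ → ℚ.<-irrefl refl (begin-strict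
          η                              ≤⟨ ℚ.≮⇒≥ qN≮η ⟩
          ∣ q N ∣                        ≤⟨ near N n ⟩
          ∣ q N ℚ.- q n ∣ ℚ.+ ∣ q n ∣    <⟨ ℚ.+-mono-< (hq N n ℕ.≤-refl N≤n) qn<η′ ⟩
          η′ ℚ.+ η′                      ≡⟨ halves η ⟩
          η                              ∎)
          where open ℚ.≤-Reasoning
        np : Null p
        np δ 0<δ = shrink (npq (δ ℚ.* η′) (*-pos 0<δ 0<η′))
          where
          shrink : (∃ λ M → ∀ n → M ℕ.≤ n → ∣ p n ℚ.* q n ∣ ℚ.< δ ℚ.* η′) → ∃ λ M → ∀ n → M ℕ.≤ n → ∣ p n ∣ ℚ.< δ
          shrink (M , hpq) = M ℕ.⊔ N , λ n ≤n → *-cancel-∣∣ {p n} {q n} 0<δ 0<η′ (hpq n (ℕ.m⊔n≤o⇒m≤o M N ≤n))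
            (η′≤q n (ℕ.m⊔n≤o⇒n≤o M N ≤n))

  square≡∣∣² : ∀ p → p ℚ.* p ≡ ∣ p ∣ ℚ.* ∣ p ∣
  square≡∣∣² p with ℚ.∣p∣≡p∨∣p∣≡-p p
  ... | inj₁ e = sym (cong₂ ℚ._*_ e e)
  ... | inj₂ e = trans (solve 1 (λ p → p :* p := (:- p) :* (:- p)) refl p) (sym (cong₂ ℚ._*_ e e))

  square-nonNeg : ∀ p → 0ℚ ℚ.≤ p ℚ.* p
  square-nonNeg p = subst (0ℚ ℚ.≤_) (trans (ℚ.∣p*q∣≡∣p∣*∣q∣ p p) (sym (square≡∣∣² p))) (ℚ.0≤∣p∣ (p ℚ.* p))

  -- If |z n| were at least ε, the sum of squares would be at least ε².
  null-square⁻ : ∀ {z w : ℕ → ℚ} → Null (λ n → z n ℚ.* z n ℚ.+ w n ℚ.* w n) → Null z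
  null-square⁻ {z} {w} nzw ε 0<ε = conclude (nzw (ε ℚ.* ε) (*-pos 0<ε 0<ε))
    where
    conclude : (∃ λ N → ∀ n → N ℕ.≤ n → ∣ z n ℚ.* z n ℚ.+ w n ℚ.* w n ∣ ℚ.< ε ℚ.* ε) →
               ∃ λ N → ∀ n → N ℕ.≤ n → ∣ z n ∣ ℚ.< ε
    conclude (N , h) = N , λ n N≤n → ℚ.≰⇒> λ ε≤z → ℚ.<-irrefl refl (begin-strict
      ε ℚ.* ε                                  ≤⟨ ℚ.*-monoˡ-≤-nonNeg ε {{ℚ.nonNegative (ℚ.<⇒≤ 0<ε)}} ε≤z ⟩
      ε ℚ.* ∣ z n ∣                            ≤⟨ ℚ.*-monoʳ-≤-nonNeg ∣ z n ∣ {{ℚ.∣-∣-nonNeg (z n)}} ε≤z ⟩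
      ∣ z n ∣ ℚ.* ∣ z n ∣                      ≡⟨ square≡∣∣² (z n) ⟨
      z n ℚ.* z n                              ≡⟨ ℚ.+-identityʳ _ ⟨
      z n ℚ.* z n ℚ.+ 0ℚ                       ≤⟨ ℚ.+-monoʳ-≤ (z n ℚ.* z n) (square-nonNeg (w n)) ⟩
      z n ℚ.* z n ℚ.+ w n ℚ.* w n
        ≡⟨ ℚ.0≤p⇒∣p∣≡p (ℚ.+-mono-≤ {0ℚ} {z n ℚ.* z n} {0ℚ} {w n ℚ.* w n} (square-nonNeg (z n))
            (square-nonNeg (w n))) ⟨
      ∣ z n ℚ.* z n ℚ.+ w n ℚ.* w n ∣          <⟨ h n N≤n ⟩
      ε ℚ.* ε                                  ∎)
      where open ℚ.≤-Reasoning

  ≈ℝ-sym : ∀ x y → x ≈ℝ y → y ≈ℝ x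
  ≈ℝ-sym x y h = null-≗ (λ n → solve 2 (λ x y → :- (x :- y) := y :- x) refl (seq x n) (seq y n))
    (null-neg {λ n → seq x n ℚ.- seq y n} h)

  ≈ℝ-trans : ∀ x y z → x ≈ℝ y → y ≈ℝ z → x ≈ℝ z
  ≈ℝ-trans x y z h k =
    null-≗ (λ n → solve 3 (λ x y z → (x :- y) :+ (y :- z) := x :- z) refl (seq x n) (seq y n) (seq z n))
      (null-+ {λ n → seq x n ℚ.- seq y n} {λ n → seq y n ℚ.- seq z n} h k)

  +ℝ-cong : ∀ x x′ y y′ → x ≈ℝ x′ → y ≈ℝ y′ → x +ℝ y ≈ℝ x′ +ℝ y′
  +ℝ-cong x x′ y y′ h k = null-≗
    (λ n → solve 4 (λ x x′ y y′ → (x :- x′) :+ (y :- y′) := (x :+ y) :- (x′ :+ y′)) refl (seq x n) (seq x′ n)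
        (seq y n) (seq y′ n))
    (null-+ {λ n → seq x n ℚ.- seq x′ n} {λ n → seq y n ℚ.- seq y′ n} h k)

  -ℝ-cong : ∀ x y → x ≈ℝ y → -ℝ x ≈ℝ -ℝ y
  -ℝ-cong x y h = null-≗ (λ n → solve 2 (λ x y → :- (x :- y) := (:- x) :- (:- y)) refl (seq x n) (seq y n))
    (null-neg {λ n → seq x n ℚ.- seq y n} h)

  *ℝ-cong : ∀ x x′ y y′ → x ≈ℝ x′ → y ≈ℝ y′ → x *ℝ y ≈ℝ x′ *ℝ y′
  *ℝ-cong x x′ y y′ h k = null-≗
    (λ n → solve 4 (λ x x′ y y′ → x :* (y :- y′) :+ y′ :* (x :- x′) := x :* y :- x′ :* y′) refl (seq x n)
        (seq x′ n) (seq y n) (seq y′ n))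
    (null-+ {λ n → seq x n ℚ.* (seq y n ℚ.- seq y′ n)} {λ n → seq y′ n ℚ.* (seq x n ℚ.- seq x′ n)}
      (null-cauchy-* {seq x} (cauchy x) k) (null-cauchy-* {seq y′} (cauchy y′) h))

  ≗⇒null : ∀ {x y : ℕ → ℚ} → (∀ n → x n ≡ y n) → Null (λ n → x n ℚ.- y n)
  ≗⇒null {x} {y} e = null-≗ (λ n → sym (trans (cong (ℚ._- y n) (e n)) (ℚ.+-inverseʳ (y n)))) null-0

  ≈ℝ-refl : ∀ x → x ≈ℝ x
  ≈ℝ-refl x = ≗⇒null {seq x} {seq x} (λ _ → refl)

  module ℂᵣ = RawRing ℂ-rawRing

  -- Apart from equivalence and congruence, the laws hold term by term in ℚ. Only the congruence of
  -- the product needs the sequences to be Cauchy.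
  ℂ-ring : CommutativeRing 0ℓ 0ℓ
  ℂ-ring = record
    { Carrier = ℂ
    ; _≈_     = ℂᵣ._≈_
    ; _+_     = ℂᵣ._+_
    ; _*_     = ℂᵣ._*_
    ; -_      = ℂᵣ.-_
    ; 0#      = ℂᵣ.0#
    ; 1#      = ℂᵣ.1#
    ; isCommutativeRing = record
      { isRing = record
        { +-isAbelianGroup = record
          { isGroup = record
            { isMonoid = record
              { isSemigroup = record
                { isMagma = record
                  { isEquivalence = record
                    { refl  = λ {z} → ≈ℝ-refl (re z) , ≈ℝ-refl (im z)
                    ; sym   = λ {z} {w} (h , k) → ≈ℝ-sym (re z) (re w) h , ≈ℝ-sym (im z) (im w) k
                    ; trans = λ {u} {v} {w} (h , k) (h′ , k′) →
                        ≈ℝ-trans (re u) (re v) (re w) h h′ , ≈ℝ-trans (im u) (im v) (im w) k k′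
                    }
                  ; ∙-cong = λ {z} {z′} {w} {w′} (h , k) (h′ , k′) →
                      +ℝ-cong (re z) (re z′) (re w) (re w′) h h′ , +ℝ-cong (im z) (im z′) (im w) (im w′) k k′
                  }
                ; assoc = λ u v w → ≗⇒null (λ n → ℚ.+-assoc (seq (re u) n) _ _) , ≗⇒null
                    (λ n → ℚ.+-assoc (seq (im u) n) _ _)
                }
              ; identity = (λ z → ≗⇒null (λ n → ℚ.+-identityˡ (seq (re z) n)) , ≗⇒null
                  (λ n → ℚ.+-identityˡ (seq (im z) n)))
                         , (λ z → ≗⇒null (λ n → ℚ.+-identityʳ (seq (re z) n)) , ≗⇒null
                             (λ n → ℚ.+-identityʳ (seq (im z) n)))
              }
            ; inverse = (λ z → ≗⇒null (λ n → ℚ.+-inverseˡ (seq (re z) n)) , ≗⇒null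
                (λ n → ℚ.+-inverseˡ (seq (im z) n)))
                      , (λ z → ≗⇒null (λ n → ℚ.+-inverseʳ (seq (re z) n)) , ≗⇒null
                          (λ n → ℚ.+-inverseʳ (seq (im z) n)))
            ; ⁻¹-cong = λ {z} {w} (h , k) → -ℝ-cong (re z) (re w) h , -ℝ-cong (im z) (im w) k
            }
          ; comm = λ z w → ≗⇒null (λ n → ℚ.+-comm (seq (re z) n) _) , ≗⇒null (λ n → ℚ.+-comm (seq (im z) n) _)
          }
        ; *-cong = λ {z} {z′} {w} {w′} → *-cong′ {z} {z′} {w} {w′}
        ; *-assoc = λ u v w →
              ≗⇒null (λ n → solve 6 (λ a b c d e f → (a :* c :+ :- (b :* d)) :* e :+ :- ((a :* d :+ b :* c) :* f)
                                                  := a :* (c :* e :+ :- (d :* f)) :+ :-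
                                                      (b :* (c :* f :+ d :* e))) refl
                       (seq (re u) n) (seq (im u) n) (seq (re v) n) (seq (im v) n) (seq (re w) n) (seq (im w) n))
            , ≗⇒null (λ n → solve 6 (λ a b c d e f → (a :* c :+ :- (b :* d)) :* f :+ (a :* d :+ b :* c) :* e
                                                  := a :* (c :* f :+ d :* e) :+ b :* (c :* e :+ :- (d :* f))) refl
                       (seq (re u) n) (seq (im u) n) (seq (re v) n) (seq (im v) n) (seq (re w) n) (seq (im w) n))
        ; *-identity =
              (λ z → ≗⇒null (λ n → solve 2 (λ a b → con 1ℚ :* a :+ :- (con 0ℚ :* b) := a) refl (seq (re z) n)
                  (seq (im z) n))
                   , ≗⇒null (λ n → solve 2 (λ a b → con 1ℚ :* b :+ con 0ℚ :* a := b) refl (seq (re z) n)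
                       (seq (im z) n)))
            , (λ z → ≗⇒null (λ n → solve 2 (λ a b → a :* con 1ℚ :+ :- (b :* con 0ℚ) := a) refl (seq (re z) n)
                (seq (im z) n))
                   , ≗⇒null (λ n → solve 2 (λ a b → a :* con 0ℚ :+ b :* con 1ℚ := b) refl (seq (re z) n)
                       (seq (im z) n)))
        ; distrib =
              (λ u v w →
                  ≗⇒null (λ n → solve 6 (λ a b c d e f → a :* (c :+ e) :+ :- (b :* (d :+ f))
                                                      := (a :* c :+ :- (b :* d)) :+ (a :* e :+ :- (b :* f))) refl
                           (seq (re u) n) (seq (im u) n) (seq (re v) n) (seq (im v) n) (seq (re w) n) (seq (im w) n))
                , ≗⇒null (λ n → solve 6 (λ a b c d e f → a :* (d :+ f) :+ b :* (c :+ e)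
                                                      := (a :* d :+ b :* c) :+ (a :* f :+ b :* e)) refl
                           (seq (re u) n) (seq (im u) n) (seq (re v) n) (seq (im v) n) (seq (re w) n) (seq (im w) n)))
            , (λ u v w →
                  ≗⇒null (λ n → solve 6 (λ a b c d e f → (c :+ e) :* a :+ :- ((d :+ f) :* b)
                                                      := (c :* a :+ :- (d :* b)) :+ (e :* a :+ :- (f :* b))) refl
                           (seq (re u) n) (seq (im u) n) (seq (re v) n) (seq (im v) n) (seq (re w) n) (seq (im w) n))
                , ≗⇒null (λ n → solve 6 (λ a b c d e f → (c :+ e) :* b :+ (d :+ f) :* a
                                                      := (c :* b :+ d :* a) :+ (e :* b :+ f :* a)) refl
                           (seq (re u) n) (seq (im u) n) (seq (re v) n) (seq (im v) n) (seq (re w) n) (seq (im w) n)))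
        }
      ; *-comm = λ z w →
            ≗⇒null (λ n → solve 4 (λ a b c d → a :* c :+ :- (b :* d) := c :* a :+ :- (d :* b)) refl
                     (seq (re z) n) (seq (im z) n) (seq (re w) n) (seq (im w) n))
          , ≗⇒null (λ n → solve 4 (λ a b c d → a :* d :+ b :* c := c :* b :+ d :* a) refl
                     (seq (re z) n) (seq (im z) n) (seq (re w) n) (seq (im w) n))
      }
    }
    where
    *-cong′ : ∀ {z z′ w w′} → z ℂᵣ.≈ z′ → w ℂᵣ.≈ w′ → z ℂᵣ.* w ℂᵣ.≈ z′ ℂᵣ.* w′
    *-cong′ {z} {z′} {w} {w′} (h , k) (h′ , k′) =
        +ℝ-cong (re z *ℝ re w) (re z′ *ℝ re w′) (-ℝ (im z *ℝ im w)) (-ℝ (im z′ *ℝ im w′))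
          (*ℝ-cong (re z) (re z′) (re w) (re w′) h h′)
          (-ℝ-cong (im z *ℝ im w) (im z′ *ℝ im w′) (*ℝ-cong (im z) (im z′) (im w) (im w′) k k′))
      , +ℝ-cong (re z *ℝ im w) (re z′ *ℝ im w′) (im z *ℝ re w) (im z′ *ℝ re w′)
          (*ℝ-cong (re z) (re z′) (im w) (im w′) h k′) (*ℝ-cong (im z) (im z′) (re w) (re w′) k h′)

  norm² : ℂ → ℝ
  norm² z = (re z *ℝ re z) +ℝ (im z *ℝ im z)

  null-norm²⁻ : ∀ z → Null (seq (norm² z)) → z ℂᵣ.≈ ℂᵣ.0#
  null-norm²⁻ z h = null-≗ (λ n → sym (minus-0 (seq (re z) n))) (null-square⁻ {seq (re z)} {seq (im z)} h)
                  , null-≗ (λ n → sym (minus-0 (seq (im z) n)))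
                      (null-square⁻ {seq (im z)} {seq (re z)}
                          (null-≗ (λ n → ℚ.+-comm (seq (re z) n ℚ.* seq (re z) n) _) h))
    where
    minus-0 : ∀ q → q ℚ.- 0ℚ ≡ q
    minus-0 = solve 1 (λ q → q :- con 0ℚ := q) refl

  null-norm² : ∀ z → z ℂᵣ.≈ ℂᵣ.0# → Null (seq (norm² z))
  null-norm² z (h , k) = null-+ {λ n → seq (re z) n ℚ.* seq (re z) n} (square (re z) h) (square (im z) k)
    where
    square : ∀ x → x ≈ℝ fromℚ 0ℚ → Null (λ n → seq x n ℚ.* seq x n)
    square x h = null-cauchy-* {seq x} {seq x} (cauchy x)
        (null-≗ (λ n → solve 1 (λ q → q :- con 0ℚ := q) refl (seq x n)) h)

  -- The squared norm is multiplicative and detects zero, which reduces the claim to real sequences.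
  ℂ-zero-product : ∀ {z w} → ¬ z ℂᵣ.≈ ℂᵣ.0# → z ℂᵣ.* w ℂᵣ.≈ ℂᵣ.0# → w ℂᵣ.≈ ℂᵣ.0#
  ℂ-zero-product {z} {w} z≉0 zw≈0 = null-norm²⁻ w
      (null-zero-product {seq (norm² z)} {seq (norm² w)} (cauchy (norm² w))
    (λ h → z≉0 (null-norm²⁻ z h))
    (null-≗ (λ n → solve 4 (λ a b c d → (a :* c :+ :- (b :* d)) :* (a :* c :+ :- (b :* d)) :+ (a :* d :+ b :* c)
        :* (a :* d :+ b :* c)
                                   := (a :* a :+ b :* b) :* (c :* c :+ d :* d)) refl
               (seq (re z) n) (seq (im z) n) (seq (re w) n) (seq (im w) n))
      (null-norm² (z ℂᵣ.* w) zw≈0)))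

  open IntegerScalars ℂ-ring using (ι)

  re-ι≥1 : ∀ n k → 1ℚ ℚ.≤ seq (re (ι (+ suc n))) k
  re-ι≥1 zero    k = ℚ.≤-refl
  re-ι≥1 (suc n) k = ℚ.≤-trans (re-ι≥1 n k) (begin
    seq (re (ι (+ suc n))) k             ≡⟨ ℚ.+-identityʳ _ ⟨
    seq (re (ι (+ suc n))) k ℚ.+ 0ℚ      ≤⟨ ℚ.+-monoʳ-≤ (seq (re (ι (+ suc n))) k) (ℚ.<⇒≤ (ℚ.positive⁻¹ 1ℚ)) ⟩
    seq (re (ι (+ suc n))) k ℚ.+ 1ℚ      ∎)
    where open ℚ.≤-Reasoning

  ℂ-char-0 : ∀ n → ¬ ι (+ suc n) ℂᵣ.≈ ℂᵣ.0#
  ℂ-char-0 n (h , _) = conclude (h 1ℚ (ℚ.positive⁻¹ 1ℚ))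
    where
    conclude : ¬ ∃ λ N → ∀ k → N ℕ.≤ k → ∣ seq (re (ι (+ suc n))) k ℚ.- 0ℚ ∣ ℚ.< 1ℚ
    conclude (N , small) = ℚ.<-irrefl refl (begin-strict
      1ℚ                ≤⟨ re-ι≥1 n N ⟩
      q                 ≡⟨ ℚ.0≤p⇒∣p∣≡p (ℚ.≤-trans (ℚ.<⇒≤ (ℚ.positive⁻¹ 1ℚ)) (re-ι≥1 n N)) ⟨
      ∣ q ∣             ≡⟨ cong ∣_∣ (solve 1 (λ q → q := q :- con 0ℚ) refl q) ⟩
      ∣ q ℚ.- 0ℚ ∣      <⟨ small N ℕ.≤-refl ⟩
      1ℚ                ∎)
      where
      open ℚ.≤-Reasoning
      q : ℚ
      q = seq (re (ι (+ suc n))) N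

  ℂ-domain : IsDomain₀ ℂ-ring
  ℂ-domain = record { zero-product = λ {z} {w} → ℂ-zero-product {z} {w} ; char-0 = ℂ-char-0 }

open ComplexNumbers

-- Sets of exponents as polynomials, and folding

indicator : ∀ {n} → Subset n → Poly
indicator T = map (if_then 1ℤ else 0ℤ) (Vec.toList T)

indicator-lookup : ∀ {n} (T : Subset n) x → coeff (indicator T) (toℕ x) ≡ (if lookup T x then 1ℤ else 0ℤ)
indicator-lookup (b ∷ T) Fin.zero    = ≡.refl
indicator-lookup (b ∷ T) (Fin.suc x) = indicator-lookup T x

indicator-below : ∀ {n} (T : Subset n) → DegBelow (indicator T) n
indicator-below []      = below-[] ≋-refl
indicator-below (b ∷ T) = below-∷ (indicator-below T)

indicator-∈ : ∀ {n} {T : Subset n} {x} → x ∈ T → coeff (indicator T) (toℕ x) ≡ 1ℤ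
indicator-∈ {T = T} {x} x∈T = ≡.trans (indicator-lookup T x) (cong (if_then 1ℤ else 0ℤ) (Vec.[]=⇒lookup x∈T))

indicator-∉ : ∀ {n} {T : Subset n} {x} → x ∉ T → coeff (indicator T) (toℕ x) ≡ 0ℤ
indicator-∉ {T = T} {x} x∉T = ≡.trans (indicator-lookup T x) (go (lookup T x) ≡.refl)
  where
  go : ∀ b → lookup T x ≡ b → (if b then 1ℤ else 0ℤ) ≡ 0ℤ
  go true  e = contradiction (Vec.lookup⇒[]= x T e) x∉T
  go false e = ≡.refl

indicator-cases : ∀ {n} (T : Subset n) i →
  coeff (indicator T) i ≡ 0ℤ ⊎ (coeff (indicator T) i ≡ 1ℤ × ∃ λ x → x ∈ T × toℕ x ≡ i)
indicator-cases {n} T i with i ℕ.<? n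
... | no i≮n  = inj₁ (vanish (indicator-below T) i (ℕ.≮⇒≥ i≮n))
... | yes i<n = go (lookup T x) ≡.refl
  where
  x : Fin n
  x = fromℕ< i<n
  x≡i : toℕ x ≡ i
  x≡i = Fin.toℕ-fromℕ< i<n
  coeff≡ : ∀ {b} → lookup T x ≡ b → coeff (indicator T) i ≡ (if b then 1ℤ else 0ℤ)
  coeff≡ e = ≡.trans (cong (coeff (indicator T)) (≡.sym x≡i))
    (≡.trans (indicator-lookup T x) (cong (if_then 1ℤ else 0ℤ) e))
  go : ∀ b → lookup T x ≡ b → coeff (indicator T) i ≡ 0ℤ ⊎ (coeff (indicator T) i ≡ 1ℤ × ∃ λ x → x ∈ T × toℕ x ≡ i)
  go false e = inj₁ (coeff≡ e)
  go true  e = inj₂ (coeff≡ e , x , Vec.lookup⇒[]= x T e , x≡i)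

∈-exponents : ∀ {n f x} → coeff f (toℕ x) ≡ 1ℤ → x ∈ exponents n f
∈-exponents {n} {f} {x} e = Vec.lookup⇒[]= x _
  (≡.trans (Vec.lookup∘tabulate _ x) (dec-true (coeff f (toℕ x) ℤ.≟ 1ℤ) e))

exponents-∈ : ∀ {n f x} → x ∈ exponents n f → coeff f (toℕ x) ≡ 1ℤ
exponents-∈ {n} {f} {x} x∈ with ≡.trans (≡.sym (Vec.lookup∘tabulate _ x)) (Vec.[]=⇒lookup x∈)
... | e with coeff f (toℕ x) ℤ.≟ 1ℤ
...   | yes e′ = e′

coeff-map : ∀ (g : ℤ → ℤ) → g 0ℤ ≡ 0ℤ → ∀ f i → coeff (map g f) i ≡ g (coeff f i)
coeff-map g g0 []      i       = ≡.sym g0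
coeff-map g g0 (a ∷ f) zero    = ≡.refl
coeff-map g g0 (a ∷ f) (suc i) = coeff-map g g0 f i

coeff-shift< : ∀ {m i} f → i ℕ.< m → coeff (X^ m *ₚ f) i ≡ 0ℤ
coeff-shift< {suc m} {zero}  f _         = ≡.refl
coeff-shift< {suc m} {suc i} f (ℕ.s≤s h) = coeff-shift< f h

coeff-shift : ∀ m f i → coeff (X^ m *ₚ f) (m ℕ.+ i) ≡ coeff f i
coeff-shift zero    f i = ≡.refl
coeff-shift (suc m) f i = coeff-shift m f i

coeff-drop : ∀ m f i → coeff (drop m f) i ≡ coeff f (m ℕ.+ i)
coeff-drop zero    f       i = ≡.refl
coeff-drop (suc m) []      i = ≡.refl
coeff-drop (suc m) (a ∷ f) i = coeff-drop m f i

Ternary : ℤ → Set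
Ternary a = a ≡ 0ℤ ⊎ a ≡ 1ℤ ⊎ a ≡ -1ℤ

∣∣≤1⇒ternary : ∀ a → ℤ.∣ a ∣ ℕ.≤ 1 → Ternary a
∣∣≤1⇒ternary (+ 0)      _ = inj₁ ≡.refl
∣∣≤1⇒ternary (+ 1)      _ = inj₂ (inj₁ ≡.refl)
∣∣≤1⇒ternary -[1+ 0 ]   _ = inj₂ (inj₂ ≡.refl)
∣∣≤1⇒ternary (+ suc (suc _)) (ℕ.s≤s ())
∣∣≤1⇒ternary -[1+ suc _ ]    (ℕ.s≤s ())

-- The construction of `Φᵀ` with the half exponent and the polynomial as parameters, so that it can
-- be applied to the opaque `Φ°`.
transform : ℕ → Poly → Poly
transform m f = posPart f +ₚ (X^ m *ₚ negPart f)

-- Reducing the exponents by Xᵐ = -1 turns a set of exponents of transform m f into the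
-- polynomial fold T; its coefficients are those of f where T selects them, and 0 elsewhere.
module Folding {m n D} (n≡m+m : n ≡ m ℕ.+ m) (D<m : D ℕ.< m) (f : Poly) (f-below : DegBelow f (suc D))
               (ternary : ∀ i → Ternary (coeff f i)) where

  t : Poly
  t = transform m f

  t-low : ∀ {i} → i ℕ.< m → coeff t i ≡ coeff f i ℤ.⊔ 0ℤ
  t-low {i} i<m = ≡.trans (coeff-+ (posPart f) _ i) (≡.trans
    (cong₂ ℤ._+_ (coeff-map (λ a → a ℤ.⊔ 0ℤ) ≡.refl f i) (coeff-shift< (negPart f) i<m)) (ℤ.+-identityʳ _))

  f-high : ∀ i → coeff f (m ℕ.+ i) ≡ 0ℤ
  f-high i = vanish f-below (m ℕ.+ i) (ℕ.≤-trans D<m (ℕ.m≤m+n m i))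

  -- As D < m, the positive part of f does not reach the exponent m + i.
  t-high : ∀ i → coeff t (m ℕ.+ i) ≡ (ℤ.- coeff f i) ℤ.⊔ 0ℤ
  t-high i = ≡.trans (coeff-+ (posPart f) _ (m ℕ.+ i)) (≡.trans
    (cong₂ ℤ._+_ (≡.trans (coeff-map (λ a → a ℤ.⊔ 0ℤ) ≡.refl f (m ℕ.+ i)) (cong (ℤ._⊔ 0ℤ) (f-high i)))
      (≡.trans (coeff-shift m (negPart f) i) (coeff-map (λ a → (ℤ.- a) ℤ.⊔ 0ℤ) ≡.refl f i))) (ℤ.+-identityˡ _))

  data Position (i : ℕ) : Set where
    low  : i ℕ.< m → Position i
    high : ∀ j → i ≡ m ℕ.+ j → Position i

  position : ∀ i → Position i
  position i with i ℕ.<? m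
  ... | yes i<m = low i<m
  ... | no i≮m  = high (i ℕ.∸ m) (≡.sym (ℕ.m+[n∸m]≡n (ℕ.≮⇒≥ i≮m)))

  binary-⊔ : ∀ {a} → Ternary a → a ℤ.⊔ 0ℤ ≡ 0ℤ ⊎ a ℤ.⊔ 0ℤ ≡ 1ℤ
  binary-⊔ (inj₁ ≡.refl)        = inj₁ ≡.refl
  binary-⊔ (inj₂ (inj₁ ≡.refl)) = inj₂ ≡.refl
  binary-⊔ (inj₂ (inj₂ ≡.refl)) = inj₁ ≡.refl

  binary-neg⊔ : ∀ {a} → Ternary a → (ℤ.- a) ℤ.⊔ 0ℤ ≡ 0ℤ ⊎ (ℤ.- a) ℤ.⊔ 0ℤ ≡ 1ℤ
  binary-neg⊔ (inj₁ ≡.refl)        = inj₁ ≡.refl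
  binary-neg⊔ (inj₂ (inj₁ ≡.refl)) = inj₁ ≡.refl
  binary-neg⊔ (inj₂ (inj₂ ≡.refl)) = inj₂ ≡.refl

  t-binary : ∀ i → coeff t i ≡ 0ℤ ⊎ coeff t i ≡ 1ℤ
  t-binary i with position i
  ... | low i<m         = subst (λ a → a ≡ 0ℤ ⊎ a ≡ 1ℤ) (≡.sym (t-low i<m)) (binary-⊔ (ternary i))
  ... | high j ≡.refl   = subst (λ a → a ≡ 0ℤ ⊎ a ≡ 1ℤ) (≡.sym (t-high j)) (binary-neg⊔ (ternary j))

  t-below : ∀ i → n ℕ.≤ i → coeff t i ≡ 0ℤ
  t-below i n≤i with position i
  ... | low i<m = contradiction (ℕ.<-≤-trans i<m (ℕ.m≤m+n m m)) (ℕ.≤⇒≯ (subst (ℕ._≤ i) n≡m+m n≤i))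
  ... | high j ≡.refl = ≡.trans (t-high j) (cong (λ a → (ℤ.- a) ℤ.⊔ 0ℤ)
          (vanish f-below j (ℕ.≤-trans D<m (ℕ.+-cancelˡ-≤ m m j (subst (ℕ._≤ m ℕ.+ j) n≡m+m n≤i)))))

  fold : Subset n → Poly
  fold T = take m (indicator T) ⊕ ⊝ (drop m (indicator T))

  χ : Subset n → ℕ → ℤ
  χ T = coeff (indicator T)

  fold-coeff : ∀ T {i} → i ℕ.< m → coeff (fold T) i ≡ χ T i ℤ.+ -1ℤ ℤ.* χ T (m ℕ.+ i)
  fold-coeff T {i} i<m = ≡.trans (coeff-⊕ (take m (indicator T)) _ i) (cong₂ ℤ._+_
    (coeff-take m (indicator T) i<m)
        (≡.trans (coeff-⊝ (drop m (indicator T)) i) (cong (-1ℤ ℤ.*_) (coeff-drop m (indicator T) i))))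

  fold-below : ∀ T → DegBelow (fold T) m
  fold-below T = below-⊕ (below-take m (indicator T)) (below-⊝ (mk-below λ i m≤i →
    ≡.trans (coeff-drop m (indicator T) i)
      (vanish (indicator-below T) (m ℕ.+ i) (subst (ℕ._≤ m ℕ.+ i) (≡.sym n≡m+m) (ℕ.+-monoʳ-≤ m m≤i)))))

  S : Subset n
  S = exponents n t

  module _ {T : Subset n} (T⊆S : T ⊆ S) where

    t≡0⇒χ≡0 : ∀ i → coeff t i ≡ 0ℤ → χ T i ≡ 0ℤ
    t≡0⇒χ≡0 i tᵢ≡0 with indicator-cases T i
    ... | inj₁ χ≡0 = χ≡0
    ... | inj₂ (_ , x , x∈T , ≡.refl) =
      contradiction (≡.trans (≡.sym (exponents-∈ {n} {t} (T⊆S x∈T))) tᵢ≡0) 1≢0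

    -- The coefficient of f at i decides which of the exponents i and m + i belong to S, and so may
    -- belong to T: neither if it is 0, only i if it is 1, only m + i if it is -1.
    data Fold (i : ℕ) : Set where
      zero : coeff f i ≡ 0ℤ → coeff (fold T) i ≡ 0ℤ → Fold i
      pos  : coeff f i ≡ 1ℤ → coeff (fold T) i ≡ χ T i → Fold i
      neg  : coeff f i ≡ -1ℤ → coeff (fold T) i ≡ -1ℤ ℤ.* χ T (m ℕ.+ i) → Fold i

    fold-view : ∀ {i} → i ℕ.< m → Fold i
    fold-view {i} i<m with ternary i
    ... | inj₁ f≡0 = zero f≡0 (≡.trans (fold-coeff T i<m) (cong₂ (λ a b → a ℤ.+ -1ℤ ℤ.* b)
            (t≡0⇒χ≡0 i (≡.trans (t-low i<m) (cong (ℤ._⊔ 0ℤ) f≡0)))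
            (t≡0⇒χ≡0 (m ℕ.+ i) (≡.trans (t-high i) (cong (λ a → (ℤ.- a) ℤ.⊔ 0ℤ) f≡0)))))
    ... | inj₂ (inj₁ f≡1) = pos f≡1 (≡.trans (fold-coeff T i<m) (≡.trans (cong (λ b → χ T i ℤ.+ -1ℤ ℤ.* b)
            (t≡0⇒χ≡0 (m ℕ.+ i) (≡.trans (t-high i) (cong (λ a → (ℤ.- a) ℤ.⊔ 0ℤ) f≡1)))) (ℤ.+-identityʳ _)))
    ... | inj₂ (inj₂ f≡-1) = neg f≡-1 (≡.trans (fold-coeff T i<m) (≡.trans (cong (λ a → a ℤ.+ -1ℤ ℤ.* χ T (m ℕ.+ i))
            (t≡0⇒χ≡0 i (≡.trans (t-low i<m) (cong (ℤ._⊔ 0ℤ) f≡-1)))) (ℤ.+-identityˡ _)))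

    fold-cases : ∀ i → coeff (fold T) i ≡ 0ℤ ⊎ coeff (fold T) i ≡ coeff f i
    fold-cases i with i ℕ.<? m
    ... | no i≮m  = inj₁ (vanish (fold-below T) i (ℕ.≮⇒≥ i≮m))
    ... | yes i<m with fold-view i<m
    ...   | zero _ h≡0 = inj₁ h≡0
    ...   | pos f≡1 h≡ with indicator-cases T i
    ...     | inj₁ χ≡0       = inj₁ (≡.trans h≡ χ≡0)
    ...     | inj₂ (χ≡1 , _) = inj₂ (≡.trans h≡ (≡.trans χ≡1 (≡.sym f≡1)))
    fold-cases i | yes i<m | neg f≡-1 h≡ with indicator-cases T (m ℕ.+ i)
    ...     | inj₁ χ≡0       = inj₁ (≡.trans h≡ (cong (-1ℤ ℤ.*_) χ≡0))
    ...     | inj₂ (χ≡1 , _) = inj₂ (≡.trans h≡ (≡.trans (cong (-1ℤ ℤ.*_) χ≡1) (≡.sym f≡-1)))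

    -- The index i is x reduced modulo m, and x is the only element of S with this residue, so
    -- `fold T` shows whether x is in T. An x in T makes `fold T` nonzero; an x in S outside T makes
    -- it differ from f.
    fold-at : ∀ {x} → x ∈ S → ∃ λ i → coeff f i ≢ 0ℤ ×
        (coeff (fold T) i ≡ χ T (toℕ x) ⊎ coeff (fold T) i ≡ -1ℤ ℤ.* χ T (toℕ x))
    fold-at {x} x∈S with position (toℕ x) | exponents-∈ {n} {t} x∈S
    ... | low x<m | tₓ≡1 with fold-view x<m
    ...   | zero f≡0 _  = contradiction (≡.trans (≡.sym tₓ≡1) (≡.trans (t-low x<m) (cong (ℤ._⊔ 0ℤ) f≡0))) 1≢0
    ...   | neg f≡-1 _  = contradiction (≡.trans (≡.sym tₓ≡1) (≡.trans (t-low x<m) (cong (ℤ._⊔ 0ℤ) f≡-1))) 1≢0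
    ...   | pos f≡1 h≡  = toℕ x , (λ f≡0 → 1≢0 (≡.trans (≡.sym f≡1) f≡0)) , inj₁ h≡
    fold-at {x} x∈S | high j x≡m+j | tₓ≡1 with fold-view {j}
        (ℕ.+-cancelˡ-< m j m (≡.subst₂ ℕ._<_ x≡m+j n≡m+m (Fin.toℕ<n x)))
    ...   | zero f≡0 _  = contradiction
        (≡.trans (≡.sym tₓ≡1) (≡.trans (cong (coeff t) x≡m+j)
            (≡.trans (t-high j) (cong (λ a → (ℤ.- a) ℤ.⊔ 0ℤ) f≡0)))) 1≢0
    ...   | pos f≡1 _   = contradiction
        (≡.trans (≡.sym tₓ≡1) (≡.trans (cong (coeff t) x≡m+j)
            (≡.trans (t-high j) (cong (λ a → (ℤ.- a) ℤ.⊔ 0ℤ) f≡1)))) 1≢0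
    ...   | neg f≡-1 h≡ = j , (λ f≡0 → contradiction (≡.trans (≡.sym f≡-1) f≡0) λ ()) ,
              inj₂ (≡.trans h≡ (cong (λ i → -1ℤ ℤ.* χ T i) (≡.sym x≡m+j)))

    fold-degree : DegBelow (fold T) (suc D)
    fold-degree = mk-below λ i D<i → [ (λ h≡0 → h≡0) , (λ h≡f → ≡.trans h≡f (vanish f-below i D<i)) ]′ (fold-cases i)

  S⊆S : S ⊆ S
  S⊆S x∈S = x∈S

  fold-full : fold S ≋ f
  fold-full = mk≋ λ i → go i (i ℕ.<? m)
    where
    1-at : ∀ i → i ℕ.< n → coeff t i ≡ 1ℤ → χ S i ≡ 1ℤ
    1-at i i<n e = ≡.trans (cong (χ S) (≡.sym x≡i))
        (indicator-∈ {T = S} (∈-exponents {n} {t} (≡.trans (cong (coeff t) x≡i) e)))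
      where
      x≡i : toℕ (fromℕ< i<n) ≡ i
      x≡i = Fin.toℕ-fromℕ< i<n
    go : ∀ i → Dec (i ℕ.< m) → coeff (fold S) i ≡ coeff f i
    go i (no i≮m) = ≡.trans (vanish (fold-below S) i (ℕ.≮⇒≥ i≮m))
        (≡.sym (vanish f-below i (ℕ.≤-trans D<m (ℕ.≮⇒≥ i≮m))))
    go i (yes i<m) with fold-view S⊆S i<m
    ... | zero f≡0 h≡0 = ≡.trans h≡0 (≡.sym f≡0)
    ... | pos f≡1 h≡ = ≡.trans h≡ (≡.trans
            (1-at i (subst (i ℕ.<_) (≡.sym n≡m+m) (ℕ.<-≤-trans i<m (ℕ.m≤m+n m m)))
                (≡.trans (t-low i<m) (cong (ℤ._⊔ 0ℤ) f≡1))) (≡.sym f≡1))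
    ... | neg f≡-1 h≡ = ≡.trans h≡ (≡.trans (cong (-1ℤ ℤ.*_)
            (1-at (m ℕ.+ i) (subst (m ℕ.+ i ℕ.<_) (≡.sym n≡m+m) (ℕ.+-monoʳ-< m i<m))
                (≡.trans (t-high i) (cong (λ a → (ℤ.- a) ℤ.⊔ 0ℤ) f≡-1)))) (≡.sym f≡-1))

-- Sums of roots of unity as values of polynomials

module RootSums (K : CommutativeRing 0ℓ 0ℓ) where
  open CommutativeRing K hiding (zero)
  open IntegerScalars K
  open Evaluation K
  open import Algebra.Properties.Semiring.Exp semiring using (_^_)
  open import Algebra.Properties.Semiring.Sum semiring using (sum; *-distribˡ-sum; sum-cong-≋)
  open Solver using (solve; con; _:=_; _:+_; _:*_; _:-_; :-_)
  open import Relation.Binary.Reasoning.Setoid setoid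

  -- `rootSum` over an arbitrary commutative ring; over `ℂ-ring` both agree by definition.
  subsetSum : ∀ {n} → Carrier → Subset n → Carrier
  subsetSum ζ T = sum λ k → if lookup T k then ζ ^ toℕ k else 0#

  subsetSum≈eval : ∀ {n} ζ (T : Subset n) → subsetSum ζ T ≈ eval ζ (indicator T)
  subsetSum≈eval ζ []      = refl
  subsetSum≈eval ζ (b ∷ T) = +-cong (head b) (begin
    sum (λ k → if lookup T k then ζ * ζ ^ toℕ k else 0#)     ≈⟨ sum-cong-≋ (λ k → factor (lookup T k) (ζ ^ toℕ k)) ⟩
    sum (λ k → ζ * (if lookup T k then ζ ^ toℕ k else 0#))
      ≈⟨ *-distribˡ-sum ζ (λ k → if lookup T k then ζ ^ toℕ k else 0#) ⟨
    ζ * subsetSum ζ T                                        ≈⟨ *-congˡ (subsetSum≈eval ζ T) ⟩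
    ζ * eval ζ (indicator T)                                 ∎)
    where
    head : ∀ b → (if b then 1# else 0#) ≈ ι (if b then 1ℤ else 0ℤ)
    head true  = refl
    head false = refl
    factor : ∀ b y → (if b then ζ * y else 0#) ≈ ζ * (if b then y else 0#)
    factor true  y = refl
    factor false y = sym (zeroʳ ζ)

  eval-take-drop : ∀ x m f → eval x f ≈ eval x (take m f) + x ^ m * eval x (drop m f)
  eval-take-drop x zero    f       = sym (trans (+-identityˡ _) (*-identityˡ _))
  eval-take-drop x (suc m) []      = sym (trans (+-identityˡ _) (zeroʳ _))
  eval-take-drop x (suc m) (a ∷ f) = begin
    ι a + x * eval x f                                             ≈⟨ +-congˡ (*-congˡ (eval-take-drop x m f)) ⟩
    ι a + x * (eval x (take m f) + x ^ m * eval x (drop m f))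
      ≈⟨ solve 5 (λ a x u y v → a :+ x :* (u :+ y :* v) := (a :+ x :* u) :+ x :* y :* v) refl (ι a) x
          (eval x (take m f)) (x ^ m) (eval x (drop m f)) ⟩
    (ι a + x * eval x (take m f)) + x * x ^ m * eval x (drop m f)  ∎

-- Vanishing and minimality of the sum

module Minimality (K : CommutativeRing 0ℓ 0ℓ) (dom : IsDomain₀ K) where
  open CommutativeRing K hiding (zero)
  open IntegerScalars K using (module Solver)
  open Evaluation K
  open IsDomain₀ dom
  open PrimitiveRoots K dom
  open RootSums K
  open import Algebra.Properties.Semiring.Exp semiring using (_^_; ^-homo-*)
  open import Algebra.Properties.Group +-group using (x∙y⁻¹≈ε⇒x≈y; x≈y⇒x∙y⁻¹≈ε; inverseˡ-unique)
  open Solver using (solve; con; _:=_; _:+_; _:*_; _:-_; :-_)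
  open import Relation.Binary.Reasoning.Setoid setoid

  module FlatSum {m n D} (n≡m+m : n ≡ m ℕ.+ m) (1<m : 1 ℕ.< m) (D<m : D ℕ.< m) (Φ-monic : Monic (Φ° n) D)
           (ternary : ∀ i → Ternary (coeff (Φ° n) i))
           (ζ : Carrier) (ζ^n≈1 : ζ ^ n ≈ 1#) (order≥ : ∀ k → 0 ℕ.< k → k ℕ.< n → ¬ ζ ^ k ≈ 1#) where

    private
      m<n : m ℕ.< n
      m<n = subst (m ℕ.<_) (≡.sym n≡m+m) (ℕ.m<m+n m (ℕ.<-trans (ℕ.s≤s ℕ.z≤n) 1<m))

    open Folding n≡m+m D<m (Φ° n) (above Φ-monic) ternary
    open Root (ℕ.<-trans 1<m m<n) ζ ζ^n≈1 order≥ using (Φ-root; Φ-minimal)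

    -- (ζᵐ - 1)(ζᵐ + 1) = ζⁿ - 1 = 0, and the first factor is nonzero because m < n.
    ζ^m≈-1 : ζ ^ m ≈ - 1#
    ζ^m≈-1 = inverseˡ-unique (ζ ^ m) 1# (zero-product
      (λ e → order≥ m (ℕ.<-trans (ℕ.s≤s ℕ.z≤n) 1<m) m<n (x∙y⁻¹≈ε⇒x≈y _ _ e)) (begin
      (ζ ^ m - 1#) * (ζ ^ m + 1#)
        ≈⟨ solve 1 (λ y → (y :- con 1ℤ) :* (y :+ con 1ℤ) := y :* y :- con 1ℤ) refl (ζ ^ m) ⟩
      ζ ^ m * ζ ^ m - 1#             ≈⟨ +-congʳ (^-homo-* ζ m m) ⟨
      ζ ^ (m ℕ.+ m) - 1#             ≡⟨ cong (λ k → ζ ^ k - 1#) n≡m+m ⟨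
      ζ ^ n - 1#                     ≈⟨ x≈y⇒x∙y⁻¹≈ε ζ^n≈1 ⟩
      0#                             ∎))

    subsetSum≈fold : ∀ T → subsetSum ζ T ≈ eval ζ (fold T)
    subsetSum≈fold T = begin
      subsetSum ζ T                                ≈⟨ subsetSum≈eval ζ T ⟩
      eval ζ I                                     ≈⟨ eval-take-drop ζ m I ⟩
      eval ζ (take m I) + ζ ^ m * eval ζ (drop m I)
        ≈⟨ +-congˡ (trans (*-congʳ ζ^m≈-1) (solve 1 (λ y → (:- con 1ℤ) :* y := :- y) refl (eval ζ (drop m I)))) ⟩
      eval ζ (take m I) - eval ζ (drop m I)        ≈⟨ trans (eval-⊕ ζ (take m I) _) (+-congˡ (eval-⊝ ζ (drop m I))) ⟨
      eval ζ (fold T)                              ∎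
      where
      I : Poly
      I = indicator T

    full-sum : subsetSum ζ S ≈ 0#
    full-sum = trans (subsetSum≈fold S) (trans (eval-cong ζ fold-full) Φ-root)

    -- The exponent D occurs, as the leading coefficient of `Φ° n` is 1.
    full-nonempty : Nonempty S
    full-nonempty = x , ∈-exponents {n} {t} {x} (≡.trans (cong (coeff t) (Fin.toℕ-fromℕ< D<n))
      (≡.trans (t-low D<m) (cong (ℤ._⊔ 0ℤ) (top Φ-monic))))
      where
      D<n : D ℕ.< n
      D<n = ℕ.<-trans D<m m<n
      x : Fin n
      x = fromℕ< D<n

    -- Either fold T or Φ - fold T has degree below that of Φ, so one of them is zero.
    no-proper-sum : ∀ T → T ⊂ S → Nonempty T → ¬ subsetSum ζ T ≈ 0#
    no-proper-sum T (T⊆S , y , y∈S , y∉T) (x , x∈T) sum≈0 =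
      [ (λ h≡0 → fold≢[] (Φ-minimal Φ-monic (fold T) (lower (fold T) (fold-degree T⊆S) h≡0) fold≈0))
      , (λ h≡f → fold≢Φ (Φ-minimal Φ-monic difference (lower difference difference-below (difference-top h≡f))
          difference≈0))
      ]′ (fold-cases T⊆S D)
      where
      fold≈0 : eval ζ (fold T) ≈ 0#
      fold≈0 = trans (sym (subsetSum≈fold T)) sum≈0
      lower : ∀ h → DegBelow h (suc D) → coeff h D ≡ 0ℤ → DegBelow h D
      lower h b h≡0 = mk-below λ i D≤i → [ vanish b i , (λ { ≡.refl → h≡0 }) ]′ (ℕ.m≤n⇒m<n∨m≡n D≤i)
      fold≢[] : ¬ fold T ≋ []
      fold≢[] e with fold-at T⊆S (T⊆S x∈T)
      ... | i , _ , inj₁ h≡χ  = 1≢0 (≡.trans (≡.sym (indicator-∈ x∈T)) (≡.trans (≡.sym h≡χ) (at e i)))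
      ... | i , _ , inj₂ h≡-χ = contradiction
          (≡.trans (≡.sym (cong (-1ℤ ℤ.*_) (indicator-∈ x∈T))) (≡.trans (≡.sym h≡-χ) (at e i))) λ ()
      difference : Poly
      difference = Φ° n ⊕ ⊝ (fold T)
      difference-coeff : ∀ i → coeff difference i ≡ coeff (Φ° n) i ℤ.+ -1ℤ ℤ.* coeff (fold T) i
      difference-coeff i = ≡.trans (coeff-⊕ (Φ° n) _ i) (cong (λ a → coeff (Φ° n) i ℤ.+ a) (coeff-⊝ (fold T) i))
      difference-below : DegBelow difference (suc D)
      difference-below = below-⊕ (above Φ-monic) (below-⊝ (fold-degree T⊆S))
      difference-top : coeff (fold T) D ≡ coeff (Φ° n) D → coeff difference D ≡ 0ℤ
      difference-top h≡f = ≡.trans (difference-coeff D)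
          (cong₂ (λ a b → a ℤ.+ -1ℤ ℤ.* b) (top Φ-monic) (≡.trans h≡f (top Φ-monic)))
      difference≈0 : eval ζ difference ≈ 0#
      difference≈0 = begin
        eval ζ difference                  ≈⟨ trans (eval-⊕ ζ (Φ° n) _) (+-congˡ (eval-⊝ ζ (fold T))) ⟩
        eval ζ (Φ° n) - eval ζ (fold T)    ≈⟨ +-cong Φ-root (-‿cong fold≈0) ⟩
        0# - 0#                            ≈⟨ -‿inverseʳ 0# ⟩
        0#                                 ∎
      -- At the index belonging to y, which is in S but not in T, `fold T` vanishes and `Φ° n` does
      -- not.
      fold≢Φ : ¬ difference ≋ []
      fold≢Φ e with fold-at T⊆S y∈S
      ... | i , f≢0 , h≡ = f≢0 (≡.trans (≡.sym (ℤ.+-identityʳ _)) (≡.trans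
              (cong (λ a → coeff (Φ° n) i ℤ.+ -1ℤ ℤ.* a) (≡.sym (h≡0 h≡)))
                  (≡.trans (≡.sym (difference-coeff i)) (at e i))))
        where
        h≡0 : coeff (fold T) i ≡ χ T (toℕ y) ⊎ coeff (fold T) i ≡ -1ℤ ℤ.* χ T (toℕ y) → coeff (fold T) i ≡ 0ℤ
        h≡0 (inj₁ e) = ≡.trans e (indicator-∉ y∉T)
        h≡0 (inj₂ e) = ≡.trans e (cong (-1ℤ ℤ.*_) (indicator-∉ y∉T))

-- Reduction to twice an odd number

odd-product : ∀ {k} (p : Vector ℕ k) → (∀ i → Prime (p i)) → (∀ i → 2 ℕ.< p i) → ¬ 2 ∣ⁿ Vector.foldr ℕ._*_ 1 p
odd-product {zero}  p pr >2 2∣1 = contradiction (ℕ∣.∣⇒≤ 2∣1) λ { (ℕ.s≤s ()) }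
odd-product {suc k} p pr >2 2∣p*q with euclidsLemma (p Fin.zero) _ prime[2] 2∣p*q
... | inj₂ 2∣q = odd-product (p ∘ Fin.suc) (pr ∘ Fin.suc) (>2 ∘ Fin.suc) 2∣q
... | inj₁ 2∣p with prime⇒irreducible (pr Fin.zero) 2∣p
...   | inj₂ 2≡p = ℕ.<⇒≢ (>2 Fin.zero) 2≡p

¬2∣⇒odd : ∀ m → ¬ 2 ∣ⁿ m → m ≡ suc ((m / 2) ℕ.* 2)
¬2∣⇒odd m 2∤m = go (m % 2) (m%n<n m 2) (m≡m%n+[m/n]*n m 2)
  where
  go : ∀ r → r ℕ.< 2 → m ≡ r ℕ.+ (m / 2) ℕ.* 2 → m ≡ suc ((m / 2) ℕ.* 2)
  go 0 _ e = contradiction (divides (m / 2) e) 2∤m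
  go 1 _ e = e
  go (suc (suc r)) (ℕ.s≤s (ℕ.s≤s ())) _

flat-odd : ∀ {m} → 1 ℕ.< m → ¬ 2 ∣ⁿ m → Flat (Φ (2 ℕ.* m)) → ∀ ζ → IsPrimitiveRoot (2 ℕ.* m) ζ →
           MinimalVanishingSum (2 ℕ.* m) ζ (Φᵀ (2 ℕ.* m))
flat-odd {m} 1<m 2∤m flat ζ (ζ^n≈1 , order≥) = subst (MinimalVanishingSum n ζ) (≡.sym Φᵀ≡)
  (t-binary , t-below , (full-nonempty , full-sum) , no-proper-sum)
  where
  n h : ℕ
  n = 2 ℕ.* m
  h = m / 2
  n≡m+m : n ≡ m ℕ.+ m
  n≡m+m = cong (m ℕ.+_) (ℕ.+-identityʳ m)
  m≡ : m ≡ suc (h ℕ.* 2)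
  m≡ = ¬2∣⇒odd m 2∤m
  0<h : 0 ℕ.< h
  0<h = ℕ.n≢0⇒n>0 λ h≡0 → ℕ.<⇒≢ 1<m (≡.sym (≡.trans m≡ (cong (λ h → suc (h ℕ.* 2)) h≡0)))
  Φ°-exact : Exact n
  Φ°-exact = Φ-exact (subst (0 ℕ.<_) (≡.sym n≡m+m) (ℕ.≤-trans (ℕ.<-trans (ℕ.s≤s ℕ.z≤n) 1<m) (ℕ.m≤m+n m m)))
  D : ℕ
  D = Exact.deg Φ°-exact
  mono : Monic (Φ° n) D
  mono = Exact.monic Φ°-exact
  D<m : D ℕ.< m
  D<m = degree-Φ-2* h 0<h m≡ mono
  ternary : ∀ i → Ternary (coeff (Φ° n) i)
  ternary i = ∣∣≤1⇒ternary _ (ℕ.≤-trans (coeff≤height (Φ° n) i)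
      (ℕ.≤-reflexive (≡.trans (cong height (≡.sym (Φ≡Φ° n))) flat)))
  open Folding n≡m+m D<m (Φ° n) (above mono) ternary using (t-binary; t-below)
  open Minimality ℂ-ring ℂ-domain using (module FlatSum)
  open FlatSum n≡m+m 1<m D<m mono ternary ζ ζ^n≈1 order≥ using (full-nonempty; full-sum; no-proper-sum)
  Φᵀ≡ : Φᵀ n ≡ transform m (Φ° n)
  Φᵀ≡ = cong₂ transform (≡.trans (cong (_/ 2) (ℕ.*-comm 2 m)) (m*n/n≡m m 2)) (Φ≡Φ° n)

open import Data.Nat.Base using (_*_; _<_; _≥_)
open import Data.Vec.Functional using (foldr)

lemma2p1 : (k : ℕ) → k ≥ 1 →
    (p : Vector ℕ (suc k)) →
    p zero ≡ 2 →
    (∀ i → Prime (p i)) →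
    (∀ i j → i Fin.< j → p i < p j) →
    (n : ℕ) → n ≡ foldr _*_ 1 p →
    Flat (Φ n) →
    (ζ : ℂ) → IsPrimitiveRoot n ζ →
    MinimalVanishingSum n ζ (Φᵀ n)
lemma2p1 (suc k) k≥1 p p₀≡2 prime increasing n n≡ = subst
  -- The result for 2m is transported along n = p₀ m = 2m, where m is the product of the odd primes.
  (λ n → Flat (Φ n) → ∀ ζ → IsPrimitiveRoot n ζ → MinimalVanishingSum n ζ (Φᵀ n))
  (≡.sym (≡.trans n≡ (cong (ℕ._* m) p₀≡2))) (flat-odd {m} 1<m (odd-product q (prime ∘ Fin.suc) >2))
  where
  q : Vector ℕ (suc k)
  q = p ∘ Fin.suc
  m : ℕ
  m = foldr ℕ._*_ 1 q
  >2 : ∀ i → 2 ℕ.< q i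
  >2 i = subst (ℕ._< q i) p₀≡2 (increasing Fin.zero (Fin.suc i) (ℕ.s≤s ℕ.z≤n))
  1<m : 1 ℕ.< m
  -- The value 0 is excluded by oddness and the value 1 by the prime factor p₁, which exists because
  -- k ≥ 1.
  1<m = ℕ.≤∧≢⇒< (ℕ.n≢0⇒n>0 m≢0) (λ 1≡m → m≢1 (≡.sym 1≡m))
    where
    m≢0 : m ≢ 0
    m≢0 m≡0 = odd-product q (prime ∘ Fin.suc) >2 (subst (2 ∣ⁿ_) (≡.sym m≡0) (2 ℕ∣.∣0))
    m≢1 : m ≢ 1
    m≢1 m≡1 = prime≢1 (prime (Fin.suc Fin.zero)) (ℕ.m*n≡1⇒m≡1 (q Fin.zero) _ m≡1)
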